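{- Let $n$ be a positive integer, let $\zeta_n$ be a primitive $n$-th root of unity, and let $u_1,u_2,u_3$ be formal variables. Then $$\sum_{k,l,s\geq 0}G_n^t(k,l,s;\zeta_n)\,u_1^{k-l-s}u_2^{l-s}u_3^s=\frac{U_n^{t-1}(u_1,u_2,u_3)}{U_n^t(u_1,u_2,u_3)},$$ where $$U_n^t(u_1,u_2,u_3)=\sum_{\substack{a,b\geq 0\\ a+b\leq n-1}}\frac{1}{n-a-b}\binom{n-a-1}{b}\binom{n-b-1}{a}\,t^{n-a-b-1}(1+u_1)^a(1-tu_2)^b(u_3-u_1u_2)^{n-a-b-1},$$ and $U_n^{t-1}$ is obtained from $U_n^t$ by replacing $t$ with $t-1$.
   Context: $\mathbb{N}$ is the set of positive integers and $t$ is a formal parameter. For a multi-index $\mathbf{k}=(k_1,\ldots,k_l)\in\mathbb{N}^l$ define the weight $\mathrm{wt}(\mathbf{k})=k_1+\cdots+k_l$, the depth $\mathrm{dep}(\mathbf{k})=l$, and the height ($1$-height) $\#\{j\mid k_j\geq 2\}$. Let $q$ be a complex number with $q^m\ne1$ for every positive integer $m<n$ (e.g. $q=\zeta_n$). For $\mathbf{k}\in\mathbb{N}^l$ with $l\ge 1$, $$\overline{z}_n(\mathbf{k};q)=\sum_{n>m_1>\cdots>m_l>0}\frac{q^{(k_1-1)m_1+\cdots+(k_l-1)m_l}}{(1-q^{m_1})^{k_1}\cdots(1-q^{m_l})^{k_l}},$$ and its interpolated version is $$\overline{z}_n^t(\mathbf{k};q)=\sum_{\mathbf{p}}\overline{z}_n(\mathbf{p};q)\,t^{l-\mathrm{dep}(\mathbf{p})},$$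 where the sum runs over all $3^{l-1}$ ways of forming $\mathbf{p}=(k_1\Box\cdots\Box k_l)$ by filling each $\Box$ with "," (comma), "$+$" or "$-1+$". For nonnegative integers $k,l,s$, $G_n^t(k,l,s;q)$ is the sum of $\overline{z}_n^t(\mathbf{k};q)$ over all multi-indices $\mathbf{k}$ of weight $k$, depth $l$ and height $s$; it is $0$ when there are no such multi-indices, except that $G_n^t(0,0,0;q)=1$. The identity is one of formal power series in $u_1,u_2,u_3$. -}

module Defs where

open import Algebra.Apartness.Bundles using (HeytingField; HeytingCommutativeRing)
open import Algebra.Bundles using (CommutativeRing)
open import Algebra.Bundles.Raw using (RawRing)
import Algebra.Definitions.RawSemiring as RawSemiringOps
open import Data.Fin.Base using (toℕ)
open import Data.Fin.Properties using (toℕ<n)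
open import Data.List.Base using (List; []; _∷_; _++_; map; concatMap; filter; foldr; length; upTo)
open import Data.Nat.Base as ℕ using (ℕ; zero; suc; _∸_; _<_; s≤s; z≤n)
open import Data.Nat.Combinatorics using (_C_)
import Data.Nat.ListAction as ListAction
open import Data.Nat.Properties using (_≟_; _≤?_; <-trans)
open import Data.Product.Base using (proj₁)
open import Level using (_⊔_)
open import Relation.Nullary.Decidable using (_×-dec_)

module Polynomials {c ℓ} (R : RawRing c ℓ) where
  open RawRing R

  infixl 6 _⊕_
  infixl 7 _⊛_

  coeff : List Carrier → ℕ → Carrier
  coeff []      _       = 0#
  coeff (a ∷ p) zero    = a
  coeff (a ∷ p) (suc i) = coeff p i

  _⊕_ : List Carrier → List Carrier → List Carrier
  []      ⊕ q       = q
  (a ∷ p) ⊕ []      = a ∷ p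
  (a ∷ p) ⊕ (b ∷ q) = (a + b) ∷ (p ⊕ q)

  _⊛_ : List Carrier → List Carrier → List Carrier
  []      ⊛ q = []
  (a ∷ p) ⊛ q = map (a *_) q ⊕ (0# ∷ (p ⊛ q))

  -- R[X]: coefficient lists, constant term first.  Trailing zeros are
  -- allowed, so equality is coefficientwise, not equality of lists.
  polynomials : RawRing c ℓ
  polynomials = record
    { Carrier = List Carrier
    ; _≈_     = λ p q → ∀ i → coeff p i ≈ coeff q i
    ; _+_     = _⊕_
    ; _*_     = _⊛_
    ; -_      = map (-_)
    ; 0#      = []
    ; 1#      = 1# ∷ []
    }

  constant : Carrier → List Carrier
  constant a = a ∷ []

  X : List Carrier
  X = 0# ∷ 1# ∷ []

module PowerSeries {c ℓ} (R : RawRing c ℓ) where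
  open RawRing R
  open RawSemiringOps rawSemiring using (sum)

  constant : Carrier → ℕ → Carrier
  constant a zero    = a
  constant a (suc _) = 0#

  X : ℕ → Carrier
  X 1 = 1#
  X _ = 0#

  -- R[[X]]: f stands for Σᵢ f(i) Xⁱ.
  powerSeries : RawRing c ℓ
  powerSeries = record
    { Carrier = ℕ → Carrier
    ; _≈_     = λ f g → ∀ i → f i ≈ g i
    ; _+_     = λ f g i → f i + g i
    ; _*_     = λ f g i → sum {suc i} λ j → f (toℕ j) * g (i ∸ toℕ j)
    ; -_      = λ f i → - f i
    ; 0#      = λ _ → 0#
    ; 1#      = constant 1#
    }

-- A multi-index is a list of positive integers; the functions below are
-- only applied to such lists.

weight : List ℕ → ℕ
weight = ListAction.sum

depth : List ℕ → ℕ
depth = length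

height : List ℕ → ℕ
height ks = length (filter (2 ≤?_) ks)

tuples : List ℕ → (l : ℕ) → List (List ℕ)
tuples xs zero    = [] ∷ []
tuples xs (suc l) = concatMap (λ x → map (x ∷_) (tuples xs l)) xs

-- The multi-indices of weight k, depth l and height s, each listed once.
-- Entries of a multi-index of weight k lie in {1,…,k}.
multiIndices : (k l s : ℕ) → List (List ℕ)
multiIndices k l s =
  filter (λ ks → (weight ks ≟ k) ×-dec (height ks ≟ s))
         (tuples (map suc (upTo k)) l)

-- The list, with multiplicity, of the 3^(l-1) ways of filling the boxes
-- in k □ k₂ □ ⋯ □ kₗ with "," or "+" or "-1+".
fillings : ℕ → List ℕ → List (List ℕ)
fillings k []        = (k ∷ []) ∷ []
fillings k (k′ ∷ ks) = map (k ∷_) (fillings k′ ks)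
                    ++ fillings (k ℕ.+ k′) ks
                    ++ fillings (k ∸ 1 ℕ.+ k′) ks

-- In a Heyting field the apartness _#_ is the constructive form of ≠;
-- x # y holds iff x - y is invertible.
module FieldDefs {c ℓ₁ ℓ₂} (K : HeytingField c ℓ₁ ℓ₂) where
  open HeytingField K

  rawRing : RawRing c ℓ₁
  rawRing = CommutativeRing.rawRing
    (HeytingCommutativeRing.commutativeRing heytingCommutativeRing)

  open RawSemiringOps (RawRing.rawSemiring rawRing) public
    using (_^_; _×_; sum)

  CharacteristicZero : Set ℓ₂
  CharacteristicZero = ∀ m → suc m × 1# # 0#

  NoSmallOrder : ℕ → Carrier → Set ℓ₂
  NoSmallOrder n q = ∀ m → 0 < m → m < n → q ^ m # 1#

  record IsPrimitiveRoot (n : ℕ) (ζ : Carrier) : Set (ℓ₁ ⊔ ℓ₂) where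
    field
      ζⁿ≈1         : ζ ^ n ≈ 1#
      noSmallOrder : NoSmallOrder n ζ

  1/1- : (x : Carrier) → x # 1# → Carrier
  1/1- x x#1 = proj₁ (#⇒invertible (#-sym x#1))

  -- 1 / (m + 1), obtained as the inverse of (m + 1) - 0.
  1/suc : CharacteristicZero → ℕ → Carrier
  1/suc char0 m = proj₁ (#⇒invertible (char0 m))

  -- The sum over n > m₁ > ⋯ > mₗ > 0, written as iterated sums with m₁
  -- outermost; m₂,…,mₗ then run over the same kind of sum below m₁.
  -- The empty multi-index gives 1.
  z̄ : ∀ n q → NoSmallOrder n q → List ℕ → Carrier
  z̄ n       q q#1 []       = 1#
  z̄ zero    q q#1 (k ∷ ks) = 0#
  z̄ (suc n) q q#1 (k ∷ ks) = sum {n} λ i →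
    let m   = suc (toℕ i)
        m<n = s≤s (toℕ<n i)
    in q ^ ((k ∸ 1) ℕ.* m)
       * 1/1- (q ^ m) (q#1 m (s≤s z≤n) m<n) ^ k
       * z̄ m q (λ j 0<j j<m → q#1 j 0<j (<-trans j<m m<n)) ks

  module K[t] = Polynomials rawRing
  open K[t] public using () renaming (polynomials to K[t]; X to t)

  -- K[t][[u₁,u₂,u₃]] is built as K[t][[u₃]][[u₂]][[u₁]], so that f a b c
  -- is the coefficient of u₁ᵃ u₂ᵇ u₃ᶜ in f.
  module Series₃   = PowerSeries K[t]
  module Series₂₃  = PowerSeries Series₃.powerSeries
  module Series₁₂₃ = PowerSeries Series₂₃.powerSeries

  K[t]⟦u₁,u₂,u₃⟧ : RawRing c ℓ₁
  K[t]⟦u₁,u₂,u₃⟧ = Series₁₂₃.powerSeries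

  constant : RawRing.Carrier K[t] → RawRing.Carrier K[t]⟦u₁,u₂,u₃⟧
  constant p = Series₁₂₃.constant (Series₂₃.constant (Series₃.constant p))

  u₁ u₂ u₃ : RawRing.Carrier K[t]⟦u₁,u₂,u₃⟧
  u₁ = Series₁₂₃.X
  u₂ = Series₁₂₃.constant Series₂₃.X
  u₃ = Series₁₂₃.constant (Series₂₃.constant Series₃.X)

  t-1 : RawRing.Carrier K[t]
  t-1 = t +ₜ (-ₜ 1ₜ)
    where open RawRing K[t] renaming (1# to 1ₜ; _+_ to _+ₜ_; -_ to -ₜ_) using ()

  module _ (n : ℕ) (q : Carrier) (q#1 : NoSmallOrder n q) where

    z̄ᵗ : List ℕ → RawRing.Carrier K[t]
    z̄ᵗ []       = RawRing.1# K[t]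
    z̄ᵗ (k ∷ ks) = foldr
      (λ p acc →
        K[t].constant (z̄ n q q#1 p) *ₜ t ^ₜ (depth (k ∷ ks) ∸ depth p) +ₜ acc)
      0ₜ (fillings k ks)
      where
      open RawRing K[t] renaming (0# to 0ₜ; _+_ to _+ₜ_; _*_ to _*ₜ_)
        using (rawSemiring)
      open RawSemiringOps rawSemiring renaming (_^_ to _^ₜ_) using ()

    -- The empty multi-index is the only one of weight, depth and height
    -- 0, so G 0 0 0 is 1.
    G : (k l s : ℕ) → RawRing.Carrier K[t]
    G k l s = foldr (λ ks acc → z̄ᵗ ks +ₜ acc) 0ₜ (multiIndices k l s)
      where open RawRing K[t] renaming (0# to 0ₜ; _+_ to _+ₜ_) using ()

    -- Σ G(k,l,s) u₁^(k-l-s) u₂^(l-s) u₃^s.  A multi-index of weight k,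
    -- depth l and height s has s ≤ l and l + s ≤ k, so no exponent of a
    -- nonzero term is negative, and the exponents (a,b,c) occur for
    -- exactly one triple, namely s = c, l = b + c, k = a + l + s.
    generatingFunction : RawRing.Carrier K[t]⟦u₁,u₂,u₃⟧
    generatingFunction a b c = G (a ℕ.+ (b ℕ.+ c) ℕ.+ c) (b ℕ.+ c) c

  -- U n τ is the polynomial Uₙ with the parameter t replaced by τ.
  -- Here e = n - a - b - 1, so that 1/suc e is 1/(n-a-b).
  U : CharacteristicZero → ℕ → RawRing.Carrier K[t] →
      RawRing.Carrier K[t]⟦u₁,u₂,u₃⟧
  U char0 n τ = sumᵤ {n} λ i → sumᵤ {n ∸ toℕ i} λ j →
    let a = toℕ i
        b = toℕ j
        e = n ∸ a ∸ b ∸ 1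
    in constant (K[t].constant (1/suc char0 e))
       *ᵤ (((n ∸ a ∸ 1) C b) ℕ.* ((n ∸ b ∸ 1) C a)) ×ᵤ 1ᵤ
       *ᵤ constant τ ^ᵤ e
       *ᵤ (1ᵤ +ᵤ u₁) ^ᵤ a
       *ᵤ (1ᵤ -ᵤ constant τ *ᵤ u₂) ^ᵤ b
       *ᵤ (u₃ -ᵤ u₁ *ᵤ u₂) ^ᵤ e
    where
    open RawRing K[t]⟦u₁,u₂,u₃⟧
      renaming (1# to 1ᵤ; _+_ to _+ᵤ_; _*_ to _*ᵤ_; -_ to -ᵤ_)
      using (rawSemiring)
    open RawSemiringOps rawSemiring
      renaming (_^_ to _^ᵤ_; _×_ to _×ᵤ_; sum to sumᵤ) using ()

    infixl 6 _-ᵤ_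
    _-ᵤ_ : (f g : RawRing.Carrier K[t]⟦u₁,u₂,u₃⟧) →
           RawRing.Carrier K[t]⟦u₁,u₂,u₃⟧
    f -ᵤ g = f +ᵤ (-ᵤ g)

{-# OPTIONS --safe #-}
module Submission where

-- Put Q = ζᵐ, x = 1/(1 - Q), y = Q x.  The weights w(k) = x y^(k-1) satisfy
-- w(k) w(k′) = w(k + k′) + w(k - 1 + k′), which is how the three ways of
-- filling a box combine.  Hence, if E is the interpolated sum over m₁ < m and
-- D its increment when m₁ = m is admitted, D(k, ks) = w(k) (E + t D)(ks).
-- For the generating functions this is a linear equation, whose solution is
--   (E + D) f(t) = E f(t - 1),  f(τ) = α Q² - s Q + β,
-- with α = 1 + u₁, β = 1 - τ u₂ and s = α + β + τ (u₃ - u₁ u₂), so the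
-- generating function is the quotient of ∏ f(t - 1) by ∏ f(t), over 0 < m < n.
-- Over the extension by a root r of r² - s r + α β, with r′ = s - r, one has
-- α f = (r - α Q) (r′ - α Q), and the product over the roots of unity becomes
-- a product of two geometric sums.  This yields
--   F₀ = 0,  F₁ = 1,  Fₙ₊₂ = s Fₙ₊₁ - α β Fₙ + αⁿ⁺¹ + βⁿ⁺¹
-- for Fₙ = ∏ f, and n Uₙ satisfies the same recurrence.

open import Defs
open import Algebra.Apartness.Bundles using (HeytingField)
open import Algebra.Bundles.Raw using (RawRing)
open import Algebra.Definitions using (Invertible)
open import Data.Nat.Base using (ℕ; _<_)
open import Data.Product.Base using (Σ; proj₁)

open import Algebra.Apartness.Bundles using (HeytingCommutativeRing)
open import Algebra.Bundles using (CommutativeRing)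
import Algebra.Construct.DirectProduct as DirectProduct
import Algebra.Construct.Pointwise as Pointwise
import Algebra.Definitions.RawSemiring as RawSemiringOps
import Algebra.Morphism.Construct.Composition as Composition
import Algebra.Morphism.RingMonomorphism as RingMonomorphism
open import Algebra.Morphism.Structures using (IsRingHomomorphism; IsRingMonomorphism)
import Algebra.Properties.AbelianGroup as AbelianGroupProperties
import Algebra.Properties.CommutativeSemigroup as CommutativeSemigroupProperties
import Algebra.Properties.CommutativeSemiring.Exp as Exp
import Algebra.Properties.Ring as RingProperties
import Algebra.Properties.Semiring.Mult as SemiringMult
import Algebra.Properties.Semiring.Mult.TCOptimised as Mult
import Algebra.Properties.Semiring.Sum as SumProperties
import Algebra.Solver.Ring as RingSolver
open import Algebra.Solver.Ring.AlmostCommutativeRing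
  using (fromCommutativeRing; _-Raw-AlmostCommutative⟶_)
open import Algebra.Structures using (IsCommutativeRing)
open import Data.Bool.Base as Bool using (Bool; true; false; if_then_else_; _∧_)
import Data.Bool.Properties as Bool
open import Data.Fin.Base using (Fin; toℕ)
import Data.Fin.Properties as Fin
open import Data.List.Base
  using (List; []; _∷_; _++_; map; concatMap; filter; foldr; length; upTo; applyUpTo)
open import Data.List.Relation.Unary.All as All using (All; []; _∷_)
import Data.List.Relation.Unary.All.Properties as All
open import Data.Maybe.Base using (Maybe; just; nothing)
open import Data.Nat.Base as ℕ using (zero; suc; _∸_; _≤_; _≤ᵇ_; z≤n; s≤s)
open import Data.Nat.Combinatorics using (_C_; nCn≡1; nCk+nC[k+1]≡[n+1]C[k+1])
import Data.Nat.Properties as ℕ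
import Data.Nat.Solver as ℕSolver
open import Data.Product.Base using (_×_; _,_; proj₂)
open import Data.Unit.Base using (tt)
open import Function.Base using (_∘_; id)
open import Function.Bundles using (Equivalence)
open import Level using (_⊔_)
open import Relation.Binary.PropositionalEquality.Core as ≡ using (_≡_)
import Relation.Binary.PropositionalEquality.Properties as ≡
import Relation.Binary.Reasoning.Setoid as SetoidReasoning
open import Relation.Nullary.Decidable using (Dec; yes; no; does; _×-dec_)
open import Relation.Nullary.Negation using (contradiction)
open import Relation.Unary using (Decidable)

-- The shift from `t` to `t - 1` comes from one cancellation. Summing over the first entry turns the
-- equation for `D` into `Y D = B (E + t D)` with `Y = 1 - u₁ y` and `B = x (u₂ Y + u₃ y)`, whence
-- `(E + D) (Y - t B) = E (Y - (t - 1) B)`; and `f(τ)` is `Y - τ B` times `(1 - Q)²`. At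
-- `u₁ = u₂ = u₃ = 0` it becomes `(1 - Q)²`, a unit, so the quotient exists. The quadratic need not
-- split over the power series: with all variables 0 its roots coincide, and in general its
-- discriminant has no square root there. The root is therefore adjoined formally, geometric sums
-- replace a division by `r - α`, and the powers of `α` gathered on the way are cancelled only after
-- the return to the base ring. For `n Uₙ`, the coefficient `n / (n - a - b)` times two binomials is
-- a sum of two products of binomials. The recurrence is then an identity of natural numbers that
-- follows from Pascal's rule, once the term with `- α β` has been moved to the other side.

-- The pair (m , n) stands for the integer m - n.
module Solver {c ℓ} (R : CommutativeRing c ℓ) where
  open CommutativeRing R
  open Mult semiring using (×-homo-+; ×1-homo-*) renaming (_×_ to _·_)
  open RingProperties ring using (-‿distribˡ-*; -‿distribʳ-*; -‿involutive; -0#≈0#)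
  open AbelianGroupProperties +-abelianGroup using (⁻¹-∙-comm)
  open CommutativeSemigroupProperties +-commutativeSemigroup using (interchange)
  open SetoidReasoning setoid

  private
    differences : RawRing _ _
    differences = record
      { Carrier = ℕ × ℕ
      ; _≈_     = λ { (m , n) (m′ , n′) → m ℕ.+ n′ ≡ m′ ℕ.+ n }
      ; _+_     = λ { (m , n) (m′ , n′) → m ℕ.+ m′ , n ℕ.+ n′ }
      ; _*_     = λ { (m , n) (m′ , n′) →
                      m ℕ.* m′ ℕ.+ n ℕ.* n′ , m ℕ.* n′ ℕ.+ n ℕ.* m′ }
      ; -_      = λ { (m , n) → n , m }
      ; 0#      = 0 , 0
      ; 1#      = 1 , 0
      }

    -- The first clause makes (m , 0) denote m · 1# on the nose.
    ⟦_⟧ : ℕ × ℕ → Carrier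
    ⟦ m , zero ⟧  = m · 1#
    ⟦ m , suc n ⟧ = m · 1# - suc n · 1#

    ⟦⟧≈ : ∀ m n → ⟦ m , n ⟧ ≈ m · 1# - n · 1#
    ⟦⟧≈ m zero    = sym (trans (+-congˡ -0#≈0#) (+-identityʳ _))
    ⟦⟧≈ m (suc n) = refl

    +-homo : ∀ m n m′ n′ →
             ⟦ m ℕ.+ m′ , n ℕ.+ n′ ⟧ ≈ ⟦ m , n ⟧ + ⟦ m′ , n′ ⟧
    +-homo m n m′ n′ = begin
      ⟦ m ℕ.+ m′ , n ℕ.+ n′ ⟧
        ≈⟨ ⟦⟧≈ (m ℕ.+ m′) (n ℕ.+ n′) ⟩
      (m ℕ.+ m′) · 1# - (n ℕ.+ n′) · 1#
        ≈⟨ +-cong (×-homo-+ 1# m m′) (-‿cong (×-homo-+ 1# n n′)) ⟩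
      (m · 1# + m′ · 1#) - (n · 1# + n′ · 1#)
        ≈⟨ +-congˡ (⁻¹-∙-comm _ _) ⟨
      (m · 1# + m′ · 1#) + (- (n · 1#) + - (n′ · 1#))
        ≈⟨ interchange _ _ _ _ ⟩
      (m · 1# - n · 1#) + (m′ · 1# - n′ · 1#)
        ≈⟨ +-cong (⟦⟧≈ m n) (⟦⟧≈ m′ n′) ⟨
      ⟦ m , n ⟧ + ⟦ m′ , n′ ⟧ ∎

    foil : ∀ a b a′ b′ →
           (a * a′ + b * b′) - (a * b′ + b * a′) ≈ (a - b) * (a′ - b′)
    foil a b a′ b′ = begin
      (a * a′ + b * b′) - (a * b′ + b * a′)
        ≈⟨ +-congˡ (⁻¹-∙-comm _ _) ⟨
      (a * a′ + b * b′) + (- (a * b′) + - (b * a′))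
        ≈⟨ interchange _ _ _ _ ⟩
      (a * a′ - a * b′) + (b * b′ - b * a′)
        ≈⟨ +-cong (+-congˡ (-‿distribʳ-* _ _))
                  (trans (+-comm _ _) (+-cong (-‿distribˡ-* _ _) b*b′)) ⟩
      (a * a′ + a * - b′) + (- b * a′ + - b * - b′)
        ≈⟨ +-cong (distribˡ _ _ _) (distribˡ _ _ _) ⟨
      a * (a′ - b′) + - b * (a′ - b′)
        ≈⟨ distribʳ _ _ _ ⟨
      (a - b) * (a′ - b′) ∎
      where
      b*b′ : b * b′ ≈ - b * - b′
      b*b′ = begin
        b * b′         ≈⟨ -‿involutive _ ⟨
        - - (b * b′)   ≈⟨ -‿cong (-‿distribʳ-* _ _) ⟩
        - (b * - b′)   ≈⟨ -‿distribˡ-* _ _ ⟩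
        - b * - b′     ∎

    *-homo : ∀ m n m′ n′ →
             ⟦ m ℕ.* m′ ℕ.+ n ℕ.* n′ , m ℕ.* n′ ℕ.+ n ℕ.* m′ ⟧
             ≈ ⟦ m , n ⟧ * ⟦ m′ , n′ ⟧
    *-homo m n m′ n′ = begin
      ⟦ m ℕ.* m′ ℕ.+ n ℕ.* n′ , m ℕ.* n′ ℕ.+ n ℕ.* m′ ⟧
        ≈⟨ ⟦⟧≈ (m ℕ.* m′ ℕ.+ n ℕ.* n′) (m ℕ.* n′ ℕ.+ n ℕ.* m′) ⟩
      (m ℕ.* m′ ℕ.+ n ℕ.* n′) · 1# - (m ℕ.* n′ ℕ.+ n ℕ.* m′) · 1#
        ≈⟨ +-cong (+*-homo m m′ n n′) (-‿cong (+*-homo m n′ n m′)) ⟩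
      (m · 1# * m′ · 1# + n · 1# * n′ · 1#)
        - (m · 1# * n′ · 1# + n · 1# * m′ · 1#)
        ≈⟨ foil _ _ _ _ ⟩
      (m · 1# - n · 1#) * (m′ · 1# - n′ · 1#)
        ≈⟨ *-cong (⟦⟧≈ m n) (⟦⟧≈ m′ n′) ⟨
      ⟦ m , n ⟧ * ⟦ m′ , n′ ⟧ ∎
      where
      +*-homo : ∀ a b c d → (a ℕ.* b ℕ.+ c ℕ.* d) · 1#
                          ≈ a · 1# * b · 1# + c · 1# * d · 1#
      +*-homo a b c d = trans (×-homo-+ 1# (a ℕ.* b) (c ℕ.* d))
                              (+-cong (×1-homo-* a b) (×1-homo-* c d))

    -‿homo : ∀ m n → ⟦ n , m ⟧ ≈ - ⟦ m , n ⟧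
    -‿homo m n = begin
      ⟦ n , m ⟧                 ≈⟨ ⟦⟧≈ n m ⟩
      n · 1# - m · 1#           ≈⟨ +-comm _ _ ⟩
      - (m · 1#) + n · 1#       ≈⟨ +-congˡ (-‿involutive _) ⟨
      - (m · 1#) - - (n · 1#)   ≈⟨ ⁻¹-∙-comm _ _ ⟩
      - (m · 1# - n · 1#)       ≈⟨ -‿cong (⟦⟧≈ m n) ⟨
      - ⟦ m , n ⟧               ∎

    homomorphism : differences -Raw-AlmostCommutative⟶ fromCommutativeRing R
    homomorphism = record
      { ⟦_⟧    = ⟦_⟧
      ; +-homo = λ { (m , n) (m′ , n′) → +-homo m n m′ n′ }
      ; *-homo = λ { (m , n) (m′ , n′) → *-homo m n m′ n′ }
      ; -‿homo = λ { (m , n) → -‿homo m n }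
      ; 0-homo = refl
      ; 1-homo = refl
      }

    -- Padding each difference by the subtrahend of the other reduces the claim to an equality of
    -- natural multiples. It lets the solver see that distinct pairs such as `(1 , 1)` and `(0 , 0)`
    -- are the same coefficient, so that terms cancel.
    ⟦⟧-cong : ∀ m n m′ n′ → m ℕ.+ n′ ≡ m′ ℕ.+ n → ⟦ m , n ⟧ ≈ ⟦ m′ , n′ ⟧
    ⟦⟧-cong m n m′ n′ eq = begin
      ⟦ m , n ⟧                                        ≈⟨ ⟦⟧≈ m n ⟩
      m · 1# - n · 1#                                  ≈⟨ pad (m · 1#) (n · 1#) (n′ · 1#) ⟩
      (m · 1# + n′ · 1#) - (n · 1# + n′ · 1#)          ≈⟨ +-congʳ sums ⟩
      (m′ · 1# + n · 1#) - (n · 1# + n′ · 1#)          ≈⟨ +-congˡ (-‿cong (+-comm _ _)) ⟩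
      (m′ · 1# + n · 1#) - (n′ · 1# + n · 1#)          ≈⟨ pad (m′ · 1#) (n′ · 1#) (n · 1#) ⟨
      m′ · 1# - n′ · 1#                                ≈⟨ ⟦⟧≈ m′ n′ ⟨
      ⟦ m′ , n′ ⟧ ∎
      where
      sums : m · 1# + n′ · 1# ≈ m′ · 1# + n · 1#
      sums = trans (sym (×-homo-+ 1# m n′))
               (trans (reflexive (≡.cong (_· 1#) eq)) (×-homo-+ 1# m′ n))

      pad : ∀ x y z → x - y ≈ (x + z) - (y + z)
      pad x y z = begin
        x - y                   ≈⟨ +-identityʳ _ ⟨
        (x - y) + 0#            ≈⟨ +-congˡ (-‿inverseʳ z) ⟨
        (x - y) + (z - z)       ≈⟨ interchange _ _ _ _ ⟩
        (x + z) + (- y + - z)   ≈⟨ +-congˡ (⁻¹-∙-comm _ _) ⟩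
        (x + z) - (y + z)       ∎

    dec : ∀ x y → Maybe (⟦ x ⟧ ≈ ⟦ y ⟧)
    dec (m , n) (m′ , n′) with m ℕ.+ n′ ℕ.≟ m′ ℕ.+ n
    ... | yes eq = just (⟦⟧-cong m n m′ n′ eq)
    ... | no  _  = nothing

  open RingSolver differences (fromCommutativeRing R) homomorphism dec public
    using (solve; _:+_; _:*_; _:-_; :-_; _:=_; con; Polynomial)

  -- With the optimised multiples `1 · 1#` reduces to `1#`, so this constant evaluates to `1#`
  -- itself and goals closed by `refl` match on the nose.
  :1 : ∀ {n} → Polynomial n
  :1 = con (1 , 0)

-- Formal power series and their inverses.

module _ {c ℓ} (R : CommutativeRing c ℓ) where
  open CommutativeRing R
  open Solver R
  open SetoidReasoning setoid

  -- Here `a + x f = a (1 + x b f)`, and the fixed-point equation says that `g` is the geometric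
  -- series inverting the second factor.
  geometric-inverse : ∀ {a b f g x} → b * a ≈ 1# → g ≈ 1# + x * (- (b * f) * g) →
                      (b * g) * (a + x * f) ≈ 1#
  geometric-inverse {a} {b} {f} {g} {x} ba≈1 fixed = begin
    (b * g) * (a + x * f)
      ≈⟨ solve 5 (λ a b f g x → (b :* g) :* (a :+ x :* f)
           := (b :* a) :* g :- x :* (:- (b :* f) :* g)) refl a b f g x ⟩
    (b * a) * g - y                ≈⟨ +-congʳ (*-cong ba≈1 fixed) ⟩
    1# * (1# + y) - y              ≈⟨ solve 1 (λ y → :1 :* (:1 :+ y) :- y := :1) refl y ⟩
    1#                             ∎
    where
    y = x * (- (b * f) * g)

module PowerSeriesRing {c ℓ} (R : CommutativeRing c ℓ) where
  open CommutativeRing R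
  open PowerSeries rawRing public
  open SumProperties semiring using (sum-cong-≋)
  open Solver R
  open SetoidReasoning setoid

  open RawRing powerSeries public
    using () renaming (_≈_ to _≋_; _*_ to _⊗_; 1# to 𝟙)

  tail : (ℕ → Carrier) → ℕ → Carrier
  tail f i = f (suc i)

  ⊗-cong : ∀ {f f′ g g′} → f ≋ f′ → g ≋ g′ → (f ⊗ g) ≋ (f′ ⊗ g′)
  ⊗-cong f≋f′ g≋g′ i =
    sum-cong-≋ {suc i} λ j → *-cong (f≋f′ (toℕ j)) (g≋g′ (i ∸ toℕ j))

  ⊗-zeroˡ : ∀ g → ((λ _ → 0#) ⊗ g) ≋ λ _ → 0#
  ⊗-zeroˡ g zero    = trans (+-identityʳ _) (zeroˡ _)
  ⊗-zeroˡ g (suc i) = trans (+-cong (zeroˡ _) (⊗-zeroˡ g i)) (+-identityʳ _)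

  constant-⊗ : ∀ a g i → (constant a ⊗ g) i ≈ a * g i
  constant-⊗ a g zero    = +-identityʳ _
  constant-⊗ a g (suc i) = trans (+-congˡ (⊗-zeroˡ g i)) (+-identityʳ _)

  ⊗-identityˡ : ∀ g → (𝟙 ⊗ g) ≋ g
  ⊗-identityˡ g i = trans (constant-⊗ 1# g i) (*-identityˡ _)

  X-⊗-suc : ∀ g i → (X ⊗ g) (suc i) ≈ g i
  X-⊗-suc g i = begin
    0# * g (suc i) + (tail X ⊗ g) i   ≈⟨ +-cong (zeroˡ _) (⊗-cong {tail X} {𝟙} {g} {g} tail-X (λ _ → refl) i) ⟩
    0# + (𝟙 ⊗ g) i                    ≈⟨ +-identityˡ _ ⟩
    (𝟙 ⊗ g) i                         ≈⟨ ⊗-identityˡ g i ⟩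
    g i                               ∎
    where
    tail-X : tail X ≋ 𝟙
    tail-X zero    = refl
    tail-X (suc _) = refl

  X-⊗-zero : ∀ g → (X ⊗ g) 0 ≈ 0#
  X-⊗-zero g = trans (+-identityʳ _) (zeroˡ _)

  -- The convolution sum unfolds at the end containing `f 0`; this splits off the opposite end,
  -- which is what commutativity has to compare.
  ⊗-suc′ : ∀ f g i → (f ⊗ g) (suc i) ≈ (f ⊗ tail g) i + f (suc i) * g 0
  ⊗-suc′ f g zero = solve 4 (λ f₀ f₁ g₀ g₁ →
    f₀ :* g₁ :+ (f₁ :* g₀ :+ con (0 , 0)) := (f₀ :* g₁ :+ con (0 , 0)) :+ f₁ :* g₀) refl (f 0) (f 1) (g 0) (g 1)
  ⊗-suc′ f g (suc i) = begin
    f 0 * g (2 ℕ.+ i) + (tail f ⊗ g) (suc i)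
      ≈⟨ +-congˡ (⊗-suc′ (tail f) g i) ⟩
    f 0 * g (2 ℕ.+ i) + ((tail f ⊗ tail g) i + f (2 ℕ.+ i) * g 0)
      ≈⟨ +-assoc _ _ _ ⟨
    (f ⊗ tail g) (suc i) + f (2 ℕ.+ i) * g 0 ∎

  ⊗-comm : ∀ f g → (f ⊗ g) ≋ (g ⊗ f)
  ⊗-comm f g zero    = +-congʳ (*-comm _ _)
  ⊗-comm f g (suc i) = begin
    f 0 * g (suc i) + (tail f ⊗ g) i   ≈⟨ +-cong (*-comm _ _) (⊗-comm (tail f) g i) ⟩
    g (suc i) * f 0 + (g ⊗ tail f) i   ≈⟨ +-comm _ _ ⟩
    (g ⊗ tail f) i + g (suc i) * f 0   ≈⟨ ⊗-suc′ g f i ⟨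
    (g ⊗ f) (suc i)                    ∎

  ⊗-distribʳ : ∀ h f g → ((λ i → f i + g i) ⊗ h) ≋ λ i → (f ⊗ h) i + (g ⊗ h) i
  ⊗-distribʳ h f g zero = solve 3 (λ f₀ g₀ h₀ →
    (f₀ :+ g₀) :* h₀ :+ con (0 , 0) := (f₀ :* h₀ :+ con (0 , 0)) :+ (g₀ :* h₀ :+ con (0 , 0))) refl (f 0) (g 0) (h 0)
  ⊗-distribʳ h f g (suc i) = begin
    (f 0 + g 0) * h (suc i) + ((λ i → f (suc i) + g (suc i)) ⊗ h) i
      ≈⟨ +-congˡ (⊗-distribʳ h (tail f) (tail g) i) ⟩
    (f 0 + g 0) * h (suc i) + ((tail f ⊗ h) i + (tail g ⊗ h) i)
      ≈⟨ solve 5 (λ f₀ g₀ h₁ a b → (f₀ :+ g₀) :* h₁ :+ (a :+ b)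
                   := (f₀ :* h₁ :+ a) :+ (g₀ :* h₁ :+ b)) refl (f 0) (g 0) (h (suc i)) _ _ ⟩
    (f ⊗ h) (suc i) + (g ⊗ h) (suc i) ∎

  ⊗-scale : ∀ a f g → ((λ i → a * f i) ⊗ g) ≋ λ i → a * (f ⊗ g) i
  ⊗-scale a f g zero = solve 3 (λ a f₀ g₀ →
    (a :* f₀) :* g₀ :+ con (0 , 0) := a :* (f₀ :* g₀ :+ con (0 , 0))) refl a (f 0) (g 0)
  ⊗-scale a f g (suc i) = begin
    (a * f 0) * g (suc i) + ((λ i → a * f (suc i)) ⊗ g) i
      ≈⟨ +-cong (*-assoc _ _ _) (⊗-scale a (tail f) g i) ⟩
    a * (f 0 * g (suc i)) + a * (tail f ⊗ g) i
      ≈⟨ distribˡ _ _ _ ⟨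
    a * (f ⊗ g) (suc i) ∎

  ⊗-assoc : ∀ f g h → ((f ⊗ g) ⊗ h) ≋ (f ⊗ (g ⊗ h))
  ⊗-assoc f g h zero = solve 3 (λ f₀ g₀ h₀ →
    (f₀ :* g₀ :+ con (0 , 0)) :* h₀ :+ con (0 , 0) := f₀ :* (g₀ :* h₀ :+ con (0 , 0)) :+ con (0 , 0)) refl (f 0) (g 0) (h 0)
  ⊗-assoc f g h (suc i) = begin
    (f ⊗ g) 0 * h (suc i) + (tail (f ⊗ g) ⊗ h) i
      ≈⟨ +-congˡ (⊗-distribʳ h (λ i → f 0 * g (suc i)) (tail f ⊗ g) i) ⟩
    (f ⊗ g) 0 * h (suc i) + (((λ i → f 0 * g (suc i)) ⊗ h) i + ((tail f ⊗ g) ⊗ h) i)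
      ≈⟨ +-congˡ (+-cong (⊗-scale (f 0) (tail g) h i) (⊗-assoc (tail f) g h i)) ⟩
    (f 0 * g 0 + 0#) * h (suc i) + (f 0 * (tail g ⊗ h) i + (tail f ⊗ (g ⊗ h)) i)
      ≈⟨ solve 5 (λ f₀ g₀ h₁ a b → (f₀ :* g₀ :+ con (0 , 0)) :* h₁ :+ (f₀ :* a :+ b)
                   := f₀ :* (g₀ :* h₁ :+ a) :+ b) refl (f 0) (g 0) (h (suc i)) _ _ ⟩
    f 0 * (g ⊗ h) (suc i) + (tail f ⊗ (g ⊗ h)) i ∎

  private
    module P = IsCommutativeRing (Pointwise.isCommutativeRing ℕ isCommutativeRing)

  commutativeRing : CommutativeRing c ℓ
  commutativeRing = record
    { RawRing powerSeries
    ; isCommutativeRing = record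
      { isRing = record
        { +-isAbelianGroup = P.+-isAbelianGroup
        ; *-cong           = ⊗-cong
        ; *-assoc          = ⊗-assoc
        ; *-identity       = ⊗-identityˡ
                           , λ f i → trans (⊗-comm f 𝟙 i) (⊗-identityˡ f i)
        ; distrib          = (λ f g h i → trans (⊗-comm f (λ i → g i + h i) i)
                               (trans (⊗-distribʳ f g h i)
                                 (+-cong (⊗-comm g f i) (⊗-comm h f i))))
                           , ⊗-distribʳ
        }
      ; *-comm = ⊗-comm
      }
    }

  constant-isRingHomomorphism : IsRingHomomorphism rawRing powerSeries constant
  constant-isRingHomomorphism = record
    { isSemiringHomomorphism = record
      { isNearSemiringHomomorphism = record
        { +-isMonoidHomomorphism = record
          { isMagmaHomomorphism = record
            { isRelHomomorphism = record
              { cong = λ { eq zero → eq ; eq (suc _) → refl } }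
            ; homo = λ { a b zero → refl ; a b (suc _) → sym (+-identityʳ _) }
            }
          ; ε-homo = λ { zero → refl ; (suc _) → refl }
          }
        ; *-homo = λ { a b zero → sym (+-identityʳ _)
                     ; a b (suc i) → sym (trans (constant-⊗ a (constant b) (suc i)) (zeroʳ a)) }
        }
      ; 1#-homo = λ _ → refl
      }
    ; -‿homo = λ { a zero → refl ; a (suc _) → sym (RingProperties.-0#≈0# ring) }
    }

  constantTerm-isRingHomomorphism : IsRingHomomorphism powerSeries rawRing (λ f → f 0)
  constantTerm-isRingHomomorphism = record
    { isSemiringHomomorphism = record
      { isNearSemiringHomomorphism = record
        { +-isMonoidHomomorphism = record
          { isMagmaHomomorphism = record
            { isRelHomomorphism = record { cong = λ eq → eq 0 }
            ; homo = λ _ _ → refl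
            }
          ; ε-homo = refl
          }
        ; *-homo = λ _ _ → +-identityʳ _
        }
      ; 1#-homo = refl
      }
    ; -‿homo = λ _ → refl
    }

  private
    module S = CommutativeRing commutativeRing

  -- The fixed point of s ↦ 1 + X h s is read off the diagonal of its
  -- iterates, since the coefficient of Xⁱ does not change after i steps.
  module _ (h : ℕ → Carrier) where
    private
      iterate : ℕ → ℕ → Carrier
      iterate zero    = 𝟙
      iterate (suc k) = λ { zero → 1# ; (suc i) → (h ⊗ iterate k) i }

      -- A coefficient of a product only sees coefficients up to its own degree, so multiplying by
      -- `X h` makes one more coefficient of an iterate final.
      ⊗-cong-≤ : ∀ f {g g′ i} → (∀ j → j ≤ i → g j ≈ g′ j) →
                 (f ⊗ g) i ≈ (f ⊗ g′) i
      ⊗-cong-≤ f {i = i} g≈g′ =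
        sum-cong-≋ {suc i} λ j → *-congˡ {f (toℕ j)} (g≈g′ (i ∸ toℕ j) (ℕ.m∸n≤m i (toℕ j)))

      iterate-stable : ∀ k k′ i → i ≤ k → i ≤ k′ → iterate k i ≈ iterate k′ i
      iterate-stable zero    zero     zero    _         _          = refl
      iterate-stable zero    (suc k′) zero    _         _          = refl
      iterate-stable (suc k) zero     zero    _         _          = refl
      iterate-stable (suc k) (suc k′) zero    _         _          = refl
      iterate-stable (suc k) (suc k′) (suc i) (s≤s i≤k) (s≤s i≤k′) = ⊗-cong-≤ h λ j j≤i →
        iterate-stable k k′ j (ℕ.≤-trans j≤i i≤k) (ℕ.≤-trans j≤i i≤k′)

    geometric : ℕ → Carrier
    geometric i = iterate i i

    geometric-fixed : geometric ≋ (𝟙 S.+ X ⊗ (h ⊗ geometric))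
    geometric-fixed zero    = sym (trans (+-congˡ (X-⊗-zero (h ⊗ geometric))) (+-identityʳ _))
    geometric-fixed (suc i) = begin
      -- The coefficients of `iterate i` up to degree `i` are already final, so it may be replaced
      -- by the diagonal.
      (h ⊗ iterate i) i                    ≈⟨ ⊗-cong-≤ h (λ j j≤i → iterate-stable i j j j≤i ℕ.≤-refl) ⟩
      (h ⊗ geometric) i                    ≈⟨ X-⊗-suc (h ⊗ geometric) i ⟨
      (X ⊗ (h ⊗ geometric)) (suc i)        ≈⟨ +-identityˡ _ ⟨
      0# + (X ⊗ (h ⊗ geometric)) (suc i)   ∎

  constantTerm-X-tail : ∀ f → f ≋ (constant (f 0) S.+ X ⊗ tail f)
  constantTerm-X-tail f zero    = sym (trans (+-congˡ (X-⊗-zero (tail f))) (+-identityʳ _))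
  constantTerm-X-tail f (suc i) = sym (trans (+-identityˡ _) (X-⊗-suc (tail f) i))

  invertible : ∀ f → Invertible _≈_ 1# _*_ (f 0) → Invertible _≋_ 𝟙 _⊗_ f
  invertible f (a⁻¹ , a⁻¹a≈1 , _) = f⁻¹ , f⁻¹f≋𝟙 , S.trans (S.*-comm f f⁻¹) f⁻¹f≋𝟙
    where
    h = S.- (constant a⁻¹ ⊗ tail f)
    f⁻¹ = constant a⁻¹ ⊗ geometric h

    f⁻¹f≋𝟙 : (f⁻¹ ⊗ f) ≋ 𝟙
    f⁻¹f≋𝟙 = S.trans (S.*-congˡ {f⁻¹} (constantTerm-X-tail f))
      (geometric-inverse commutativeRing {constant (f 0)} {constant a⁻¹} {tail f} {geometric h} {X} (λ i → trans
        (sym (IsRingHomomorphism.*-homo constant-isRingHomomorphism a⁻¹ (f 0) i))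
        (IsRingHomomorphism.⟦⟧-cong constant-isRingHomomorphism a⁻¹a≈1 i))
        (geometric-fixed h))

-- Polynomials as a subring of the power series.

module PolynomialRing {c ℓ} (R : CommutativeRing c ℓ) where
  open CommutativeRing R
  open Polynomials rawRing public
  open PowerSeriesRing R using (_⊗_; ⊗-zeroˡ)
    renaming (powerSeries to series; commutativeRing to seriesRing)
  open RingProperties ring using (-0#≈0#)

  coeff-⊕ : ∀ p q i → coeff (p ⊕ q) i ≈ coeff p i + coeff q i
  coeff-⊕ []      q       i       = sym (+-identityˡ _)
  coeff-⊕ (a ∷ p) []      i       = sym (+-identityʳ _)
  coeff-⊕ (a ∷ p) (b ∷ q) zero    = refl
  coeff-⊕ (a ∷ p) (b ∷ q) (suc i) = coeff-⊕ p q i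

  coeff-map : ∀ (f : Carrier → Carrier) → f 0# ≈ 0# → ∀ p i → coeff (map f p) i ≈ f (coeff p i)
  coeff-map f f0≈0 []      i       = sym f0≈0
  coeff-map f f0≈0 (a ∷ p) zero    = refl
  coeff-map f f0≈0 (a ∷ p) (suc i) = coeff-map f f0≈0 p i

  coeff-⊛ : ∀ p q i → coeff (p ⊛ q) i ≈ (coeff p ⊗ coeff q) i
  coeff-⊛ []      q i       = sym (⊗-zeroˡ (coeff q) i)
  coeff-⊛ (a ∷ p) q zero    = trans (coeff-⊕ (map (a *_) q) (0# ∷ p ⊛ q) 0) (+-congʳ (coeff-map (a *_) (zeroʳ a) q 0))
  coeff-⊛ (a ∷ p) q (suc i) = trans (coeff-⊕ (map (a *_) q) (0# ∷ p ⊛ q) (suc i))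
    (+-cong (coeff-map (a *_) (zeroʳ a) q (suc i)) (coeff-⊛ p q i))

  -- Equality of polynomials is defined coefficientwise, so injectivity is immediate and all ring
  -- laws are pulled back from the power series.
  coeff-isRingMonomorphism : IsRingMonomorphism polynomials series coeff
  coeff-isRingMonomorphism = record
    { isRingHomomorphism = record
      { isSemiringHomomorphism = record
        { isNearSemiringHomomorphism = record
          { +-isMonoidHomomorphism = record
            { isMagmaHomomorphism = record
              { isRelHomomorphism = record { cong = λ eq → eq }
              ; homo = coeff-⊕
              }
            ; ε-homo = λ _ → refl
            }
          ; *-homo = coeff-⊛
          }
        ; 1#-homo = λ { zero → refl ; (suc _) → refl }
        }
      ; -‿homo = coeff-map (-_) -0#≈0#
      }
    ; injective = λ eq → eq
    }

  commutativeRing : CommutativeRing c ℓ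
  commutativeRing = record
    { RawRing polynomials
    ; isCommutativeRing =
        RingMonomorphism.isCommutativeRing coeff-isRingMonomorphism (CommutativeRing.isCommutativeRing seriesRing)
    }

  constant-isRingHomomorphism : IsRingHomomorphism rawRing polynomials constant
  constant-isRingHomomorphism = record
    { isSemiringHomomorphism = record
      { isNearSemiringHomomorphism = record
        { +-isMonoidHomomorphism = record
          { isMagmaHomomorphism = record
            { isRelHomomorphism = record { cong = λ { eq zero → eq ; eq (suc _) → refl } }
            ; homo = λ _ _ _ → refl
            }
          ; ε-homo = λ { zero → refl ; (suc _) → refl }
          }
        ; *-homo = λ { a b zero → sym (+-identityʳ _) ; a b (suc _) → refl }
        }
      ; 1#-homo = λ _ → refl
      }
    ; -‿homo = λ _ _ → refl
    }

-- Adjoining a root of a monic quadratic.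

-- R[r] / (r² - s r + p), with (a , b) standing for a + b r.
module QuadraticExtension {c ℓ} (R : CommutativeRing c ℓ)
                          (s p : CommutativeRing.Carrier R) where
  open CommutativeRing R
  open Solver R

  private
    _⊛_ : Carrier × Carrier → Carrier × Carrier → Carrier × Carrier
    (a , b) ⊛ (c , d) = a * c - p * (b * d) , a * d + b * c + s * (b * d)

    0′ : ∀ {n} → Polynomial n
    0′ = con (0 , 0)

  commutativeRing : CommutativeRing c ℓ
  commutativeRing = record
    { _*_ = _⊛_
    ; 1#  = 1# , 0#
    ; isCommutativeRing = record
      { isRing = record
        { +-isAbelianGroup = CommutativeRing.+-isAbelianGroup (DirectProduct.commutativeRing R R)
        ; *-cong = λ (a , b) (c , d) →
            +-cong (*-cong a c) (-‿cong (*-congˡ (*-cong b d)))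
            , +-cong (+-cong (*-cong a d) (*-cong b c)) (*-congˡ (*-cong b d))
        ; *-assoc = λ (a , b) (c , d) (e , f) →
            solve 8 (λ a b c d e f s p →
              (a :* c :- p :* (b :* d)) :* e :- p :* ((a :* d :+ b :* c :+ s :* (b :* d)) :* f)
              := a :* (c :* e :- p :* (d :* f)) :- p :* (b :* (c :* f :+ d :* e :+ s :* (d :* f))))
              refl a b c d e f s p
            , solve 8 (λ a b c d e f s p →
              (a :* c :- p :* (b :* d)) :* f :+ (a :* d :+ b :* c :+ s :* (b :* d)) :* e
                :+ s :* ((a :* d :+ b :* c :+ s :* (b :* d)) :* f)
              := a :* (c :* f :+ d :* e :+ s :* (d :* f)) :+ b :* (c :* e :- p :* (d :* f))
                :+ s :* (b :* (c :* f :+ d :* e :+ s :* (d :* f))))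
              refl a b c d e f s p
        ; *-identity =
            (λ (a , b) →
              solve 3 (λ a b p → :1 :* a :- p :* (0′ :* b) := a) refl a b p
              , solve 3 (λ a b s → :1 :* b :+ 0′ :* a :+ s :* (0′ :* b) := b) refl a b s)
            , (λ (a , b) →
              solve 3 (λ a b p → a :* :1 :- p :* (b :* 0′) := a) refl a b p
              , solve 3 (λ a b s → a :* 0′ :+ b :* :1 :+ s :* (b :* 0′) := b) refl a b s)
        ; distrib =
            (λ (a , b) (c , d) (e , f) →
              solve 7 (λ a b c d e f p →
                a :* (c :+ e) :- p :* (b :* (d :+ f))
                := (a :* c :- p :* (b :* d)) :+ (a :* e :- p :* (b :* f)))
                refl a b c d e f p
              , solve 7 (λ a b c d e f s →
                a :* (d :+ f) :+ b :* (c :+ e) :+ s :* (b :* (d :+ f))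
                := (a :* d :+ b :* c :+ s :* (b :* d)) :+ (a :* f :+ b :* e :+ s :* (b :* f)))
                refl a b c d e f s)
            , (λ (a , b) (c , d) (e , f) →
              solve 7 (λ a b c d e f p →
                (c :+ e) :* a :- p :* ((d :+ f) :* b)
                := (c :* a :- p :* (d :* b)) :+ (e :* a :- p :* (f :* b)))
                refl a b c d e f p
              , solve 7 (λ a b c d e f s →
                (c :+ e) :* b :+ (d :+ f) :* a :+ s :* ((d :+ f) :* b)
                := (c :* b :+ d :* a :+ s :* (d :* b)) :+ (e :* b :+ f :* a :+ s :* (f :* b)))
                refl a b c d e f s)
        }
      ; *-comm = λ (a , b) (c , d) →
          solve 5 (λ a b c d p → a :* c :- p :* (b :* d) := c :* a :- p :* (d :* b)) refl a b c d p
          , solve 5 (λ a b c d s → a :* d :+ b :* c :+ s :* (b :* d)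
                                := c :* b :+ d :* a :+ s :* (d :* b)) refl a b c d s
      }
    }

  private
    module E = CommutativeRing commutativeRing

  embed : Carrier → E.Carrier
  embed a = a , 0#

  embed-isRingHomomorphism : IsRingHomomorphism rawRing E.rawRing embed
  embed-isRingHomomorphism = record
    { isSemiringHomomorphism = record
      { isNearSemiringHomomorphism = record
        { +-isMonoidHomomorphism = record
          { isMagmaHomomorphism = record
            { isRelHomomorphism = record { cong = _, refl }
            ; homo = λ _ _ → refl , sym (+-identityˡ 0#)
            }
          ; ε-homo = refl , refl
          }
        ; *-homo = λ a b →
            solve 3 (λ a b p → a :* b := a :* b :- p :* (0′ :* 0′)) refl a b p
            , solve 3 (λ a b s → 0′ := a :* 0′ :+ 0′ :* b :+ s :* (0′ :* 0′)) refl a b s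
        }
      ; 1#-homo = refl , refl
      }
    ; -‿homo = λ _ → refl , solve 0 (0′ := :- 0′) refl
    }

  -- The pair `(s , -1)` is `s - r`. The two equations that follow are Vieta's formulas, the only
  -- facts about the roots used later.
  root conjugateRoot : E.Carrier
  root          = 0# , 1#
  conjugateRoot = s , - 1#

  root+conjugateRoot : root E.+ conjugateRoot E.≈ embed s
  root+conjugateRoot = +-identityˡ s , -‿inverseʳ 1#

  root*conjugateRoot : root E.* conjugateRoot E.≈ embed p
  root*conjugateRoot =
    solve 2 (λ s p → 0′ :* s :- p :* (:1 :* (:- :1)) := p) refl s p
    , solve 1 (λ s → 0′ :* (:- :1) :+ :1 :* s :+ s :* (:1 :* (:- :1)) := 0′) refl s

-- Products over the nontrivial roots of unity.

module Products {c ℓ} (R : CommutativeRing c ℓ) where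
  open CommutativeRing R
  open Solver R
  open Exp commutativeSemiring using (_^_)
  open SetoidReasoning setoid

  product : ℕ → (ℕ → Carrier) → Carrier
  product zero    f = 1#
  product (suc k) f = product k f * f k

  product-cong : ∀ k {f g} → (∀ i → f i ≈ g i) → product k f ≈ product k g
  product-cong zero    eq = refl
  product-cong (suc k) eq = *-cong (product-cong k eq) (eq k)

  product-* : ∀ k f g → product k (λ i → f i * g i) ≈ product k f * product k g
  product-* zero    f g = sym (*-identityˡ _)
  product-* (suc k) f g = trans (*-congʳ (product-* k f g))
    (solve 4 (λ a b c d → (a :* b) :* (c :* d) := (a :* c) :* (b :* d)) refl _ _ _ _)

  product-const : ∀ k a → product k (λ _ → a) ≈ a ^ k
  product-const zero    a = refl
  product-const (suc k) a = trans (*-congʳ (product-const k a)) (*-comm _ _)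

  -- e c k i is the coefficient of Xⁱ in ∏_{j<k} (1 - c j X).
  e : (ℕ → Carrier) → ℕ → ℕ → Carrier
  e c k       zero    = 1#
  e c zero    (suc i) = 0#
  e c (suc k) (suc i) = e c k (suc i) - c k * e c k i

  -- The recursion of `e` removes the last factor of the product, this one the first. With both, the
  -- product over `1, ζ, …, ζᵏ` can be compared with its rotation by `ζ`.
  e-cons : ∀ c k i → e c (suc k) (suc i) ≈ e (λ j → c (suc j)) k (suc i) - c 0 * e (λ j → c (suc j)) k i
  e-cons c zero    zero    = refl
  e-cons c zero    (suc i) = refl
  e-cons c (suc k) zero    = trans (+-congʳ (e-cons c k 0))
    (solve 3 (λ x a b → (x :- a :* :1) :- b :* :1 := (x :- b :* :1) :- a :* :1) refl _ (c 0) (c (suc k)))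
  e-cons c (suc k) (suc i) = trans
    (+-cong (e-cons c k (suc i)) (-‿cong (*-congˡ (e-cons c k i))))
    (solve 5 (λ a b x y z → (x :- a :* y) :- b :* (y :- a :* z) := (x :- b :* y) :- a :* (y :- b :* z))
      refl (c 0) (c (suc k)) _ _ _)

  -- Scaling every `c j` by `x` substitutes `x X` for `X` in the product.
  e-scale : ∀ x c k i → e (λ j → x * c j) k i ≈ x ^ i * e c k i
  e-scale x c k       zero    = sym (*-identityˡ _)
  e-scale x c zero    (suc i) = sym (zeroʳ _)
  e-scale x c (suc k) (suc i) = trans
    (+-cong (e-scale x c k (suc i)) (-‿cong (*-congˡ (e-scale x c k i))))
    (solve 5 (λ x y a b z → (x :* y) :* a :- (x :* b) :* (y :* z) := (x :* y) :* (a :- b :* z))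
      refl x (x ^ i) _ (c k) _)

  e-vanish : ∀ c k i → k < i → e c k i ≈ 0#
  e-vanish c zero    (suc i) _         = refl
  e-vanish c (suc k) (suc i) (s≤s k<i) = trans
    (+-cong (e-vanish c k (suc i) (ℕ.m≤n⇒m≤1+n k<i)) (-‿cong (*-congˡ (e-vanish c k i k<i))))
    (solve 1 (λ a → con (0 , 0) :- a :* con (0 , 0) := con (0 , 0)) refl (c k))

  -- Multiplication by ζ permutes 1, ζ, …, ζᵏ, so only the constant and the
  -- top coefficient of ∏ (1 - ζʲ X) survive; dividing by 1 - X leaves 1 + X + ⋯ + Xᵏ.
  e-rootsOfUnity : ∀ ζ k → ζ ^ suc k ≈ 1# →
                   (∀ i → 0 < i → i < suc k → ∀ x → ζ ^ i * x ≈ x → x ≈ 0#) →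
                   ∀ i → i ≤ k → e (λ j → ζ ^ suc j) k i ≈ 1#
  e-rootsOfUnity ζ k ζⁿ≈1 regular zero    _   = refl
  e-rootsOfUnity ζ k ζⁿ≈1 regular (suc i) i<k = begin
    -- The bracket is a coefficient of `(1 - X)` times the product, that is, of the product over all
    -- of `1, ζ, …, ζᵏ`.
    e′ (suc i)                            ≈⟨ solve 2 (λ x y → x := (x :- :1 :* y) :+ y) refl _ (e′ i) ⟩
    (e′ (suc i) - 1# * e′ i) + e′ i       ≈⟨ +-congʳ (trans (sym (e-cons (ζ ^_) k i)) vanishes) ⟩
    0# + e′ i                             ≈⟨ +-identityˡ _ ⟩
    e′ i                                  ≈⟨ e-rootsOfUnity ζ k ζⁿ≈1 regular i (ℕ.<⇒≤ i<k) ⟩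
    1#                                    ∎
    where
    e′ : ℕ → Carrier
    e′ = e (λ j → ζ ^ suc j) k

    vanishes : e (ζ ^_) (suc k) (suc i) ≈ 0#
    -- The substitution of `ζ X` turns the factors `1, …, ζᵏ` into `ζ, …, ζᵏ⁺¹`, the same ones as
    -- `ζᵏ⁺¹ = 1`. The coefficient of `Xⁱ⁺¹` is thus fixed under multiplication by `ζⁱ⁺¹`.
    vanishes = regular (suc i) (s≤s z≤n) (s≤s i<k) _ (begin
      ζ ^ suc i * e (ζ ^_) (suc k) (suc i)   ≈⟨ e-scale ζ (ζ ^_) (suc k) (suc i) ⟨
      e′ (suc i) - ζ ^ suc k * e′ i          ≈⟨ +-congˡ (-‿cong (*-congʳ ζⁿ≈1)) ⟩
      e′ (suc i) - 1# * e′ i                 ≈⟨ e-cons (ζ ^_) k i ⟨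
      e (ζ ^_) (suc k) (suc i)               ∎)

  module _ (A B : Carrier) where
    -- ∑_{i<k} A^{k-1-i} Bⁱ
    geometricSum : ℕ → Carrier
    geometricSum zero    = 0#
    geometricSum (suc k) = A * geometricSum k + B ^ k

    -- ∑_{i≤k} a i A^{k-i} Bⁱ
    homogenise : ℕ → (ℕ → Carrier) → Carrier
    homogenise zero    a = a 0
    homogenise (suc k) a = A * homogenise k a + a (suc k) * B ^ suc k

    homogenise-cong : ∀ k {a b} → (∀ i → i ≤ k → a i ≈ b i) → homogenise k a ≈ homogenise k b
    homogenise-cong zero    eq = eq 0 z≤n
    homogenise-cong (suc k) eq = +-cong
      (*-congˡ (homogenise-cong k λ i i≤k → eq i (ℕ.m≤n⇒m≤1+n i≤k))) (*-congʳ (eq (suc k) ℕ.≤-refl))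

    homogenise-1 : ∀ k → homogenise k (λ _ → 1#) ≈ geometricSum (suc k)
    homogenise-1 zero    = solve 1 (λ a → :1 := a :* con (0 , 0) :+ :1) refl A
    homogenise-1 (suc k) = +-cong (*-congˡ (homogenise-1 k)) (*-identityˡ _)

    -- The sequence `b` is `a` multiplied by `1 - c X`, which homogenises to `A - c B`. The last
    -- term is the top coefficient of degree `k + 1`, which `homogenise k a` does not contain.
    homogenise-step : ∀ k a b c → b 0 ≈ a 0 → (∀ i → b (suc i) ≈ a (suc i) - c * a i) →
      homogenise (suc k) b ≈ (A - c * B) * homogenise k a + a (suc k) * B ^ suc k
    homogenise-step zero a b c b₀ bₛ = trans (+-cong (*-congˡ b₀) (*-congʳ (bₛ 0)))
      (solve 5 (λ A B c a₀ a₁ → A :* a₀ :+ (a₁ :- c :* a₀) :* (B :* :1)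
        := (A :- c :* B) :* a₀ :+ a₁ :* (B :* :1)) refl A B c (a 0) (a 1))
    homogenise-step (suc k) a b c b₀ bₛ = trans
      (+-cong (*-congˡ (homogenise-step k a b c b₀ bₛ)) (*-congʳ (bₛ (suc k))))
      (solve 7 (λ A B c h a₁ a₂ y →
        A :* ((A :- c :* B) :* h :+ a₁ :* y) :+ (a₂ :- c :* a₁) :* (B :* y)
        := (A :- c :* B) :* (A :* h :+ a₁ :* y) :+ a₂ :* (B :* y))
        refl A B c (homogenise k a) (a (suc k)) (a (suc (suc k))) (B ^ suc k))

module _ {a b ℓ₁ ℓ₂} (K : CommutativeRing a ℓ₁) (R : CommutativeRing b ℓ₂)
         {ι : CommutativeRing.Carrier K → CommutativeRing.Carrier R}
         (ι-hom : IsRingHomomorphism (CommutativeRing.rawRing K) (CommutativeRing.rawRing R) ι) where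
  private
    module K  = CommutativeRing K
    module PK = Products K
    open Exp K.commutativeSemiring using () renaming (_^_ to _^ₖ_)
  open CommutativeRing R
  open IsRingHomomorphism ι-hom
  open Products R
  open Solver R
  open SetoidReasoning setoid

  homomorphism-minus : ∀ x y → ι (x K.- y) ≈ ι x - ι y
  homomorphism-minus x y = trans (+-homo x (K.- y)) (+-congˡ (-‿homo y))

  product-linear : ∀ A B c k →
    product k (λ i → A - ι (c i) * B) ≈ homogenise A B k (λ i → ι (PK.e c k i))
  product-linear A B c zero    = sym 1#-homo
  product-linear A B c (suc k) = begin
    product k _ * (A - ι (c k) * B)
      ≈⟨ *-congʳ (product-linear A B c k) ⟩
    homogenise A B k eₖ * (A - ι (c k) * B)
      -- The zero multiple, of `B ^ suc k`, makes room for the top term of `homogenise-step`, whose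
      -- coefficient vanishes because `k` factors have degree at most `k`.
      ≈⟨ solve 3 (λ x y z → x :* y := y :* x :+ con (0 , 0) :* z) refl _ _ _ ⟩
    (A - ι (c k) * B) * homogenise A B k eₖ + 0# * (_)
      ≈⟨ +-congˡ (*-congʳ (trans (⟦⟧-cong (PK.e-vanish c k (suc k) ℕ.≤-refl)) 0#-homo)) ⟨
    (A - ι (c k) * B) * homogenise A B k eₖ + eₖ (suc k) * _
      ≈⟨ homogenise-step A B k eₖ (λ i → ι (PK.e c (suc k) i)) (ι (c k)) refl
           (λ i → trans (homomorphism-minus _ _) (+-congˡ (-‿cong (*-homo _ _)))) ⟨
    homogenise A B (suc k) (λ i → ι (PK.e c (suc k) i)) ∎
    where
    eₖ : ℕ → Carrier
    eₖ i = ι (PK.e c k i)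

  -- The classical value `(Aⁿ - Bⁿ) / (A - B)`, in a form that makes sense for all `A` and `B`.
  product-rootsOfUnity : ∀ ζ k → ζ ^ₖ suc k K.≈ K.1# →
    (∀ i → 0 < i → i < suc k → ∀ x → ζ ^ₖ i K.* x K.≈ x → x K.≈ K.0#) →
    ∀ A B → product k (λ i → A - ι (ζ ^ₖ suc i) * B) ≈ geometricSum A B (suc k)
  product-rootsOfUnity ζ k ζⁿ≈1 regular A B = begin
    product k (λ i → A - ι (ζ ^ₖ suc i) * B)
      ≈⟨ product-linear A B (λ i → ζ ^ₖ suc i) k ⟩
    homogenise A B k (λ i → ι (PK.e (λ j → ζ ^ₖ suc j) k i))
      ≈⟨ homogenise-cong A B k (λ i i≤k →
           trans (⟦⟧-cong (PK.e-rootsOfUnity ζ k ζⁿ≈1 regular i i≤k)) 1#-homo) ⟩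
    homogenise A B k (λ _ → 1#)
      ≈⟨ homogenise-1 A B k ⟩
    geometricSum A B (suc k) ∎

-- The recurrence for products of quadratic factors.

module Recurrence {c ℓ} (R : CommutativeRing c ℓ) where
  open CommutativeRing R
  open Solver R
  open Products R
  open Exp commutativeSemiring using (_^_; ^-distrib-*; ^-congˡ)
  open SetoidReasoning setoid

  F : (α β s : Carrier) → ℕ → Carrier
  F α β s 0             = 0#
  F α β s 1             = 1#
  F α β s (suc (suc k)) =
    s * F α β s (suc k) - α * β * F α β s k + (α ^ suc k + β ^ suc k)

  -- It splits off the pure power of `A` where the definition splits off that of `B`. Comparing the
  -- two forms of one sum drives the next proof.
  geometricSum-shift : ∀ A B k → geometricSum A B (suc k) ≈ B * geometricSum A B k + A ^ k
  geometricSum-shift A B zero    = solve 2 (λ A B → A :* con (0 , 0) :+ :1 := B :* con (0 , 0) :+ :1) refl A B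
  geometricSum-shift A B (suc k) = trans (+-congʳ (*-congˡ (geometricSum-shift A B k)))
    (solve 5 (λ A B g x y → A :* (B :* g :+ x) :+ B :* y := B :* (A :* g :+ y) :+ A :* x)
      refl A B (geometricSum A B k) (A ^ k) (B ^ k))

  -- The recurrence satisfied by the products of two geometric sums with
  -- ratios r/α and r′/α is that of F, up to powers of α.
  geometricSum-F : ∀ α β s r r′ → r + r′ ≈ s → r * r′ ≈ α * β → ∀ k →
    α * (geometricSum r α k * geometricSum r′ α k) ≈ α ^ k * F α β s k
  geometricSum-F α β s r r′ sum prod zero =
    solve 1 (λ a → a :* (con (0 , 0) :* con (0 , 0)) := :1 :* con (0 , 0)) refl α
  geometricSum-F α β s r r′ sum prod (suc zero) =
    solve 3 (λ a r r′ → a :* ((r :* con (0 , 0) :+ :1) :* (r′ :* con (0 , 0) :+ :1)) := (a :* :1) :* :1) refl α r r′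
  geometricSum-F α β s r r′ sum prod (suc (suc k)) = begin
    α * ((r * g₁ + α * κ) * (r′ * g₁′ + α * κ))
      ≈⟨ solve 6 (λ α r r′ g₁ g₁′ κ →
           α :* ((r :* g₁ :+ α :* κ) :* (r′ :* g₁′ :+ α :* κ))
           := α :* (r :* r′ :* g₁ :* g₁′ :+ r :* g₁ :* (α :* κ) :+ r′ :* g₁′ :* (α :* κ) :+ (α :* κ) :* (α :* κ)))
           refl α r r′ g₁ g₁′ κ ⟩
    α * (r * r′ * g₁ * g₁′ + r * g₁ * (α * κ) + r′ * g₁′ * (α * κ) + (α * κ) * (α * κ))
      -- The two forms of the next geometric sum express `α κ`. Taking the `r′` version beside
      -- `r g₁` and the `r` version beside `r′ g₁′` collects the mixed terms into multiples of
      -- `g₁ g₁′` and of `(g₁ - ρ) (g₁′ - ρ′)`, up to pure powers.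
      ≈⟨ *-congˡ (+-congʳ (+-cong (+-congˡ (*-congˡ (ακ r′))) (*-congˡ (ακ r)))) ⟩
    α * (r * r′ * g₁ * g₁′ + r * g₁ * (α * g₁′ + r′ * ρ′ - r′ * g₁′)
         + r′ * g₁′ * (α * g₁ + r * ρ - r * g₁) + (α * κ) * (α * κ))
      ≈⟨ solve 8 (λ α r r′ g₁ g₁′ κ ρ ρ′ →
           α :* (r :* r′ :* g₁ :* g₁′ :+ r :* g₁ :* (α :* g₁′ :+ r′ :* ρ′ :- r′ :* g₁′)
             :+ r′ :* g₁′ :* (α :* g₁ :+ r :* ρ :- r :* g₁) :+ (α :* κ) :* (α :* κ))
           := α :* (r :+ r′) :* (α :* (g₁ :* g₁′))
              :- α :* (r :* r′) :* ((g₁ :- ρ) :* (g₁′ :- ρ′))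
              :+ (α :* (α :* κ) :* (α :* κ) :+ α :* ((r :* ρ) :* (r′ :* ρ′))))
           refl α r r′ g₁ g₁′ κ ρ ρ′ ⟩
    α * (r + r′) * (α * (g₁ * g₁′)) - α * (r * r′) * ((g₁ - ρ) * (g₁′ - ρ′))
      + (α * (α * κ) * (α * κ) + α * ((r * ρ) * (r′ * ρ′)))
      -- Since `g₁ - ρ = α g₀`, the preceding product of sums appears; the powers of `r` and `r′`
      -- merge into a power of `α β`.
      ≈⟨ +-cong (+-congˡ (-‿cong (*-congˡ (*-cong (αg r) (αg r′))))) (+-congˡ (*-congˡ
           (trans (sym (^-distrib-* r r′ (suc k))) (trans (^-congˡ (suc k) prod) (^-distrib-* α β (suc k)))))) ⟩
    α * (r + r′) * (α * (g₁ * g₁′)) - α * (r * r′) * ((α * g₀) * (α * g₀′))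
      + (α * (α * κ) * (α * κ) + α * ((α * κ) * β ^ suc k))
      ≈⟨ +-congʳ (+-cong (*-cong (*-congˡ sum) (geometricSum-F α β s r r′ sum prod (suc k)))
           (-‿cong (trans (*-cong (*-congˡ prod)
             (solve 3 (λ α g g′ → (α :* g) :* (α :* g′) := α :* (α :* (g :* g′))) refl α g₀ g₀′))
             (*-congˡ (*-congˡ (geometricSum-F α β s r r′ sum prod k)))))) ⟩
    α * s * ((α * κ) * F α β s (suc k)) - α * (α * β) * (α * (κ * F α β s k))
      + (α * (α * κ) * (α * κ) + α * ((α * κ) * β ^ suc k))
      ≈⟨ solve 7 (λ α β s κ f₁ f₀ b →
           α :* s :* ((α :* κ) :* f₁) :- α :* (α :* β) :* (α :* (κ :* f₀))
             :+ (α :* (α :* κ) :* (α :* κ) :+ α :* ((α :* κ) :* b))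
           := (α :* (α :* κ)) :* (s :* f₁ :- α :* β :* f₀ :+ (α :* κ :+ b)))
           refl α β s κ (F α β s (suc k)) (F α β s k) (β ^ suc k) ⟩
    (α * (α * κ)) * F α β s (suc (suc k)) ∎
    where
    κ ρ ρ′ g₀ g₀′ g₁ g₁′ : Carrier
    κ   = α ^ k
    ρ   = r ^ k
    ρ′  = r′ ^ k
    g₀  = geometricSum r α k
    g₀′ = geometricSum r′ α k
    g₁  = geometricSum r α (suc k)
    g₁′ = geometricSum r′ α (suc k)

    αg : ∀ r → geometricSum r α (suc k) - r ^ k ≈ α * geometricSum r α k
    αg r = trans (+-congʳ (geometricSum-shift r α k))
      (solve 2 (λ x y → x :+ y :- y := x) refl _ (r ^ k))

    ακ : ∀ r → α * κ ≈ α * geometricSum r α (suc k) + r * r ^ k - r * geometricSum r α (suc k)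
    ακ r = trans (solve 2 (λ x y → x := y :+ x :- y) refl _ (r * geometricSum r α (suc k)))
                 (+-congʳ (geometricSum-shift r α (suc k)))

module _ {a b ℓ₁ ℓ₂} (R : CommutativeRing a ℓ₁) (S : CommutativeRing b ℓ₂)
         {φ : CommutativeRing.Carrier R → CommutativeRing.Carrier S}
         (φ-hom : IsRingHomomorphism (CommutativeRing.rawRing R) (CommutativeRing.rawRing S) φ) where
  private
    module R  = CommutativeRing R
    module PR = Products R
    module FR = Recurrence R
    module ER = Exp R.commutativeSemiring
  open CommutativeRing S
  open IsRingHomomorphism φ-hom
  open Products S
  open Recurrence S
  open Exp commutativeSemiring using (_^_)

  homomorphism-^ : ∀ x k → φ (x ER.^ k) ≈ φ x ^ k
  homomorphism-^ x zero    = 1#-homo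
  homomorphism-^ x (suc k) = trans (*-homo _ _) (*-congˡ (homomorphism-^ x k))

  homomorphism-product : ∀ k f → φ (PR.product k f) ≈ product k (λ i → φ (f i))
  homomorphism-product zero    f = 1#-homo
  homomorphism-product (suc k) f = trans (*-homo _ _) (*-congʳ (homomorphism-product k f))

  homomorphism-quadratic : ∀ α β s Q → φ (α R.* (Q R.* Q) R.- s R.* Q R.+ β)
                         ≈ φ α * (φ Q * φ Q) - φ s * φ Q + φ β
  homomorphism-quadratic α β s Q = trans (+-homo _ _) (+-congʳ (trans (homomorphism-minus R S φ-hom _ _)
    (+-cong (trans (*-homo _ _) (*-congˡ (*-homo _ _))) (-‿cong (*-homo _ _)))))

  homomorphism-F : ∀ α β s k → φ (FR.F α β s k) ≈ F (φ α) (φ β) (φ s) k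
  homomorphism-F α β s zero          = 0#-homo
  homomorphism-F α β s (suc zero)    = 1#-homo
  homomorphism-F α β s (suc (suc k)) = trans (+-homo _ _) (+-cong
    (trans (homomorphism-minus R S φ-hom _ _) (+-cong
      (trans (*-homo _ _) (*-congˡ (homomorphism-F α β s (suc k))))
      (-‿cong (trans (*-homo _ _) (*-cong (*-homo _ _) (homomorphism-F α β s k))))))
    (trans (+-homo _ _) (+-cong (homomorphism-^ α (suc k)) (homomorphism-^ β (suc k)))))

module _ {a b ℓ₁ ℓ₂} (K : CommutativeRing a ℓ₁) (R : CommutativeRing b ℓ₂)
         {ι : CommutativeRing.Carrier K → CommutativeRing.Carrier R}
         (ι-hom : IsRingHomomorphism (CommutativeRing.rawRing K) (CommutativeRing.rawRing R) ι)
         (ζ : CommutativeRing.Carrier K) (k : ℕ) where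
  private
    module K  = CommutativeRing K
    open Exp K.commutativeSemiring using () renaming (_^_ to _^ₖ_)
  open CommutativeRing R
  open Products R
  open Recurrence R
  open Exp commutativeSemiring using (_^_)
  open Solver R
  open SetoidReasoning setoid

  module _ (ζⁿ≈1 : ζ ^ₖ suc k K.≈ K.1#)
           (regular : ∀ i → 0 < i → i < suc k → ∀ x → ζ ^ₖ i K.* x K.≈ x → x K.≈ K.0#) where

    -- Each of the `k` quadratics absorbs one `α` in order to split into linear factors, and
    -- `geometricSum-F` takes one more. These factors are kept on both sides, so that nothing has to
    -- be cancelled in the extension.
    product-split : ∀ α β s r r′ → r + r′ ≈ s → r * r′ ≈ α * β →
      α * (α ^ k * product k (λ i → let Q = ι (ζ ^ₖ suc i) in α * (Q * Q) - s * Q + β))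
      ≈ α * (α ^ k * F α β s (suc k))
    product-split α β s r r′ sum prod = begin
      α * (α ^ k * product k quadratic)
        ≈⟨ *-congˡ (*-congʳ (product-const k α)) ⟨
      α * (product k (λ _ → α) * product k quadratic)
        ≈⟨ *-congˡ (product-* k (λ _ → α) quadratic) ⟨
      α * product k (λ i → α * quadratic i)
        ≈⟨ *-congˡ (product-cong k factor) ⟩
      α * product k (λ i → (r - Q i * α) * (r′ - Q i * α))
        ≈⟨ *-congˡ (product-* k (λ i → r - Q i * α) (λ i → r′ - Q i * α)) ⟩
      α * (product k (λ i → r - Q i * α) * product k (λ i → r′ - Q i * α))
        ≈⟨ *-congˡ (*-cong (product-rootsOfUnity K R ι-hom ζ k ζⁿ≈1 regular r α)
                           (product-rootsOfUnity K R ι-hom ζ k ζⁿ≈1 regular r′ α)) ⟩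
      α * (geometricSum r α (suc k) * geometricSum r′ α (suc k))
        ≈⟨ geometricSum-F α β s r r′ sum prod (suc k) ⟩
      (α * α ^ k) * F α β s (suc k)
        ≈⟨ *-assoc _ _ _ ⟩
      α * (α ^ k * F α β s (suc k)) ∎
      where
      Q quadratic : ℕ → Carrier
      Q i = ι (ζ ^ₖ suc i)
      quadratic i = α * (Q i * Q i) - s * Q i + β

      factor : ∀ i → α * quadratic i ≈ (r - Q i * α) * (r′ - Q i * α)
      factor i = begin
        α * (α * (Q i * Q i) - s * Q i + β)
          ≈⟨ solve 4 (λ α β s Q → α :* (α :* (Q :* Q) :- s :* Q :+ β)
               := α :* α :* (Q :* Q) :- α :* Q :* s :+ α :* β) refl α β s (Q i) ⟩
        α * α * (Q i * Q i) - α * Q i * s + α * β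
          ≈⟨ +-cong (+-congˡ (-‿cong (*-congˡ sum))) prod ⟨
        α * α * (Q i * Q i) - α * Q i * (r + r′) + r * r′
          ≈⟨ solve 4 (λ α r r′ Q → α :* α :* (Q :* Q) :- α :* Q :* (r :+ r′) :+ r :* r′
               := (r :- Q :* α) :* (r′ :- Q :* α)) refl α r r′ (Q i) ⟩
        (r - Q i * α) * (r′ - Q i * α) ∎

module _ {a b ℓ₁ ℓ₂} (K : CommutativeRing a ℓ₁) (R : CommutativeRing b ℓ₂)
         {ι : CommutativeRing.Carrier K → CommutativeRing.Carrier R}
         (ι-hom : IsRingHomomorphism (CommutativeRing.rawRing K) (CommutativeRing.rawRing R) ι) where
  private
    module K  = CommutativeRing K
    open Exp K.commutativeSemiring using () renaming (_^_ to _^ₖ_)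
  open CommutativeRing R
  open Products R
  open Recurrence R
  open Exp commutativeSemiring using (_^_)

  -- The factors α Q² - s Q + β split over R[r]/(r² - s r + α β), up to α.
  product-quadratic : ∀ ζ k → ζ ^ₖ suc k K.≈ K.1# →
    (∀ i → 0 < i → i < suc k → ∀ x → ζ ^ₖ i K.* x K.≈ x → x K.≈ K.0#) →
    ∀ α β s → (∀ {x y} → α * x ≈ α * y → x ≈ y) →
    product k (λ i → let Q = ι (ζ ^ₖ suc i) in α * (Q * Q) - s * Q + β) ≈ F α β s (suc k)
  product-quadratic ζ k ζⁿ≈1 regular α β s α-cancel =
    -- Taking first coordinates brings the identity from the extension back to `R`: embedded
    -- elements are equal only if their first coordinates are.
    α^-cancel k (α-cancel (proj₁ (E.trans (embed-α P) (E.trans (E.*-congˡ (E.*-congˡ embed-P))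
      (E.trans (product-split K E (Composition.isRingHomomorphism E.trans ι-hom X.embed-isRingHomomorphism)
                 ζ k ζⁿ≈1 regular _ _ _ X.root X.conjugateRoot X.root+conjugateRoot
                 (E.trans X.root*conjugateRoot (X*-homo α β)))
        (E.sym (E.trans (embed-α (F α β s (suc k)))
          (E.*-congˡ (E.*-congˡ (homomorphism-F R E X.embed-isRingHomomorphism α β s (suc k)))))))))))
    where
    module X = QuadraticExtension R s (α * β)
    E : CommutativeRing _ _
    E = X.commutativeRing
    module E = CommutativeRing E
    module EE = Exp E.commutativeSemiring
    X*-homo = IsRingHomomorphism.*-homo X.embed-isRingHomomorphism

    f : ℕ → Carrier
    f i = let Q = ι (ζ ^ₖ suc i) in α * (Q * Q) - s * Q + β
    P : Carrier
    P = product k f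

    α^-cancel : ∀ k {x y} → α ^ k * x ≈ α ^ k * y → x ≈ y
    α^-cancel zero    eq = trans (sym (*-identityˡ _)) (trans eq (*-identityˡ _))
    α^-cancel (suc k) eq = α^-cancel k (α-cancel (trans (sym (*-assoc _ _ _)) (trans eq (*-assoc _ _ _))))

    embed-α : ∀ x → X.embed (α * (α ^ k * x)) E.≈ X.embed α E.* (X.embed α EE.^ k E.* X.embed x)
    embed-α x = E.trans (X*-homo α (α ^ k * x)) (E.*-congˡ (E.trans (X*-homo (α ^ k) x)
      (E.*-congʳ (homomorphism-^ R E X.embed-isRingHomomorphism α k))))

    embed-P : X.embed P E.≈ _
    embed-P = E.trans (homomorphism-product R E X.embed-isRingHomomorphism k f)
      (Products.product-cong E k λ i →
        homomorphism-quadratic R E X.embed-isRingHomomorphism α β s (ι (ζ ^ₖ suc i)))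

-- The integer coefficients of `n Uₙ`.

module Coefficients where
  open import Data.Nat.Base using (_+_; _*_)
  open ℕSolver.+-*-Solver
  open ≡.≡-Reasoning

  -- h a e is the binomial coefficient (a + e choose a), and k a e = h (a - 1) e.
  h : ℕ → ℕ → ℕ
  h zero    e       = 1
  h (suc a) zero    = 1
  h (suc a) (suc e) = h a (suc e) + h (suc a) e

  k : ℕ → ℕ → ℕ
  k zero    e = 0
  k (suc a) e = h a e

  h-zeroʳ : ∀ a → h a 0 ≡ 1
  h-zeroʳ zero    = ≡.refl
  h-zeroʳ (suc a) = ≡.refl

  k-suc : ∀ a e → k (suc a) (suc e) ≡ k a (suc e) + k (suc a) e
  k-suc zero    e = ≡.refl
  k-suc (suc a) e = ≡.refl

  h≡C : ∀ a e → h a e ≡ (a + e) C a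
  h≡C zero    e       = ≡.refl
  h≡C (suc a) zero    = ≡.sym (≡.trans (≡.cong (_C suc a) (ℕ.+-identityʳ (suc a))) (nCn≡1 (suc a)))
  h≡C (suc a) (suc e) = begin
    h a (suc e) + h (suc a) e                        ≡⟨ ≡.cong₂ _+_ (h≡C a (suc e)) (h≡C (suc a) e) ⟩
    (a + suc e) C a + (suc a + e) C suc a            ≡⟨ ≡.cong (λ m → (a + suc e) C a + m C suc a) (ℕ.+-suc a e) ⟨
    (a + suc e) C a + (a + suc e) C suc a            ≡⟨ nCk+nC[k+1]≡[n+1]C[k+1] (a + suc e) a ⟩
    suc (a + suc e) C suc a                          ∎

  -- Both sides are `(a + e + 1)! / (a! e!)`; the induction uses only Pascal's rule.
  h-exchange : ∀ a e → suc e * h a (suc e) ≡ suc a * h (suc a) e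
  h-exchange zero    zero    = ≡.refl
  h-exchange zero    (suc e) = begin
    suc (suc e) * 1                   ≡⟨ solve 1 (λ e → (con 2 :+ e) :* con 1 := con 1 :+ (con 1 :+ e) :* con 1) ≡.refl e ⟩
    1 + suc e * h 0 (suc e)           ≡⟨ ≡.cong suc (h-exchange 0 e) ⟩
    1 + 1 * h 1 e                     ≡⟨ solve 1 (λ x → con 1 :+ con 1 :* x := con 1 :* (con 1 :+ x)) ≡.refl (h 1 e) ⟩
    1 * (1 + h 1 e)                   ∎
  h-exchange (suc a) zero    = begin
    1 * (h a 1 + 1)                   ≡⟨ solve 1 (λ x → con 1 :* (x :+ con 1) := con 1 :* x :+ con 1) ≡.refl (h a 1) ⟩
    1 * h a 1 + 1                     ≡⟨ ≡.cong (_+ 1) (h-exchange a 0) ⟩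
    suc a * 1 + 1                     ≡⟨ solve 1 (λ a → (con 1 :+ a) :* con 1 :+ con 1 := (con 2 :+ a) :* con 1) ≡.refl a ⟩
    suc (suc a) * 1                   ∎
  h-exchange (suc a) (suc e) = begin
    suc (suc e) * (h a (2 + e) + y)
      ≡⟨ ℕ.*-distribˡ-+ (suc (suc e)) (h a (2 + e)) y ⟩
    suc (suc e) * h a (2 + e) + suc (suc e) * y
      ≡⟨ ≡.cong (_+ suc (suc e) * y) (h-exchange a (suc e)) ⟩
    suc a * y + suc (suc e) * y
      ≡⟨ solve 3 (λ a e y → (con 1 :+ a) :* y :+ (con 2 :+ e) :* y := (con 2 :+ a) :* y :+ (con 1 :+ e) :* y)
           ≡.refl a e y ⟩
    suc (suc a) * y + suc e * y
      ≡⟨ ≡.cong (suc (suc a) * y +_) (h-exchange (suc a) e) ⟩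
    suc (suc a) * y + suc (suc a) * h (2 + a) e
      ≡⟨ ℕ.*-distribˡ-+ (suc (suc a)) y (h (2 + a) e) ⟨
    suc (suc a) * (y + h (2 + a) e) ∎
    where y = h (suc a) (suc e)

  h-absorption : ∀ a e → suc e * h a (suc e) ≡ suc (a + e) * h a e
  h-absorption zero    e = ≡.refl
  h-absorption (suc a) e = begin
    suc e * (h a (suc e) + h (suc a) e)              ≡⟨ ℕ.*-distribˡ-+ (suc e) (h a (suc e)) _ ⟩
    suc e * h a (suc e) + suc e * h (suc a) e        ≡⟨ ≡.cong (_+ suc e * h (suc a) e) (h-exchange a e) ⟩
    suc a * h (suc a) e + suc e * h (suc a) e
      ≡⟨ solve 3 (λ a e y → (con 1 :+ a) :* y :+ (con 1 :+ e) :* y := (con 2 :+ (a :+ e)) :* y) ≡.refl a e (h (suc a) e) ⟩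
    suc (suc a + e) * h (suc a) e                    ∎

  k-absorption : ∀ b e → suc e * k b (suc e) ≡ b * h b e
  k-absorption zero    e = ℕ.*-zeroʳ (suc e)
  k-absorption (suc b) e = h-exchange b e

  -- The coefficient of `αᵃ βᵇ wᵉ` in `n Uₙ` for `n = a + b + e + 1` and `w = τ (u₃ - u₁ u₂)`,
  -- namely `n / (e + 1)` times `C(a + e, a) C(b + e, b)`, written without division so that Pascal's
  -- rule applies.
  N : ℕ → ℕ → ℕ → ℕ
  N a b e = h a (suc e) * h b e + h a e * k b (suc e)

  -- Multiplied by `e + 1`, the two summands of `N` contribute the common product of binomials
  -- `a + e + 1` and `b` times; these multiplicities add up to `n`.
  N-closed : ∀ a b e → suc e * N a b e ≡ suc (a + b + e) * (h b e * h a e)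
  N-closed a b e = begin
    suc e * (h a (suc e) * h b e + h a e * k b (suc e))
      ≡⟨ solve 5 (λ e x y z w → e :* (x :* y :+ z :* w) := (e :* x) :* y :+ z :* (e :* w))
           ≡.refl (suc e) (h a (suc e)) (h b e) (h a e) (k b (suc e)) ⟩
    (suc e * h a (suc e)) * h b e + h a e * (suc e * k b (suc e))
      ≡⟨ ≡.cong₂ (λ x y → x * h b e + h a e * y) (h-absorption a e) (k-absorption b e) ⟩
    (suc (a + e) * h a e) * h b e + h a e * (b * h b e)
      ≡⟨ solve 5 (λ a b e x y → ((con 1 :+ (a :+ e)) :* x) :* y :+ x :* (b :* y) := (con 1 :+ (a :+ b :+ e)) :* (y :* x))
           ≡.refl a b e (h a e) (h b e) ⟩
    suc (a + b + e) * (h b e * h a e) ∎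

  -- On coefficient functions these are multiplication by `α`, `β` and `w`.
  ↑₁ ↑₂ ↑₃ : (ℕ → ℕ → ℕ → ℕ) → ℕ → ℕ → ℕ → ℕ
  ↑₁ M zero    b e = 0
  ↑₁ M (suc a) b e = M a b e
  ↑₂ M a zero    e = 0
  ↑₂ M a (suc b) e = M a b e
  ↑₃ M a b zero    = 0
  ↑₃ M a b (suc e) = M a b e

  -- The coefficients of the pure powers of `α` and of `β`. The constant monomial belongs to `δ₁`
  -- alone, so that it is counted once.
  δ₁ δ₂ : ℕ → ℕ → ℕ → ℕ
  δ₁ a zero zero = 1
  δ₁ a _    _    = 0
  δ₂ zero (suc b) zero = 1
  δ₂ _    _       _    = 0

  -- The recurrence of `F` read off coefficient by coefficient, with `s = α + β + w` and the term in
  -- `α β` moved to the left to avoid subtraction. In the interior it is Pascal's rule applied in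
  -- each variable; the other clauses are the boundary.
  N-recurrence : ∀ a b e → N a b e + ↑₁ (↑₂ N) a b e
                         ≡ ↑₃ N a b e + ↑₁ N a b e + ↑₂ N a b e + δ₁ a b e + δ₂ a b e
  N-recurrence zero    zero    zero    = ≡.refl
  N-recurrence zero    zero    (suc e) = ≡.refl
  N-recurrence (suc a) zero    zero    rewrite h-zeroʳ a =
    solve 1 (λ x → (x :+ con 1) :* con 1 :+ con 0 :+ con 0
      := con 0 :+ (x :* con 1 :+ con 0) :+ con 0 :+ con 1 :+ con 0) ≡.refl (h a 1)
  N-recurrence zero    (suc b) zero    rewrite k-suc b 0 | h-zeroʳ b =
    solve 1 (λ y → con 1 :+ con 1 :* (y :+ con 1) :+ con 0
      := con 0 :+ con 0 :+ (con 1 :+ con 1 :* y) :+ con 0 :+ con 1) ≡.refl (k b 1)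
  N-recurrence (suc a) (suc b) zero    rewrite k-suc b 0 | h-zeroʳ b | h-zeroʳ a =
    solve 2 (λ x y → (x :+ con 1) :* con 1 :+ con 1 :* (y :+ con 1) :+ (x :* con 1 :+ con 1 :* y)
      := con 0 :+ (x :* con 1 :+ con 1 :* (y :+ con 1)) :+ ((x :+ con 1) :* con 1 :+ con 1 :* y) :+ con 0 :+ con 0)
      ≡.refl (h a 1) (k b 1)
  N-recurrence zero    (suc b) (suc e) rewrite k-suc b (suc e) =
    solve 3 (λ x y z → con 1 :* (x :+ y) :+ con 1 :* (z :+ x) :+ con 0
      := (con 1 :* y :+ con 1 :* x) :+ con 0 :+ (con 1 :* x :+ con 1 :* z) :+ con 0 :+ con 0)
      ≡.refl (h b (suc e)) (h (suc b) e) (k b (2 + e))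
  N-recurrence (suc a) zero    (suc e) =
    solve 3 (λ x p q → (x :+ (p :+ q)) :* con 1 :+ (p :+ q) :* con 0 :+ con 0
      := ((p :+ q) :* con 1 :+ q :* con 0) :+ (x :* con 1 :+ p :* con 0) :+ con 0 :+ con 0 :+ con 0)
      ≡.refl (h a (2 + e)) (h a (suc e)) (h (suc a) e)
  N-recurrence (suc a) (suc b) (suc e) rewrite k-suc b (suc e) =
    solve 6 (λ A₂ A₁ P₀ B₁ R₀ K₂ →
      (A₂ :+ (A₁ :+ P₀)) :* (B₁ :+ R₀) :+ (A₁ :+ P₀) :* (K₂ :+ B₁) :+ (A₂ :* B₁ :+ A₁ :* K₂)
      := ((A₁ :+ P₀) :* R₀ :+ P₀ :* B₁) :+ (A₂ :* (B₁ :+ R₀) :+ A₁ :* (K₂ :+ B₁))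
         :+ ((A₂ :+ (A₁ :+ P₀)) :* B₁ :+ (A₁ :+ P₀) :* K₂) :+ con 0 :+ con 0)
      ≡.refl (h a (2 + e)) (h a (suc e)) (h (suc a) e) (h b (suc e)) (h (suc b) e) (k b (2 + e))

-- Homogeneous sums in `α`, `β`, `w`.

module HomogeneousSums {c ℓ} (R : CommutativeRing c ℓ) (α β w : CommutativeRing.Carrier R) where
  open CommutativeRing R
  open Solver R
  open Exp commutativeSemiring using (_^_)
  open SemiringMult semiring using (×-homo-+) renaming (_×_ to _·_)
  open SumProperties semiring using (sum; sum-cong-≋; *-distribˡ-sum; ∑-distrib-+)
  open Recurrence R using (F)
  open Coefficients
  open SetoidReasoning setoid

  private
    term₂ : ℕ → (ℕ → ℕ → ℕ) → ℕ → Carrier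
    term₂ k M j = (M j (k ∸ j) · 1#) * (β ^ j * w ^ (k ∸ j))

  opaque
    -- The part of total degree `k` of the series in `β` and `w` with coefficients `M`. Being
    -- opaque, it is used through its recursion in the degree, additivity and congruence.
    homogeneous₂ : ℕ → (ℕ → ℕ → ℕ) → Carrier
    homogeneous₂ k M = sum {suc k} λ i → term₂ k M (toℕ i)

    homogeneous₂-suc : ∀ k M → homogeneous₂ (suc k) M
      ≈ (M 0 (suc k) · 1#) * w ^ suc k + β * homogeneous₂ k (λ j → M (suc j))
    homogeneous₂-suc k M = +-cong (*-congˡ (*-identityˡ _)) (sym (trans
      (*-distribˡ-sum {suc k} β (λ i → term₂ k (λ j → M (suc j)) (toℕ i)))
      (sum-cong-≋ {suc k} λ i →
        solve 4 (λ m b x y → b :* (m :* (x :* y)) := m :* ((b :* x) :* y))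
          refl (M (suc (toℕ i)) (k ∸ toℕ i) · 1#) β (β ^ toℕ i) (w ^ (k ∸ toℕ i)))))

    homogeneous₂-0 : ∀ M → homogeneous₂ 0 M ≈ M 0 0 · 1#
    homogeneous₂-0 M = solve 1 (λ m → m :* (:1 :* :1) :+ con (0 , 0) := m) refl _

    homogeneous₂-cong : ∀ k {M M′} → (∀ b e → M b e ≡ M′ b e) → homogeneous₂ k M ≈ homogeneous₂ k M′
    homogeneous₂-cong k eq = sum-cong-≋ {suc k} λ i → let j = toℕ i in
      *-congʳ {β ^ j * w ^ (k ∸ j)} (reflexive (≡.cong (_· 1#) (eq j (k ∸ j))))

    homogeneous₂-+ : ∀ k M M′ → homogeneous₂ k (λ b e → M b e ℕ.+ M′ b e) ≈ homogeneous₂ k M + homogeneous₂ k M′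
    homogeneous₂-+ k M M′ = trans
      (sum-cong-≋ {suc k} λ i → let j = toℕ i in
        trans (*-congʳ {β ^ j * w ^ (k ∸ j)} (×-homo-+ 1# (M j (k ∸ j)) (M′ j (k ∸ j)))) (distribʳ _ _ _))
      (∑-distrib-+ {suc k} (λ i → term₂ k M (toℕ i)) (λ i → term₂ k M′ (toℕ i)))

  private
    term₃ : ℕ → (ℕ → ℕ → ℕ → ℕ) → ℕ → Carrier
    term₃ k M j = α ^ j * homogeneous₂ (k ∸ j) (M j)

  opaque
    homogeneous₃ : ℕ → (ℕ → ℕ → ℕ → ℕ) → Carrier
    homogeneous₃ k M = sum {suc k} λ i → term₃ k M (toℕ i)

    homogeneous₃-suc : ∀ k M → homogeneous₃ (suc k) M
      ≈ homogeneous₂ (suc k) (M 0) + α * homogeneous₃ k (λ j → M (suc j))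
    homogeneous₃-suc k M = +-cong (*-identityˡ _) (sym (trans
      (*-distribˡ-sum {suc k} α (λ i → term₃ k (λ j → M (suc j)) (toℕ i)))
      (sum-cong-≋ {suc k} λ i → sym (*-assoc α (α ^ toℕ i) (homogeneous₂ (k ∸ toℕ i) (M (suc (toℕ i))))))))

    homogeneous₃-0 : ∀ M → homogeneous₃ 0 M ≈ M 0 0 0 · 1#
    homogeneous₃-0 M = trans (trans (+-identityʳ _) (*-identityˡ _)) (homogeneous₂-0 (M 0))

    homogeneous₃-cong : ∀ k {M M′} → (∀ a b e → M a b e ≡ M′ a b e) → homogeneous₃ k M ≈ homogeneous₃ k M′
    homogeneous₃-cong k eq = sum-cong-≋ {suc k} λ i →
      *-congˡ {α ^ toℕ i} (homogeneous₂-cong (k ∸ toℕ i) (eq (toℕ i)))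

    homogeneous₃-+ : ∀ k M M′ → homogeneous₃ k (λ a b e → M a b e ℕ.+ M′ a b e) ≈ homogeneous₃ k M + homogeneous₃ k M′
    homogeneous₃-+ k M M′ = trans
      (sum-cong-≋ {suc k} λ i → let j = toℕ i in
        trans (*-congˡ {α ^ j} (homogeneous₂-+ (k ∸ j) (M j) (M′ j))) (distribˡ _ _ _))
      (∑-distrib-+ {suc k} (λ i → term₃ k M (toℕ i)) (λ i → term₃ k M′ (toℕ i)))

  homogeneous₂-zero : ∀ k {M} → (∀ b e → M b e ≡ 0) → homogeneous₂ k M ≈ 0#
  homogeneous₂-zero zero    {M} eq = trans (homogeneous₂-0 M) (reflexive (≡.cong (_· 1#) (eq 0 0)))
  homogeneous₂-zero (suc k) {M} eq = trans (homogeneous₂-suc k M) (trans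
    (+-cong (*-congʳ (reflexive (≡.cong (_· 1#) (eq 0 (suc k))))) (*-congˡ (homogeneous₂-zero k λ b → eq (suc b))))
    (solve 2 (λ x y → con (0 , 0) :* x :+ y :* con (0 , 0) := con (0 , 0)) refl _ _))

  homogeneous₃-zero : ∀ k {M} → (∀ a b e → M a b e ≡ 0) → homogeneous₃ k M ≈ 0#
  homogeneous₃-zero zero    {M} eq = trans (homogeneous₃-0 M) (reflexive (≡.cong (_· 1#) (eq 0 0 0)))
  homogeneous₃-zero (suc k) {M} eq = trans (homogeneous₃-suc k M) (trans
    (+-cong (homogeneous₂-zero (suc k) (eq 0)) (*-congˡ (homogeneous₃-zero k λ b → eq (suc b))))
    (solve 1 (λ y → con (0 , 0) :+ y :* con (0 , 0) := con (0 , 0)) refl _))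

  homogeneous₃-↑₁ : ∀ k M → homogeneous₃ (suc k) (↑₁ M) ≈ α * homogeneous₃ k M
  homogeneous₃-↑₁ k M = trans (homogeneous₃-suc k (↑₁ M))
    (trans (+-congʳ (homogeneous₂-zero (suc k) λ _ _ → ≡.refl)) (+-identityˡ _))

  homogeneous₂-↑₂ : ∀ k M a → homogeneous₂ (suc k) (↑₂ M a) ≈ β * homogeneous₂ k (M a)
  homogeneous₂-↑₂ k M a = trans (homogeneous₂-suc k (↑₂ M a))
    (trans (+-congʳ (zeroˡ _)) (+-identityˡ _))

  homogeneous₃-↑₂ : ∀ k M → homogeneous₃ (suc k) (↑₂ M) ≈ β * homogeneous₃ k M
  homogeneous₃-↑₂ zero    M = begin
    homogeneous₃ 1 (↑₂ M)
      ≈⟨ homogeneous₃-suc 0 (↑₂ M) ⟩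
    homogeneous₂ 1 (↑₂ M 0) + α * homogeneous₃ 0 (λ a → ↑₂ M (suc a))
      ≈⟨ +-cong (homogeneous₂-↑₂ 0 M 0) (*-congˡ (homogeneous₃-0 (λ a → ↑₂ M (suc a)))) ⟩
    β * homogeneous₂ 0 (M 0) + α * 0#
      ≈⟨ +-cong (*-congˡ (trans (homogeneous₂-0 (M 0)) (sym (homogeneous₃-0 M)))) (zeroʳ α) ⟩
    β * homogeneous₃ 0 M + 0#
      ≈⟨ +-identityʳ _ ⟩
    β * homogeneous₃ 0 M ∎
  homogeneous₃-↑₂ (suc k) M = begin
    homogeneous₃ (2 ℕ.+ k) (↑₂ M)
      ≈⟨ homogeneous₃-suc (suc k) (↑₂ M) ⟩
    homogeneous₂ (2 ℕ.+ k) (↑₂ M 0) + α * homogeneous₃ (suc k) (λ a → ↑₂ M (suc a))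
      ≈⟨ +-cong (homogeneous₂-↑₂ (suc k) M 0) (*-congˡ (trans
           (homogeneous₃-cong (suc k) λ { a zero e → ≡.refl ; a (suc b) e → ≡.refl })
           (homogeneous₃-↑₂ k (λ a → M (suc a))))) ⟩
    β * homogeneous₂ (suc k) (M 0) + α * (β * homogeneous₃ k (λ a → M (suc a)))
      ≈⟨ solve 4 (λ a b x y → b :* x :+ a :* (b :* y) := b :* (x :+ a :* y)) refl α β _ _ ⟩
    β * (homogeneous₂ (suc k) (M 0) + α * homogeneous₃ k (λ a → M (suc a)))
      ≈⟨ *-congˡ (homogeneous₃-suc k M) ⟨
    β * homogeneous₃ (suc k) M ∎

  homogeneous₂-↑₃ : ∀ k (M : ℕ → ℕ → ℕ → ℕ) a → homogeneous₂ (suc k) (↑₃ M a) ≈ w * homogeneous₂ k (M a)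
  homogeneous₂-↑₃ zero    M a = begin
    homogeneous₂ 1 (↑₃ M a)
      ≈⟨ homogeneous₂-suc 0 (↑₃ M a) ⟩
    (M a 0 0 · 1#) * (w * 1#) + β * homogeneous₂ 0 (λ b → ↑₃ M a (suc b))
      ≈⟨ +-congˡ (*-congˡ (homogeneous₂-0 (λ b → ↑₃ M a (suc b)))) ⟩
    (M a 0 0 · 1#) * (w * 1#) + β * 0#
      ≈⟨ solve 3 (λ m w b → m :* (w :* :1) :+ b :* con (0 , 0) := w :* m) refl _ w β ⟩
    w * (M a 0 0 · 1#)
      ≈⟨ *-congˡ (homogeneous₂-0 (M a)) ⟨
    w * homogeneous₂ 0 (M a) ∎
  homogeneous₂-↑₃ (suc k) M a = begin
    homogeneous₂ (2 ℕ.+ k) (↑₃ M a)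
      ≈⟨ homogeneous₂-suc (suc k) (↑₃ M a) ⟩
    (M a 0 (suc k) · 1#) * (w * w ^ suc k) + β * homogeneous₂ (suc k) (λ b → ↑₃ M a (suc b))
      ≈⟨ +-congˡ (*-congˡ (trans
           (homogeneous₂-cong (suc k) λ { b zero → ≡.refl ; b (suc e) → ≡.refl })
           -- The shift `↑₃` does not touch the first index, so the induction hypothesis is applied
           -- to a family constant in it, with the second index advanced.
           (homogeneous₂-↑₃ k (λ _ b → M a (suc b)) a))) ⟩
    (M a 0 (suc k) · 1#) * (w * w ^ suc k) + β * (w * homogeneous₂ k (λ b → M a (suc b)))
      ≈⟨ solve 5 (λ m w x b y → m :* (w :* x) :+ b :* (w :* y) := w :* (m :* x :+ b :* y)) refl _ w _ β _ ⟩
    w * ((M a 0 (suc k) · 1#) * w ^ suc k + β * homogeneous₂ k (λ b → M a (suc b)))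
      ≈⟨ *-congˡ (homogeneous₂-suc k (M a)) ⟨
    w * homogeneous₂ (suc k) (M a) ∎

  homogeneous₃-↑₃ : ∀ k M → homogeneous₃ (suc k) (↑₃ M) ≈ w * homogeneous₃ k M
  homogeneous₃-↑₃ zero    M = begin
    homogeneous₃ 1 (↑₃ M)
      ≈⟨ homogeneous₃-suc 0 (↑₃ M) ⟩
    homogeneous₂ 1 (↑₃ M 0) + α * homogeneous₃ 0 (λ a → ↑₃ M (suc a))
      ≈⟨ +-cong (homogeneous₂-↑₃ 0 M 0) (*-congˡ (homogeneous₃-0 (λ a → ↑₃ M (suc a)))) ⟩
    w * homogeneous₂ 0 (M 0) + α * 0#
      ≈⟨ +-cong (*-congˡ (trans (homogeneous₂-0 (M 0)) (sym (homogeneous₃-0 M)))) (zeroʳ α) ⟩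
    w * homogeneous₃ 0 M + 0#
      ≈⟨ +-identityʳ _ ⟩
    w * homogeneous₃ 0 M ∎
  homogeneous₃-↑₃ (suc k) M = begin
    homogeneous₃ (2 ℕ.+ k) (↑₃ M)
      ≈⟨ homogeneous₃-suc (suc k) (↑₃ M) ⟩
    homogeneous₂ (2 ℕ.+ k) (↑₃ M 0) + α * homogeneous₃ (suc k) (λ a → ↑₃ M (suc a))
      ≈⟨ +-cong (homogeneous₂-↑₃ (suc k) M 0) (*-congˡ (trans
           (homogeneous₃-cong (suc k) λ { a b zero → ≡.refl ; a b (suc e) → ≡.refl })
           (homogeneous₃-↑₃ k (λ a → M (suc a))))) ⟩
    w * homogeneous₂ (suc k) (M 0) + α * (w * homogeneous₃ k (λ a → M (suc a)))
      ≈⟨ solve 4 (λ a b x y → b :* x :+ a :* (b :* y) := b :* (x :+ a :* y)) refl α w _ _ ⟩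
    w * (homogeneous₂ (suc k) (M 0) + α * homogeneous₃ k (λ a → M (suc a)))
      ≈⟨ *-congˡ (homogeneous₃-suc k M) ⟨
    w * homogeneous₃ (suc k) M ∎

  homogeneous₃-δ₁ : ∀ k → homogeneous₃ k δ₁ ≈ α ^ k
  homogeneous₃-δ₁ zero    = trans (homogeneous₃-0 δ₁) (+-identityʳ 1#)
  homogeneous₃-δ₁ (suc k) = begin
    homogeneous₃ (suc k) δ₁
      ≈⟨ homogeneous₃-suc k δ₁ ⟩
    homogeneous₂ (suc k) (δ₁ 0) + α * homogeneous₃ k (λ a → δ₁ (suc a))
      ≈⟨ +-cong (trans (homogeneous₂-suc k (δ₁ 0)) (+-cong (zeroˡ _)
           (trans (*-congˡ (homogeneous₂-zero k λ _ _ → ≡.refl)) (zeroʳ β))))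
         (*-congˡ (trans (homogeneous₃-cong k λ { _ zero zero → ≡.refl ; _ zero (suc _) → ≡.refl ; _ (suc _) _ → ≡.refl })
           (homogeneous₃-δ₁ k))) ⟩
    (0# + 0#) + α * α ^ k
      ≈⟨ solve 1 (λ x → (con (0 , 0) :+ con (0 , 0)) :+ x := x) refl _ ⟩
    α ^ suc k ∎

  homogeneous₂-δ : ∀ k → homogeneous₂ k (λ b → δ₂ 0 (suc b)) ≈ β ^ k
  homogeneous₂-δ zero    = trans (homogeneous₂-0 (λ b → δ₂ 0 (suc b))) (+-identityʳ 1#)
  homogeneous₂-δ (suc k) = begin
    homogeneous₂ (suc k) (λ b → δ₂ 0 (suc b))
      ≈⟨ homogeneous₂-suc k (λ b → δ₂ 0 (suc b)) ⟩
    0# * w ^ suc k + β * homogeneous₂ k (λ b → δ₂ 0 (suc (suc b)))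
      ≈⟨ +-cong (zeroˡ _) (*-congˡ (trans (homogeneous₂-cong k λ { _ zero → ≡.refl ; _ (suc _) → ≡.refl })
           (homogeneous₂-δ k))) ⟩
    0# + β * β ^ k
      ≈⟨ +-identityˡ _ ⟩
    β ^ suc k ∎

  homogeneous₃-δ₂ : ∀ k → homogeneous₃ (suc k) δ₂ ≈ β ^ suc k
  homogeneous₃-δ₂ k = begin
    homogeneous₃ (suc k) δ₂
      ≈⟨ homogeneous₃-suc k δ₂ ⟩
    homogeneous₂ (suc k) (δ₂ 0) + α * homogeneous₃ k (λ a → δ₂ (suc a))
      ≈⟨ +-cong (trans (homogeneous₂-suc k (δ₂ 0)) (+-cong (zeroˡ _) (*-congˡ (homogeneous₂-δ k))))
           (*-congˡ (homogeneous₃-zero k λ _ _ _ → ≡.refl)) ⟩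
    (0# + β * β ^ k) + α * 0#
      ≈⟨ solve 2 (λ x a → (con (0 , 0) :+ x) :+ a :* con (0 , 0) := x) refl _ α ⟩
    β ^ suc k ∎

  homogeneous₃-N-suc : ∀ k → homogeneous₃ (suc k) N + homogeneous₃ (suc k) (↑₁ (↑₂ N))
    ≈ (α + β + w) * homogeneous₃ k N + (α ^ suc k + β ^ suc k)
  homogeneous₃-N-suc k = begin
    H N + H (↑₁ (↑₂ N))
      ≈⟨ homogeneous₃-+ (suc k) N (↑₁ (↑₂ N)) ⟨
    H (λ a b e → N a b e ℕ.+ ↑₁ (↑₂ N) a b e)
      ≈⟨ homogeneous₃-cong (suc k) N-recurrence ⟩
    H (λ a b e → ↑₃ N a b e ℕ.+ ↑₁ N a b e ℕ.+ ↑₂ N a b e ℕ.+ δ₁ a b e ℕ.+ δ₂ a b e)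
      ≈⟨ trans (homogeneous₃-+ (suc k) _ δ₂) (+-congʳ (trans (homogeneous₃-+ (suc k) _ δ₁)
           (+-congʳ (trans (homogeneous₃-+ (suc k) _ (↑₂ N)) (+-congʳ (homogeneous₃-+ (suc k) (↑₃ N) (↑₁ N))))))) ⟩
    H (↑₃ N) + H (↑₁ N) + H (↑₂ N) + H δ₁ + H δ₂
      ≈⟨ +-cong (+-cong (+-cong (+-cong (homogeneous₃-↑₃ k N) (homogeneous₃-↑₁ k N)) (homogeneous₃-↑₂ k N))
           (homogeneous₃-δ₁ (suc k))) (homogeneous₃-δ₂ k) ⟩
    w * T + α * T + β * T + α ^ suc k + β ^ suc k
      ≈⟨ solve 6 (λ α β w T x y → w :* T :+ α :* T :+ β :* T :+ x :+ y := (α :+ β :+ w) :* T :+ (x :+ y))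
           refl α β w T _ _ ⟩
    (α + β + w) * T + (α ^ suc k + β ^ suc k) ∎
    where
    H = homogeneous₃ (suc k)
    T = homogeneous₃ k N

  F≈homogeneous₃ : ∀ k → F α β (α + β + w) (suc k) ≈ homogeneous₃ k N
  F≈homogeneous₃ zero          = sym (trans (homogeneous₃-0 N) (+-identityʳ 1#))
  -- Degree `k` belongs to `F` at `k + 1`, so `F` at 0 has no homogeneous counterpart. In degree one
  -- the `α β` terms are shown to vanish on both sides instead.
  F≈homogeneous₃ (suc zero)    = begin
    s * 1# - α * β * 0# + (α ^ 1 + β ^ 1)
      ≈⟨ solve 5 (λ s a b x y → s :* :1 :- a :* b :* con (0 , 0) :+ (x :+ y) := s :* :1 :+ (x :+ y)) refl s α β _ _ ⟩
    s * 1# + (α ^ 1 + β ^ 1)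
      ≈⟨ +-congʳ (*-congˡ (F≈homogeneous₃ 0)) ⟩
    s * homogeneous₃ 0 N + (α ^ 1 + β ^ 1)
      ≈⟨ homogeneous₃-N-suc 0 ⟨
    homogeneous₃ 1 N + homogeneous₃ 1 (↑₁ (↑₂ N))
      ≈⟨ +-congˡ (trans (homogeneous₃-↑₁ 0 (↑₂ N)) (trans (*-congˡ (homogeneous₃-0 (↑₂ N))) (zeroʳ α))) ⟩
    homogeneous₃ 1 N + 0#
      ≈⟨ +-identityʳ _ ⟩
    homogeneous₃ 1 N ∎
    where s = α + β + w
  F≈homogeneous₃ (suc (suc k)) = begin
    s * F α β s (2 ℕ.+ k) - α * β * F α β s (suc k) + powers
      ≈⟨ +-congʳ (+-cong (*-congˡ (F≈homogeneous₃ (suc k))) (-‿cong (*-congˡ (F≈homogeneous₃ k)))) ⟩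
    s * homogeneous₃ (suc k) N - α * β * homogeneous₃ k N + powers
      ≈⟨ solve 5 (λ x a b y z → x :- a :* b :* y :+ z := (x :+ z) :- a :* (b :* y)) refl _ α β _ _ ⟩
    (s * homogeneous₃ (suc k) N + powers) - α * (β * homogeneous₃ k N)
      ≈⟨ +-cong (sym (homogeneous₃-N-suc (suc k)))
           (-‿cong (sym (trans (homogeneous₃-↑₁ (suc k) (↑₂ N)) (*-congˡ (homogeneous₃-↑₂ k N))))) ⟩
    (homogeneous₃ (2 ℕ.+ k) N + homogeneous₃ (2 ℕ.+ k) (↑₁ (↑₂ N))) - homogeneous₃ (2 ℕ.+ k) (↑₁ (↑₂ N))
      ≈⟨ solve 2 (λ x y → x :+ y :- y := x) refl _ _ ⟩
    homogeneous₃ (2 ℕ.+ k) N ∎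
    where
    s = α + β + w
    powers = α ^ (2 ℕ.+ k) + β ^ (2 ℕ.+ k)

-- The explicit form of `Uₙ`.

module Explicit {c ℓ} (R : RawRing c ℓ) where
  open RawRing R
  open RawSemiringOps rawSemiring using (_^_; sum) renaming (_×_ to _·_)

  -- U over an arbitrary ring, opaque because comparing its unfoldings is slow.
  opaque
    -- inv e plays the role of 1/(e + 1).
    explicit : (inv : ℕ → Carrier) (α β τ v : Carrier) → ℕ → Carrier
    explicit inv α β τ v n = sum {n} λ i → sum {n ∸ toℕ i} λ j →
      let a = toℕ i
          b = toℕ j
          e = n ∸ a ∸ b ∸ 1
      in inv e * (((n ∸ a ∸ 1) C b) ℕ.* ((n ∸ b ∸ 1) C a)) · 1#
         * τ ^ e * α ^ a * β ^ b * v ^ e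

module ExplicitForm {c ℓ} (R : CommutativeRing c ℓ) where
  open CommutativeRing R
  open Solver R
  open Exp commutativeSemiring using (_^_; ^-distrib-*)
  open SemiringMult semiring using (×1-homo-*) renaming (_×_ to _·_)
  open SumProperties semiring using (sum; sum-cong-≋; *-distribˡ-sum)
  open Recurrence R using (F)
  open Coefficients
  open SetoidReasoning setoid

  open Explicit rawRing using (explicit)

  module _ (inv : ℕ → Carrier) (inverse : ∀ e → inv e * suc e · 1# ≈ 1#) (α β τ v : Carrier) where
    open HomogeneousSums R α β (τ * v)

    private
      term : ℕ → ℕ → ℕ → Carrier
      term n a b = let e = n ∸ a ∸ b ∸ 1 in
        inv e * (((n ∸ a ∸ 1) C b) ℕ.* ((n ∸ b ∸ 1) C a)) · 1# * τ ^ e * α ^ a * β ^ b * v ^ e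

      -- n / (e + 1) · C(b + e, b) C(a + e, a) = N a b e  for n = a + b + e + 1
      scalars : ∀ a b e → suc (a ℕ.+ b ℕ.+ e) · 1# * (inv e * (h b e ℕ.* h a e) · 1#) ≈ N a b e · 1#
      scalars a b e = begin
        n * (inv e * x)             ≈⟨ solve 3 (λ n i x → n :* (i :* x) := i :* (n :* x)) refl n (inv e) x ⟩
        inv e * (n * x)             ≈⟨ *-congˡ (×1-homo-* (suc (a ℕ.+ b ℕ.+ e)) (h b e ℕ.* h a e)) ⟨
        inv e * (suc (a ℕ.+ b ℕ.+ e) ℕ.* (h b e ℕ.* h a e)) · 1#
                                    ≈⟨ *-congˡ (reflexive (≡.cong (_· 1#) (N-closed a b e))) ⟨
        inv e * (suc e ℕ.* N a b e) · 1#
                                    ≈⟨ *-congˡ (×1-homo-* (suc e) (N a b e)) ⟩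
        inv e * (suc e · 1# * y)    ≈⟨ *-assoc _ _ _ ⟨
        inv e * suc e · 1# * y      ≈⟨ *-congʳ (inverse e) ⟩
        1# * y                      ≈⟨ *-identityˡ _ ⟩
        y                           ∎
        where
        n = suc (a ℕ.+ b ℕ.+ e) · 1#
        x = (h b e ℕ.* h a e) · 1#
        y = N a b e · 1#

      term≈ : ∀ a b e → let n = suc (a ℕ.+ b ℕ.+ e) in
        n · 1# * term n a b ≈ α ^ a * (N a b e · 1# * (β ^ b * (τ * v) ^ e))
      term≈ a b e
        -- For `n = a + b + e + 1` the rewrites turn the truncated differences into `b + e`, `e` and
        -- `a + e`, after which the binomials become values of `h`.
        rewrite ≡.trans (≡.cong (λ x → suc x ∸ a) (ℕ.+-assoc a b e))
                 (≡.trans (≡.cong (_∸ a) (≡.sym (ℕ.+-suc a (b ℕ.+ e)))) (ℕ.m+n∸m≡n a (suc (b ℕ.+ e))))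
              | ≡.trans (≡.cong (_∸ b) (≡.sym (ℕ.+-suc b e))) (ℕ.m+n∸m≡n b (suc e))
              | ≡.trans (≡.cong (λ x → suc (x ℕ.+ e) ∸ b) (ℕ.+-comm a b))
                 (≡.trans (≡.cong (λ x → suc x ∸ b) (ℕ.+-assoc b a e))
                 (≡.trans (≡.cong (_∸ b) (≡.sym (ℕ.+-suc b (a ℕ.+ e)))) (ℕ.m+n∸m≡n b (suc (a ℕ.+ e)))))
              | ≡.sym (h≡C a e) | ≡.sym (h≡C b e) = begin
        n * (inv e * x * τ ^ e * α ^ a * β ^ b * v ^ e)
          ≈⟨ solve 7 (λ n i x t a b v → n :* (i :* x :* t :* a :* b :* v) := (n :* (i :* x)) :* (a :* (b :* (t :* v))))
               refl n (inv e) x (τ ^ e) (α ^ a) (β ^ b) (v ^ e) ⟩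
        (n * (inv e * x)) * (α ^ a * (β ^ b * (τ ^ e * v ^ e)))
          ≈⟨ *-cong (scalars a b e) (*-congˡ (*-congˡ (sym (^-distrib-* τ v e)))) ⟩
        N a b e · 1# * (α ^ a * (β ^ b * (τ * v) ^ e))
          ≈⟨ solve 4 (λ m a b w → m :* (a :* (b :* w)) := a :* (m :* (b :* w))) refl _ (α ^ a) (β ^ b) _ ⟩
        α ^ a * (N a b e · 1# * (β ^ b * (τ * v) ^ e)) ∎
        where
        n = suc (a ℕ.+ b ℕ.+ e) · 1#
        x = (h b e ℕ.* h a e) · 1#

      sum-resize : ∀ {p q} (f : ℕ → Carrier) → p ≡ q → sum {p} (λ i → f (toℕ i)) ≈ sum {q} (λ i → f (toℕ i))
      sum-resize f ≡.refl = refl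

      sum-cong-≤ : ∀ k {f g : ℕ → Carrier} → (∀ j → j ≤ k → f j ≈ g j) →
                   sum {suc k} (λ i → f (toℕ i)) ≈ sum {suc k} (λ i → g (toℕ i))
      sum-cong-≤ k eq = sum-cong-≋ {suc k} λ i → eq (toℕ i) (Fin.toℕ≤pred[n] i)

    opaque
      unfolding explicit homogeneous₂ homogeneous₃

      explicit≈homogeneous₃ : ∀ m → suc m · 1# * explicit inv α β τ v (suc m) ≈ homogeneous₃ m N
      explicit≈homogeneous₃ m = begin
        suc m · 1# * explicit inv α β τ v (suc m)
          ≈⟨ *-distribˡ-sum {suc m} (suc m · 1#) (λ i → row (toℕ i)) ⟩
        sum {suc m} (λ i → suc m · 1# * row (toℕ i))
          ≈⟨ sum-cong-≤ m row≈ ⟩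
        homogeneous₃ m N ∎
        where
        row : ℕ → Carrier
        row a = sum {suc m ∸ a} λ j → term (suc m) a (toℕ j)

        term≈′ : ∀ a → a ≤ m → ∀ b → b ≤ m ∸ a →
          suc m · 1# * term (suc m) a b ≈ α ^ a * (N a b (m ∸ a ∸ b) · 1# * (β ^ b * (τ * v) ^ (m ∸ a ∸ b)))
        term≈′ a a≤m b b≤m∸a = ≡.subst
          (λ k → suc k · 1# * term (suc k) a b ≈ α ^ a * (N a b (m ∸ a ∸ b) · 1# * (β ^ b * (τ * v) ^ (m ∸ a ∸ b))))
          (≡.trans (ℕ.+-assoc a b (m ∸ a ∸ b)) (≡.trans (≡.cong (a ℕ.+_) (ℕ.m+[n∸m]≡n b≤m∸a)) (ℕ.m+[n∸m]≡n a≤m)))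
          (term≈ a b (m ∸ a ∸ b))

        row≈ : ∀ a → a ≤ m → suc m · 1# * row a ≈ α ^ a * homogeneous₂ (m ∸ a) (N a)
        row≈ a a≤m = begin
          suc m · 1# * row a
            ≈⟨ *-congˡ (sum-resize (term (suc m) a) (ℕ.+-∸-assoc 1 a≤m)) ⟩
          suc m · 1# * sum {suc (m ∸ a)} (λ j → term (suc m) a (toℕ j))
            ≈⟨ *-distribˡ-sum {suc (m ∸ a)} (suc m · 1#) (λ j → term (suc m) a (toℕ j)) ⟩
          sum {suc (m ∸ a)} (λ j → suc m · 1# * term (suc m) a (toℕ j))
            ≈⟨ sum-cong-≤ (m ∸ a) {λ b → suc m · 1# * term (suc m) a b} (term≈′ a a≤m) ⟩
          sum {suc (m ∸ a)} (λ j → α ^ a * entry (toℕ j))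
            ≈⟨ *-distribˡ-sum {suc (m ∸ a)} (α ^ a) (λ j → entry (toℕ j)) ⟨
          α ^ a * homogeneous₂ (m ∸ a) (N a) ∎
          where
          entry : ℕ → Carrier
          entry b = N a b (m ∸ a ∸ b) · 1# * (β ^ b * (τ * v) ^ (m ∸ a ∸ b))

    explicit≈F : ∀ m → suc m · 1# * explicit inv α β τ v (suc m) ≈ F α β (α + β + τ * v) (suc m)
    explicit≈F m = trans (explicit≈homogeneous₃ m) (sym (F≈homogeneous₃ m))

-- Sums over multi-indices, organised by the first entry.

excess ones : List ℕ → ℕ
excess []       = 0
excess (k ∷ ks) = (k ∸ 2) ℕ.+ excess ks
ones []           = 0
ones (1     ∷ ks) = suc (ones ks)
ones (_     ∷ ks) = ones ks

-- Decides excess ks ≡ a, ones ks ≡ b and height ks ≡ c while peeling off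
-- the first entry.
match : List ℕ → ℕ → ℕ → ℕ → Bool
match []                 zero zero    zero    = true
match []                 _    _       _       = false
match (0 ∷ ks)           _    _       _       = false
match (1 ∷ ks)           _    zero    _       = false
match (1 ∷ ks)           a    (suc b) c       = match ks a b c
match (suc (suc i) ∷ ks) _    _       zero    = false
match (suc (suc i) ∷ ks) a    b       (suc c) = (i ≤ᵇ a) ∧ match ks (a ∸ i) b c

-- With `weight≡`, this identifies `excess`, `ones` and `height` as the exponents of `u₁`, `u₂` and
-- `u₃`: depth minus height counts the ones, and weight minus depth minus height is the excess.
length≡ : ∀ {ks} → All (0 <_) ks → length ks ≡ ones ks ℕ.+ height ks
length≡ []                             = ≡.refl
length≡ {1 ∷ _} (_ ∷ ps)               = ≡.cong suc (length≡ ps)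
length≡ {suc (suc i) ∷ ks} (_ ∷ ps)    = ≡.trans (≡.cong suc (length≡ ps)) (≡.sym (ℕ.+-suc (ones ks) (height ks)))

weight≡ : ∀ {ks} → All (0 <_) ks → weight ks ≡ excess ks ℕ.+ (ones ks ℕ.+ height ks) ℕ.+ height ks
weight≡ []                             = ≡.refl
weight≡ {1 ∷ ks} (_ ∷ ps)              = ≡.trans (≡.cong suc (weight≡ ps))
  (solve 3 (λ x y z → con 1 :+ (x :+ (y :+ z) :+ z) := x :+ (con 1 :+ (y :+ z)) :+ z)
    ≡.refl (excess ks) (ones ks) (height ks))
  where open ℕSolver.+-*-Solver
weight≡ {suc (suc i) ∷ ks} (_ ∷ ps)    = ≡.trans (≡.cong (suc (suc i) ℕ.+_) (weight≡ ps))
  (solve 4 (λ i x y z → (con 2 :+ i) :+ (x :+ (y :+ z) :+ z) := (i :+ x) :+ (y :+ (con 1 :+ z)) :+ (con 1 :+ z))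
    ≡.refl i (excess ks) (ones ks) (height ks))
  where open ℕSolver.+-*-Solver

match-sound : ∀ ks a b c → match ks a b c ≡ true → a ≡ excess ks × b ≡ ones ks × c ≡ height ks
match-sound []                 zero zero    zero    eq = ≡.refl , ≡.refl , ≡.refl
match-sound (1 ∷ ks)           a    (suc b) c       eq with match-sound ks a b c eq
... | p , q , r = p , ≡.cong suc q , r
match-sound (suc (suc i) ∷ ks) a    b       (suc c) eq with i ≤ᵇ a in i≤a
... | true with match-sound ks (a ∸ i) b c eq
...   | p , q , r = ≡.trans (≡.sym (ℕ.m+[n∸m]≡n (ℕ.≤ᵇ⇒≤ i a (≡.subst Bool.T (≡.sym i≤a) tt)))) (≡.cong (i ℕ.+_) p)
                  , q , ≡.cong suc r

match-complete : ∀ {ks} → All (0 <_) ks → match ks (excess ks) (ones ks) (height ks) ≡ true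
match-complete []                          = ≡.refl
match-complete {1 ∷ _} (_ ∷ ps)            = match-complete ps
match-complete {suc (suc i) ∷ ks} (_ ∷ ps)
  rewrite ℕ.m+n∸m≡n i (excess ks)
        | Equivalence.to Bool.T-≡ (ℕ.≤⇒≤ᵇ (ℕ.m≤m+n i (excess ks))) = match-complete ps

does-≡ : ∀ {p} {P : Set p} (P? : Dec P) {b} → (P → b ≡ true) → (b ≡ true → P) → does P? ≡ b
does-≡ (yes p) to from = ≡.sym (to p)
does-≡ (no ¬p) {true}  to from = contradiction (from ≡.refl) ¬p
does-≡ (no ¬p) {false} to from = ≡.refl

-- Once the depth is fixed, weight and height determine the three exponents, so the filter defining
-- `G` may be replaced by a test that recurses on the list.
match-correct : ∀ a b c {ks} → All (0 <_) ks → length ks ≡ b ℕ.+ c →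
  does ((weight ks ℕ.≟ a ℕ.+ (b ℕ.+ c) ℕ.+ c) ×-dec (height ks ℕ.≟ c)) ≡ match ks a b c
match-correct a b c {ks} ps len = does-≡ ((weight ks ℕ.≟ a ℕ.+ (b ℕ.+ c) ℕ.+ c) ×-dec (height ks ℕ.≟ c)) to from
  where
  to : weight ks ≡ a ℕ.+ (b ℕ.+ c) ℕ.+ c × height ks ≡ c → match ks a b c ≡ true
  to (w , ≡.refl) with ℕ.+-cancelʳ-≡ (height ks) b (ones ks) (≡.trans (≡.sym len) (length≡ ps))
  ... | ≡.refl with ℕ.+-cancelʳ-≡ (b ℕ.+ height ks) a (excess ks)
                      (ℕ.+-cancelʳ-≡ (height ks) _ _ (≡.trans (≡.sym w) (weight≡ ps)))
  ...   | ≡.refl = match-complete ps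

  from : match ks a b c ≡ true → weight ks ≡ a ℕ.+ (b ℕ.+ c) ℕ.+ c × height ks ≡ c
  from eq with match-sound ks a b c eq
  ... | ≡.refl , ≡.refl , ≡.refl = weight≡ ps , ≡.refl

module MultiIndexSums {c ℓ} (A : CommutativeRing c ℓ) where
  open CommutativeRing A
  open SumProperties semiring using (sum; sum-cong-≋)
  open SetoidReasoning setoid

  sumOver : ∀ {x} {X : Set x} → (X → Carrier) → List X → Carrier
  sumOver φ = foldr (λ x acc → φ x + acc) 0#

  sumOver-++ : ∀ {x} {X : Set x} (φ : X → Carrier) xs ys → sumOver φ (xs ++ ys) ≈ sumOver φ xs + sumOver φ ys
  sumOver-++ φ []       ys = sym (+-identityˡ _)
  sumOver-++ φ (x ∷ xs) ys = trans (+-congˡ (sumOver-++ φ xs ys)) (sym (+-assoc _ _ _))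

  sumOver-map : ∀ {x y} {X : Set x} {Y : Set y} (φ : Y → Carrier) (g : X → Y) xs → sumOver φ (map g xs) ≈ sumOver (φ ∘ g) xs
  sumOver-map φ g []       = refl
  sumOver-map φ g (x ∷ xs) = +-congˡ (sumOver-map φ g xs)

  sumOver-cong : ∀ {x} {X : Set x} {φ ψ : X → Carrier} xs → (∀ x → φ x ≈ ψ x) → sumOver φ xs ≈ sumOver ψ xs
  sumOver-cong []       eq = refl
  sumOver-cong (x ∷ xs) eq = +-cong (eq x) (sumOver-cong xs eq)

  sumOver-concatMap : ∀ {x y} {X : Set x} {Y : Set y} (φ : Y → Carrier) (f : X → List Y) xs →
    sumOver φ (concatMap f xs) ≈ sumOver (sumOver φ ∘ f) xs
  sumOver-concatMap φ f []       = refl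
  sumOver-concatMap φ f (x ∷ xs) = trans (sumOver-++ φ (f x) (concatMap f xs)) (+-congˡ (sumOver-concatMap φ f xs))

  sumOver-filter : ∀ {x p} {X : Set x} {P : X → Set p} (P? : Decidable P) (φ : X → Carrier) xs →
    sumOver φ (filter P? xs) ≈ sumOver (λ x → if does (P? x) then φ x else 0#) xs
  sumOver-filter P? φ []       = refl
  sumOver-filter P? φ (x ∷ xs) with does (P? x)
  ... | true  = +-congˡ (sumOver-filter P? φ xs)
  ... | false = trans (sumOver-filter P? φ xs) (sym (+-identityˡ _))

  sumOver-applyUpTo : ∀ {x} {X : Set x} (φ : X → Carrier) f n → sumOver φ (applyUpTo f n) ≈ sum {n} (λ i → φ (f (toℕ i)))
  sumOver-applyUpTo φ f zero    = refl
  sumOver-applyUpTo φ f (suc n) = +-congˡ (sumOver-applyUpTo φ (f ∘ suc) n)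

  sum-zero : ∀ n {f : Fin n → Carrier} → (∀ i → f i ≈ 0#) → sum f ≈ 0#
  sum-zero zero    eq = refl
  sum-zero (suc n) eq = trans (+-cong (eq Fin.zero) (sum-zero n (eq ∘ Fin.suc))) (+-identityˡ _)

  sum-truncate : ∀ {n a} (f : ℕ → Carrier) → suc a ≤ n →
    sum {n} (λ i → if toℕ i ≤ᵇ a then f (toℕ i) else 0#) ≈ sum {suc a} (λ i → f (toℕ i))
  sum-truncate {suc n} {zero}  f _         = +-congˡ (sum-zero n λ _ → refl)
  sum-truncate {suc n} {suc a} f (s≤s a<n) = +-congˡ (trans
    (sum-cong-≋ {n} λ i → if-suc (toℕ i)) (sum-truncate (f ∘ suc) a<n))
    where
    if-suc : ∀ i → (if suc i ≤ᵇ suc a then f (suc i) else 0#) ≈ (if i ≤ᵇ a then f (suc i) else 0#)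
    if-suc zero    = refl
    if-suc (suc i) = refl

  previous : ℕ → (ℕ → Carrier) → Carrier
  previous zero    f = 0#
  previous (suc b) f = f b

  -- The sum of φ over the multi-indices with b entries 1 and c entries
  -- kᵢ ≥ 2, where Σ (kᵢ - 2) = a over the latter; l is the depth, so the
  -- sum is empty unless l = b + c.
  T∑ : ℕ → ℕ → ℕ → ℕ → (List ℕ → Carrier) → Carrier
  T∑ zero    zero zero zero φ = φ []
  T∑ zero    _    _    _    φ = 0#
  T∑ (suc l) a    b    c    φ =
      previous b (λ b′ → T∑ l a b′ c (λ ks → φ (1 ∷ ks)))
    + previous c (λ c′ → sum {suc a} λ i → T∑ l (a ∸ toℕ i) b c′ (λ ks → φ (suc (suc (toℕ i)) ∷ ks)))

  private
    entries : ℕ → List ℕ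
    entries n = map suc (upTo n)

    tupleSum : ℕ → ℕ → (List ℕ → Carrier) → Carrier
    tupleSum n l φ = sumOver φ (tuples (entries n) l)

    tupleSum-suc : ∀ n l φ → tupleSum n (suc l) φ ≈ sum {n} (λ i → tupleSum n l (λ ks → φ (suc (toℕ i) ∷ ks)))
    tupleSum-suc n l φ = begin
      sumOver φ (concatMap prefix (entries n))
        ≈⟨ sumOver-concatMap φ prefix (entries n) ⟩
      sumOver (sumOver φ ∘ prefix) (entries n)
        ≈⟨ sumOver-cong (entries n) (λ x → sumOver-map φ (x ∷_) (tuples (entries n) l)) ⟩
      sumOver (λ x → tupleSum n l (λ ks → φ (x ∷ ks))) (entries n)
        ≈⟨ sumOver-map _ suc (upTo n) ⟩
      sumOver (λ i → tupleSum n l (λ ks → φ (suc i ∷ ks))) (upTo n)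
        ≈⟨ sumOver-applyUpTo (λ i → tupleSum n l (λ ks → φ (suc i ∷ ks))) id n ⟩
      sum {n} (λ i → tupleSum n l (λ ks → φ (suc (toℕ i) ∷ ks))) ∎
      where
      prefix : ℕ → List (List ℕ)
      prefix x = map (x ∷_) (tuples (entries n) l)

    tupleSum-cong : ∀ n l {φ ψ} → (∀ ks → All (0 <_) ks → length ks ≡ l → φ ks ≈ ψ ks) →
                    tupleSum n l φ ≈ tupleSum n l ψ
    tupleSum-cong n zero    eq = +-congʳ (eq [] [] ≡.refl)
    tupleSum-cong n (suc l) {φ} {ψ} eq = trans (tupleSum-suc n l φ) (trans
      (sum-cong-≋ {n} λ i → tupleSum-cong n l {λ ks → φ (suc (toℕ i) ∷ ks)} {λ ks → ψ (suc (toℕ i) ∷ ks)}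
        λ ks ps len → eq (suc (toℕ i) ∷ ks) (s≤s z≤n ∷ ps) (≡.cong suc len))
      (sym (tupleSum-suc n l ψ)))

    tupleSum-zero : ∀ n l → tupleSum n l (λ _ → 0#) ≈ 0#
    tupleSum-zero n l = zeros (tuples (entries n) l)
      where
      zeros : ∀ {x} {X : Set x} (xs : List X) → sumOver (λ _ → 0#) xs ≈ 0#
      zeros []       = refl
      zeros (x ∷ xs) = trans (+-identityˡ _) (zeros xs)

    matching : ℕ → ℕ → ℕ → (List ℕ → Carrier) → List ℕ → Carrier
    matching a b c φ ks = if match ks a b c then φ ks else 0#

    -- The bound `n` on the entries stays fixed along the recursion while the remaining weight does
    -- not grow, so no admissible entry is cut off.
    tupleSum-matching : ∀ n l a b c φ → a ℕ.+ (b ℕ.+ c) ℕ.+ c ≤ n →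
                        tupleSum n l (matching a b c φ) ≈ T∑ l a b c φ
    tupleSum-matching n zero zero    zero    zero    φ _ = +-identityʳ _
    tupleSum-matching n zero zero    zero    (suc c) φ _ = +-identityʳ _
    tupleSum-matching n zero zero    (suc b) c       φ _ = +-identityʳ _
    tupleSum-matching n zero (suc a) b       c       φ _ = +-identityʳ _
    tupleSum-matching n (suc l) a b c φ bound = trans (tupleSum-suc n l (matching a b c φ)) (split n bound)
      where
      body : ℕ → Carrier
      body i = tupleSum n l (λ ks → matching a b c φ (suc i ∷ ks))

      bound-1 : ∀ b′ → b ≡ suc b′ → a ℕ.+ (b′ ℕ.+ c) ℕ.+ c ≤ n
      bound-1 b′ ≡.refl = ℕ.≤-trans (ℕ.+-monoˡ-≤ c (ℕ.+-monoʳ-≤ a (ℕ.n≤1+n (b′ ℕ.+ c)))) bound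

      bound-2 : ∀ i c′ → c ≡ suc c′ → a ∸ i ℕ.+ (b ℕ.+ c′) ℕ.+ c′ ≤ n
      bound-2 i c′ ≡.refl = ℕ.≤-trans
        (ℕ.+-mono-≤ (ℕ.+-mono-≤ (ℕ.m∸n≤m a i) (ℕ.+-monoʳ-≤ b (ℕ.n≤1+n c′))) (ℕ.n≤1+n c′)) bound

      -- An entry of at least 2 is still to come, so the weight is at least `a + 2`; this leaves
      -- room for all of the entries `2, …, a + 2`.
      a<m : ∀ c′ m → c ≡ suc c′ → a ℕ.+ (b ℕ.+ c) ℕ.+ c ≤ suc m → suc a ≤ m
      a<m c′ m ≡.refl k≤m = ℕ.≤-trans
        (ℕ.≤-trans (ℕ.≤-reflexive (ℕ.+-comm 1 a))
          (ℕ.≤-trans (ℕ.+-monoʳ-≤ a (ℕ.≤-trans (s≤s z≤n) (ℕ.m≤n+m (suc c′) b))) (ℕ.m≤m+n _ c′)))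
        (ℕ.≤-pred (ℕ.≤-trans (ℕ.≤-reflexive (≡.sym (ℕ.+-suc _ c′))) k≤m))

      first : ∀ b′ → b ≡ b′ → tupleSum n l (λ ks → matching a b′ c φ (1 ∷ ks))
                            ≈ previous b′ (λ b′ → T∑ l a b′ c (λ ks → φ (1 ∷ ks)))
      first zero     eq = tupleSum-zero n l
      first (suc b′) eq = tupleSum-matching n l a b′ c (λ ks → φ (1 ∷ ks)) (bound-1 b′ eq)

      rest : ∀ c′ m → c ≡ c′ → a ℕ.+ (b ℕ.+ c) ℕ.+ c ≤ suc m →
        sum {m} (λ i → tupleSum n l (λ ks → matching a b c′ φ (suc (suc (toℕ i)) ∷ ks)))
        ≈ previous c′ (λ c′ → sum {suc a} λ i → T∑ l (a ∸ toℕ i) b c′ (λ ks → φ (suc (suc (toℕ i)) ∷ ks)))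
      rest zero     m eq k≤m = sum-zero m λ _ → tupleSum-zero n l
      rest (suc c′) m eq k≤m = trans (sum-cong-≋ {m} λ i → entry (toℕ i)) (sum-truncate T′ (a<m c′ m eq k≤m))
        where
        T′ : ℕ → Carrier
        T′ i = T∑ l (a ∸ i) b c′ (λ ks → φ (suc (suc i) ∷ ks))

        entry : ∀ i → tupleSum n l (λ ks → matching a b (suc c′) φ (suc (suc i) ∷ ks)) ≈ (if i ≤ᵇ a then T′ i else 0#)
        entry i with i ≤ᵇ a
        ... | true  = tupleSum-matching n l (a ∸ i) b c′ (λ ks → φ (suc (suc i) ∷ ks)) (bound-2 i c′ eq)
        ... | false = tupleSum-zero n l

      -- The number `m` of candidate first entries is separated from the bound `n` on the later
      -- ones, so that it can be split into the entry 1 and the entries from 2 on.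
      split : ∀ m → a ℕ.+ (b ℕ.+ c) ℕ.+ c ≤ m → sum {m} (λ i → body (toℕ i)) ≈ T∑ (suc l) a b c φ
      split zero k≤0 with ℕ.m+n≡0⇒m≡0 b b+c≡0 | ℕ.m+n≡0⇒n≡0 b b+c≡0
        where
        b+c≡0 : b ℕ.+ c ≡ 0
        b+c≡0 = ℕ.m+n≡0⇒n≡0 a (ℕ.m+n≡0⇒m≡0 (a ℕ.+ (b ℕ.+ c)) (ℕ.n≤0⇒n≡0 k≤0))
      ... | ≡.refl | ≡.refl = sym (+-identityˡ 0#)
      split (suc m) k≤m = +-cong (first b ≡.refl) (rest c m ≡.refl k≤m)

  T∑-multiIndices : ∀ a b c φ →
    sumOver φ (multiIndices (a ℕ.+ (b ℕ.+ c) ℕ.+ c) (b ℕ.+ c) c) ≈ T∑ (b ℕ.+ c) a b c φ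
  T∑-multiIndices a b c φ = begin
    sumOver φ (multiIndices k (b ℕ.+ c) c)
      ≈⟨ sumOver-filter (λ ks → (weight ks ℕ.≟ k) ×-dec (height ks ℕ.≟ c)) φ (tuples (entries k) (b ℕ.+ c)) ⟩
    tupleSum k (b ℕ.+ c) (λ ks → if does ((weight ks ℕ.≟ k) ×-dec (height ks ℕ.≟ c)) then φ ks else 0#)
      ≈⟨ tupleSum-cong k (b ℕ.+ c) (λ ks ps len →
           reflexive (≡.cong (if_then φ ks else 0#) (match-correct a b c ps len))) ⟩
    tupleSum k (b ℕ.+ c) (matching a b c φ)
      ≈⟨ tupleSum-matching k (b ℕ.+ c) a b c φ ℕ.≤-refl ⟩
    T∑ (b ℕ.+ c) a b c φ ∎
    where
    k = a ℕ.+ (b ℕ.+ c) ℕ.+ c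

module MultiIndexSumsProperties {c ℓ} (A : CommutativeRing c ℓ) where
  open CommutativeRing A
  open SumProperties semiring using (sum-cong-≋; ∑-distrib-+; *-distribˡ-sum)
  open CommutativeSemigroupProperties +-commutativeSemigroup using (interchange)
  open MultiIndexSums A

  previous-cong : ∀ b {f g} → (∀ i → f i ≈ g i) → previous b f ≈ previous b g
  previous-cong zero    eq = refl
  previous-cong (suc b) eq = eq b

  T∑-cong : ∀ l a b c {φ ψ} → (∀ ks → All (0 <_) ks → φ ks ≈ ψ ks) → T∑ l a b c φ ≈ T∑ l a b c ψ
  T∑-cong zero zero    zero    zero    eq = eq [] []
  T∑-cong zero zero    zero    (suc _) eq = refl
  T∑-cong zero zero    (suc _) _       eq = refl
  T∑-cong zero (suc _) _       _       eq = refl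
  T∑-cong (suc l) a b c {φ} {ψ} eq = +-cong
    (previous-cong b λ b′ → T∑-cong l a b′ c {λ ks → φ (1 ∷ ks)} λ ks ps → eq (1 ∷ ks) (s≤s z≤n ∷ ps))
    (previous-cong c λ c′ → sum-cong-≋ {suc a} λ i →
      T∑-cong l (a ∸ toℕ i) b c′ {λ ks → φ (suc (suc (toℕ i)) ∷ ks)} λ ks ps → eq (suc (suc (toℕ i)) ∷ ks) (s≤s z≤n ∷ ps))

  previous-+ : ∀ b f g → previous b f + previous b g ≈ previous b (λ i → f i + g i)
  previous-+ zero    f g = +-identityˡ 0#
  previous-+ (suc b) f g = refl

  T∑-+ : ∀ l a b c φ ψ → T∑ l a b c (λ ks → φ ks + ψ ks) ≈ T∑ l a b c φ + T∑ l a b c ψ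
  T∑-+ zero zero    zero    zero    φ ψ = refl
  T∑-+ zero zero    zero    (suc _) φ ψ = sym (+-identityˡ 0#)
  T∑-+ zero zero    (suc _) _       φ ψ = sym (+-identityˡ 0#)
  T∑-+ zero (suc _) _       _       φ ψ = sym (+-identityˡ 0#)
  T∑-+ (suc l) a b c φ ψ = trans
    (+-cong
      (trans (previous-cong b λ b′ → T∑-+ l a b′ c (λ ks → φ (1 ∷ ks)) (λ ks → ψ (1 ∷ ks))) (sym (previous-+ b _ _)))
      (trans (previous-cong c λ c′ → trans
        (sum-cong-≋ {suc a} λ i → T∑-+ l (a ∸ toℕ i) b c′
          (λ ks → φ (suc (suc (toℕ i)) ∷ ks)) (λ ks → ψ (suc (suc (toℕ i)) ∷ ks)))
        (∑-distrib-+ {suc a} (λ i → T∑ l (a ∸ toℕ i) b c′ (λ ks → φ (suc (suc (toℕ i)) ∷ ks)))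
                             (λ i → T∑ l (a ∸ toℕ i) b c′ (λ ks → ψ (suc (suc (toℕ i)) ∷ ks)))))
        (sym (previous-+ c _ _))))
    (interchange _ _ _ _)

  *-previous : ∀ s b f → s * previous b f ≈ previous b (λ i → s * f i)
  *-previous s zero    f = zeroʳ s
  *-previous s (suc b) f = refl

  T∑-* : ∀ s l a b c φ → T∑ l a b c (λ ks → s * φ ks) ≈ s * T∑ l a b c φ
  T∑-* s zero zero    zero    zero    φ = refl
  T∑-* s zero zero    zero    (suc _) φ = sym (zeroʳ s)
  T∑-* s zero zero    (suc _) _       φ = sym (zeroʳ s)
  T∑-* s zero (suc _) _       _       φ = sym (zeroʳ s)
  T∑-* s (suc l) a b c φ = trans
    (+-cong
      (trans (previous-cong b λ b′ → T∑-* s l a b′ c (λ ks → φ (1 ∷ ks))) (sym (*-previous s b _)))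
      (trans (previous-cong c λ c′ → trans
        (sum-cong-≋ {suc a} λ i → T∑-* s l (a ∸ toℕ i) b c′ (λ ks → φ (suc (suc (toℕ i)) ∷ ks)))
        (sym (*-distribˡ-sum {suc a} s (λ i → T∑ l (a ∸ toℕ i) b c′ (λ ks → φ (suc (suc (toℕ i)) ∷ ks))))))
        (sym (*-previous s c _))))
    (sym (distribˡ _ _ _))

  multiIndices-T∑ : ∀ {φ ψ} → (∀ ks → φ ks ≈ ψ ks) → ∀ a b c →
    sumOver φ (multiIndices (a ℕ.+ (b ℕ.+ c) ℕ.+ c) (b ℕ.+ c) c) ≈ T∑ (b ℕ.+ c) a b c ψ
  multiIndices-T∑ {φ} eq a b c = trans (T∑-multiIndices a b c φ) (T∑-cong (b ℕ.+ c) a b c λ ks _ → eq ks)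

-- The linear equation for generating functions.

module _ {c ℓ} (R : CommutativeRing c ℓ) where
  open CommutativeRing R
  open Solver R
  open SetoidReasoning setoid

  -- A first entry 1 contributes `x u₂`, and first entries `i + 2` contribute `x yⁱ⁺¹ u₁ⁱ u₃`, which
  -- sum to `x y u₃ / (1 - u₁ y)`. The latter part is `d₂`, given by its fixed-point equation; the
  -- conclusion has the denominator cleared.
  resolvent : ∀ {d d₂ m x xy y u₁ u₂ u₃} → xy ≈ x * y →
    d ≈ x * (u₂ * m) + d₂ → d₂ ≈ u₁ * (y * d₂) + xy * (u₃ * m) →
    (1# - u₁ * y) * d ≈ x * (u₂ * (1# - u₁ * y) + u₃ * y) * m
  resolvent {d} {d₂} {m} {x} {xy} {y} {u₁} {u₂} {u₃} xy≈ d≈ d₂≈ = begin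
    (1# - u₁ * y) * d
      ≈⟨ *-congˡ d≈ ⟩
    (1# - u₁ * y) * (x * (u₂ * m) + d₂)
      ≈⟨ solve 6 (λ d₂ m x y u₁ u₂ → (:1 :- u₁ :* y) :* (x :* (u₂ :* m) :+ d₂)
           := (:1 :- u₁ :* y) :* (x :* (u₂ :* m)) :+ d₂ :- u₁ :* (y :* d₂)) refl d₂ m x y u₁ u₂ ⟩
    (1# - u₁ * y) * (x * (u₂ * m)) + d₂ - u₁ * (y * d₂)
      ≈⟨ +-congʳ (+-congˡ (trans d₂≈ (+-congˡ (*-congʳ xy≈)))) ⟩
    (1# - u₁ * y) * (x * (u₂ * m)) + (u₁ * (y * d₂) + x * y * (u₃ * m)) - u₁ * (y * d₂)
      ≈⟨ solve 7 (λ d₂ m x y u₁ u₂ u₃ →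
           (:1 :- u₁ :* y) :* (x :* (u₂ :* m)) :+ (u₁ :* (y :* d₂) :+ x :* y :* (u₃ :* m)) :- u₁ :* (y :* d₂)
           := x :* (u₂ :* (:1 :- u₁ :* y) :+ u₃ :* y) :* m) refl d₂ m x y u₁ u₂ u₃ ⟩
    x * (u₂ * (1# - u₁ * y) + u₃ * y) * m ∎

module TripleSeries {c ℓ} (A : CommutativeRing c ℓ) where
  module PS₃   = PowerSeriesRing A
  module PS₂₃  = PowerSeriesRing PS₃.commutativeRing
  module PS₁₂₃ = PowerSeriesRing PS₂₃.commutativeRing

  tripleSeries : CommutativeRing c ℓ
  tripleSeries = PS₁₂₃.commutativeRing

  module A = CommutativeRing A
  open CommutativeRing tripleSeries

  constant : A.Carrier → Carrier
  constant p = PS₁₂₃.constant (PS₂₃.constant (PS₃.constant p))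

  u₁ u₂ u₃ : Carrier
  u₁ = PS₁₂₃.X
  u₂ = PS₁₂₃.constant PS₂₃.X
  u₃ = PS₁₂₃.constant (PS₂₃.constant PS₃.X)

  constant-* : ∀ p f a b c → (constant p * f) a b c A.≈ p A.* f a b c
  constant-* p f a b c = A.trans (PS₁₂₃.constant-⊗ (PS₂₃.constant (PS₃.constant p)) f a b c)
    (A.trans (PS₂₃.constant-⊗ (PS₃.constant p) (f a) b c) (PS₃.constant-⊗ p (f a b) c))

  u₁-*-zero : ∀ f b c → (u₁ * f) 0 b c A.≈ A.0#
  u₁-*-zero f = PS₁₂₃.X-⊗-zero f

  u₁-*-suc : ∀ f a b c → (u₁ * f) (suc a) b c A.≈ f a b c
  u₁-*-suc f = PS₁₂₃.X-⊗-suc f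

  u₂-*-zero : ∀ f a c → (u₂ * f) a 0 c A.≈ A.0#
  u₂-*-zero f a c = A.trans (PS₁₂₃.constant-⊗ PS₂₃.X f a 0 c) (PS₂₃.X-⊗-zero (f a) c)

  u₂-*-suc : ∀ f a b c → (u₂ * f) a (suc b) c A.≈ f a b c
  u₂-*-suc f a b c = A.trans (PS₁₂₃.constant-⊗ PS₂₃.X f a (suc b) c) (PS₂₃.X-⊗-suc (f a) b c)

  u₃-*-zero : ∀ f a b → (u₃ * f) a b 0 A.≈ A.0#
  u₃-*-zero f a b = A.trans (PS₁₂₃.constant-⊗ (PS₂₃.constant PS₃.X) f a b 0)
    (A.trans (PS₂₃.constant-⊗ PS₃.X (f a) b 0) (PS₃.X-⊗-zero (f a b)))

  u₃-*-suc : ∀ f a b c → (u₃ * f) a b (suc c) A.≈ f a b c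
  u₃-*-suc f a b c = A.trans (PS₁₂₃.constant-⊗ (PS₂₃.constant PS₃.X) f a b (suc c))
    (A.trans (PS₂₃.constant-⊗ PS₃.X (f a) b (suc c)) (PS₃.X-⊗-suc (f a b) c))

  open MultiIndexSums A using (T∑; previous)
  open MultiIndexSumsProperties A
  open SumProperties A.semiring using (sum; sum-cong-≋; *-distribˡ-sum)
  open Exp A.commutativeSemiring using (_^_)

  generating : (List ℕ → A.Carrier) → Carrier
  generating φ a b c = T∑ (b ℕ.+ c) a b c φ

  module _ (x y : A.Carrier) (D M : List ℕ → A.Carrier) (D[] : D [] A.≈ A.0#)
           (D-∷ : ∀ i ks → All (0 <_) ks → D (suc i ∷ ks) A.≈ x A.* y ^ i A.* M ks) where
    open SetoidReasoning A.setoid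

    private
      -- A first entry `i + 2` takes `i` from the exponent of `u₁` and one from that of `u₃`, and
      -- carries the weight `x yⁱ⁺¹`.
      later : ℕ → ℕ → ℕ → ℕ → A.Carrier
      later l a b c′ = sum {suc a} λ i → x A.* y ^ suc (toℕ i) A.* T∑ l (a ∸ toℕ i) b c′ M

      D₂ : Carrier
      D₂ a b c = previous c (λ c′ → later (b ℕ.+ c′) a b c′)

      T∑-D : ∀ l a b c → T∑ (suc l) a b c D A.≈
        previous b (λ b′ → x A.* T∑ l a b′ c M) A.+ previous c (λ c′ → later l a b c′)
      T∑-D l a b c = A.+-cong
        (previous-cong b λ b′ → A.trans
          (T∑-cong l a b′ c {λ ks → D (1 ∷ ks)} λ ks ps → A.trans (D-∷ 0 ks ps) (A.*-congʳ (A.*-identityʳ x)))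
          (T∑-* x l a b′ c M))
        (previous-cong c λ c′ → sum-cong-≋ {suc a} λ i → A.trans
          (T∑-cong l (a ∸ toℕ i) b c′ {λ ks → D (suc (suc (toℕ i)) ∷ ks)} λ ks ps → D-∷ (suc (toℕ i)) ks ps)
          (T∑-* (x A.* y ^ suc (toℕ i)) l (a ∸ toℕ i) b c′ M))

      D≈ : generating D ≈ constant x * (u₂ * generating M) + D₂
      D≈ a zero zero = A.trans (T∑-0 a) (A.sym (A.trans (A.+-congʳ (D₁-zero a 0)) (A.+-identityˡ _)))
        where
        T∑-0 : ∀ a → T∑ 0 a 0 0 D A.≈ A.0#
        T∑-0 zero    = D[]
        T∑-0 (suc a) = A.refl

        D₁-zero : ∀ a c → (constant x * (u₂ * generating M)) a 0 c A.≈ A.0#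
        D₁-zero a c = A.trans (constant-* x (u₂ * generating M) a 0 c)
          (A.trans (A.*-congˡ (u₂-*-zero (generating M) a c)) (A.zeroʳ x))
      D≈ a zero (suc c) = A.trans (T∑-D c a 0 (suc c)) (A.+-congʳ (A.sym
        (A.trans (constant-* x (u₂ * generating M) a 0 (suc c))
          (A.trans (A.*-congˡ (u₂-*-zero (generating M) a (suc c))) (A.zeroʳ x)))))
      D≈ a (suc b) c = A.trans (T∑-D (b ℕ.+ c) a (suc b) c) (A.+-cong
        (A.sym (A.trans (constant-* x (u₂ * generating M) a (suc b) c)
          (A.*-congˡ (u₂-*-suc (generating M) a b c))))
        (level c))
        where
        -- Removing a one or a larger entry leaves the same depth, but the two are written as
        -- `b + suc c` and `suc b + c`.
        level : ∀ c → previous c (later (b ℕ.+ c) a (suc b)) A.≈ previous c (λ c′ → later (suc b ℕ.+ c′) a (suc b) c′)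
        level zero    = A.refl
        level (suc c) = A.reflexive (≡.cong (λ l → later l a (suc b) c) (ℕ.+-suc b c))

      -- The summand with first entry 2 is the last term. Lowering every other first entry by one
      -- costs a factor `y` and one power of `u₁`, and gives `D₂` again.
      D₂≈ : D₂ ≈ u₁ * (constant y * D₂) + constant (x A.* y) * (u₃ * generating M)
      D₂≈ a b zero = A.sym (A.trans (A.+-cong (first a)
          (A.trans (constant-* (x A.* y) (u₃ * generating M) a b 0)
            (A.trans (A.*-congˡ (u₃-*-zero (generating M) a b)) (A.zeroʳ _)))) (A.+-identityˡ _))
        where
        first : ∀ a → (u₁ * (constant y * D₂)) a b 0 A.≈ A.0#
        first zero    = u₁-*-zero (constant y * D₂) b 0
        first (suc a) = A.trans (u₁-*-suc (constant y * D₂) a b 0)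
          (A.trans (constant-* y D₂ a b 0) (A.zeroʳ y))
      D₂≈ zero b (suc c) = begin
        x A.* (y A.* A.1#) A.* generating M 0 b c A.+ A.0#
          ≈⟨ A.+-comm _ _ ⟩
        A.0# A.+ x A.* (y A.* A.1#) A.* generating M 0 b c
          ≈⟨ A.+-cong (u₁-*-zero (constant y * D₂) b (suc c))
               (A.trans (constant-* (x A.* y) (u₃ * generating M) 0 b (suc c))
                 (A.*-cong (A.*-congˡ (A.sym (A.*-identityʳ y))) (u₃-*-suc (generating M) 0 b c))) ⟨
        (u₁ * (constant y * D₂)) 0 b (suc c) A.+ (constant (x A.* y) * (u₃ * generating M)) 0 b (suc c) ∎
      D₂≈ (suc a) b (suc c) = begin
        x A.* (y A.* A.1#) A.* generating M (suc a) b c A.+ shifted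
          ≈⟨ A.+-comm _ _ ⟩
        shifted A.+ x A.* (y A.* A.1#) A.* generating M (suc a) b c
          ≈⟨ A.+-cong (A.trans (u₁-*-suc (constant y * D₂) a b (suc c))
               (A.trans (constant-* y D₂ a b (suc c)) scale))
               (A.trans (constant-* (x A.* y) (u₃ * generating M) (suc a) b (suc c))
                 (A.*-cong (A.*-congˡ (A.sym (A.*-identityʳ y))) (u₃-*-suc (generating M) (suc a) b c))) ⟨
        (u₁ * (constant y * D₂)) (suc a) b (suc c) A.+ (constant (x A.* y) * (u₃ * generating M)) (suc a) b (suc c) ∎
        where
        open Solver A
        shifted : A.Carrier
        shifted = sum {suc a} λ i → x A.* y ^ suc (suc (toℕ i)) A.* T∑ (b ℕ.+ c) (a ∸ toℕ i) b c M

        scale : y A.* D₂ a b (suc c) A.≈ shifted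
        scale = A.trans (*-distribˡ-sum {suc a} y (λ i → x A.* y ^ suc (toℕ i) A.* T∑ (b ℕ.+ c) (a ∸ toℕ i) b c M))
          (sum-cong-≋ {suc a} λ i → solve 4 (λ x y z m → y :* (x :* z :* m) := x :* (y :* z) :* m) A.refl
            x y (y ^ suc (toℕ i)) (T∑ (b ℕ.+ c) (a ∸ toℕ i) b c M))

    generating-resolvent : constant (x A.* y) ≈ constant x * constant y →
      (1# - u₁ * constant y) * generating D
      ≈ constant x * (u₂ * (1# - u₁ * constant y) + u₃ * constant y) * generating M
    generating-resolvent constant-homo = resolvent tripleSeries
      {generating D} {D₂} {generating M} {constant x} {constant (x A.* y)} {constant y} {u₁} {u₂} {u₃}
      constant-homo D≈ D₂≈

-- Interpolated nested sums and their increments.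

length-fillings : ∀ k ks → All (λ p → length p ≤ suc (length ks)) (fillings k ks)
length-fillings k []        = ℕ.≤-refl ∷ []
length-fillings k (k′ ∷ ks) = All.++⁺ (All.map⁺ (All.map s≤s (length-fillings k′ ks)))
  (All.++⁺ (All.map ℕ.m≤n⇒m≤1+n (length-fillings (k ℕ.+ k′) ks))
           (All.map ℕ.m≤n⇒m≤1+n (length-fillings (k ∸ 1 ℕ.+ k′) ks)))

module NestedSums {c ℓ} (K : CommutativeRing c ℓ) (w : ℕ → ℕ → CommutativeRing.Carrier K) where
  open CommutativeRing K
  open SumProperties semiring using (sum)

  -- The outermost index runs up to `n` inclusive, so `Z n` corresponds to `z̄ (suc n)`, and passing
  -- from `n` to `n + 1` adds a single term. The weights form a total function, free of apartness
  -- proofs.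
  Z : ℕ → List ℕ → Carrier
  Z n []       = 1#
  Z n (k ∷ ks) = sum {n} λ i → w (suc (toℕ i)) k * Z (toℕ i) ks

  sum-last : ∀ n (f : ℕ → Carrier) → sum {suc n} (λ i → f (toℕ i)) ≈ sum {n} (λ i → f (toℕ i)) + f n
  sum-last zero    f = +-comm _ _
  sum-last (suc n) f = trans (+-congˡ (sum-last n (λ i → f (suc i)))) (sym (+-assoc _ _ _))

  Z-suc : ∀ n k ks → Z (suc n) (k ∷ ks) ≈ Z n (k ∷ ks) + w (suc n) k * Z n ks
  Z-suc n k ks = sum-last n (λ i → w (suc i) k * Z i ks)

module Interpolated {a b ℓ₁ ℓ₂} (K : CommutativeRing a ℓ₁) (A : CommutativeRing b ℓ₂)
    {ι : CommutativeRing.Carrier K → CommutativeRing.Carrier A}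
    (ι-hom : IsRingHomomorphism (CommutativeRing.rawRing K) (CommutativeRing.rawRing A) ι)
    (t : CommutativeRing.Carrier A)
    (w : ℕ → ℕ → CommutativeRing.Carrier K) where
  private
    module K = CommutativeRing K
  open CommutativeRing A
  open IsRingHomomorphism ι-hom
  open NestedSums K w
  open MultiIndexSums A
  open Exp commutativeSemiring using (_^_)
  open CommutativeSemigroupProperties +-commutativeSemigroup using (interchange)
  open Solver A
  open SetoidReasoning setoid

  sumOver-congᴬ : ∀ {x} {X : Set x} {φ ψ : X → Carrier} {xs} → All (λ x → φ x ≈ ψ x) xs → sumOver φ xs ≈ sumOver ψ xs
  sumOver-congᴬ []       = refl
  sumOver-congᴬ (e ∷ es) = +-cong e (sumOver-congᴬ es)

  sumOver-+ : ∀ {x} {X : Set x} (φ ψ : X → Carrier) xs → sumOver (λ x → φ x + ψ x) xs ≈ sumOver φ xs + sumOver ψ xs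
  sumOver-+ φ ψ []       = sym (+-identityˡ 0#)
  sumOver-+ φ ψ (x ∷ xs) = trans (+-congˡ (sumOver-+ φ ψ xs)) (interchange _ _ _ _)

  sumOver-* : ∀ {x} {X : Set x} s (φ : X → Carrier) xs → sumOver (λ x → s * φ x) xs ≈ s * sumOver φ xs
  sumOver-* s φ []       = sym (zeroʳ s)
  sumOver-* s φ (x ∷ xs) = trans (+-congˡ (sumOver-* s φ xs)) (sym (distribˡ _ _ _))

  E : ℕ → List ℕ → Carrier
  E n []       = 1#
  E n (k ∷ ks) = sumOver (λ p → ι (Z n p) * t ^ (suc (length ks) ∸ length p)) (fillings k ks)

  module _ (n : ℕ) where
    private
      wₙ : ℕ → Carrier
      wₙ k = ι (w (suc n) k)

      -- The increment due to one filling when the outermost index may be `n + 1`. It is 0 for the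
      -- empty list, on which `Z` does not depend on `n`.
      ψ : ℕ → List ℕ → Carrier
      ψ d []      = 0#
      ψ d (k ∷ p) = (wₙ k * ι (Z n p)) * t ^ (d ∸ suc (length p))

    -- This is `E + t D`, as `M≈` confirms; the recursion anticipates `D (k ∷ ks) = wₙ k * M ks`, so
    -- that the latter can be stated before `D` is known.
    M : List ℕ → Carrier
    M []       = 1#
    M (k ∷ ks) = E n (k ∷ ks) + t * (wₙ k * M ks)

    E-suc : ∀ k ks → E (suc n) (k ∷ ks) ≈ E n (k ∷ ks) + sumOver (ψ (suc (length ks))) (fillings k ks)
    E-suc k ks = trans (sumOver-cong (fillings k ks) step) (sumOver-+ _ (ψ (suc (length ks))) (fillings k ks))
      where
      step : ∀ p → ι (Z (suc n) p) * t ^ (suc (length ks) ∸ length p)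
                 ≈ ι (Z n p) * t ^ (suc (length ks) ∸ length p) + ψ (suc (length ks)) p
      step []      = sym (+-identityʳ _)
      step (k ∷ p) = trans (*-congʳ (trans (⟦⟧-cong (Z-suc n k p))
        (trans (+-homo _ _) (+-congˡ (*-homo _ _))))) (distribʳ _ _ _)

    -- A merge lowers the depth by one and leaves one more factor `t`. The length bound, supplied by
    -- `length-fillings`, makes the truncated subtraction exact.
    ψ-shift : ∀ d p → length p ≤ d → ψ (suc d) p ≈ t * ψ d p
    ψ-shift d []      _     = sym (zeroʳ t)
    ψ-shift d (k ∷ p) len≤d = trans (*-congˡ (reflexive (≡.cong (t ^_) (ℕ.+-∸-assoc 1 len≤d))))
      (solve 3 (λ x t y → x :* (t :* y) := t :* (x :* y)) refl (wₙ k * ι (Z n p)) t _)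

    module _ (merge : ∀ i j → w (suc n) (suc i) K.* w (suc n) (suc j)
                              K.≈ w (suc n) (suc i ℕ.+ suc j) K.+ w (suc n) (i ℕ.+ suc j)) where

      -- Both merges of the first two entries have the same cofactor, and
      -- their weights add up to the product of the two separate weights.
      fillings-ψ : ∀ k ks → 0 < k → All (0 <_) ks →
                   sumOver (ψ (suc (length ks))) (fillings k ks) ≈ wₙ k * M ks
      fillings-ψ k [] _ _ = trans (+-identityʳ _) (trans (*-identityʳ _) (*-congˡ 1#-homo))
      fillings-ψ (suc i) (suc j ∷ ks) 0<k (0<k′ ∷ ps) = begin
        sumOver (ψ (suc d)) (map (k ∷_) (fillings k′ ks) ++ fillings (k ℕ.+ k′) ks ++ fillings (i ℕ.+ k′) ks)
          ≈⟨ trans (sumOver-++ (ψ (suc d)) (map (k ∷_) (fillings k′ ks)) _)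
               (+-congˡ (sumOver-++ (ψ (suc d)) (fillings (k ℕ.+ k′) ks) (fillings (i ℕ.+ k′) ks))) ⟩
        sumOver (ψ (suc d)) (map (k ∷_) (fillings k′ ks))
          + (sumOver (ψ (suc d)) (fillings (k ℕ.+ k′) ks) + sumOver (ψ (suc d)) (fillings (i ℕ.+ k′) ks))
          -- After a comma the remaining entries sit at smaller indices, hence the cofactor `E n`.
          -- After either merge the second entry sits at `n + 1` as well, hence a factor `t` and the
          -- cofactor `M ks`.
          ≈⟨ +-cong comma (+-cong (merged (k ℕ.+ k′) (s≤s z≤n)) (merged (i ℕ.+ k′) (ℕ.≤-trans (s≤s z≤n) (ℕ.m≤n+m k′ i)))) ⟩
        wₙ k * E n (k′ ∷ ks) + (t * (wₙ (k ℕ.+ k′) * M ks) + t * (wₙ (i ℕ.+ k′) * M ks))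
          ≈⟨ +-congˡ (solve 4 (λ t x y m → t :* (x :* m) :+ t :* (y :* m) := t :* ((x :+ y) :* m)) refl t _ _ (M ks)) ⟩
        wₙ k * E n (k′ ∷ ks) + t * ((wₙ (k ℕ.+ k′) + wₙ (i ℕ.+ k′)) * M ks)
          ≈⟨ +-congˡ (*-congˡ (*-congʳ (trans (sym (+-homo _ _)) (trans (⟦⟧-cong (K.sym (merge i j))) (*-homo _ _))))) ⟩
        wₙ k * E n (k′ ∷ ks) + t * ((wₙ k * wₙ k′) * M ks)
          ≈⟨ solve 5 (λ t x y m e → x :* e :+ t :* ((x :* y) :* m) := x :* (e :+ t :* (y :* m)))
               refl t (wₙ k) (wₙ k′) (M ks) _ ⟩
        wₙ k * (E n (k′ ∷ ks) + t * (wₙ k′ * M ks)) ∎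
        where
        k k′ d : ℕ
        k = suc i
        k′ = suc j
        d = suc (length ks)

        comma : sumOver (ψ (suc d)) (map (k ∷_) (fillings k′ ks)) ≈ wₙ k * E n (k′ ∷ ks)
        comma = trans (sumOver-map (ψ (suc d)) (k ∷_) (fillings k′ ks))
          (trans (sumOver-cong (fillings k′ ks) λ p → *-assoc _ _ _) (sumOver-* (wₙ k) _ (fillings k′ ks)))

        merged : ∀ k → 0 < k → sumOver (ψ (suc d)) (fillings k ks) ≈ t * (wₙ k * M ks)
        merged k 0<k = trans (sumOver-congᴬ (All.map (λ {p} → ψ-shift d p) (length-fillings k ks)))
          (trans (sumOver-* t (ψ d) (fillings k ks)) (*-congˡ (fillings-ψ k ks 0<k ps)))

      D : List ℕ → Carrier
      D ks = E (suc n) ks - E n ks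

      D-[] : D [] ≈ 0#
      D-[] = -‿inverseʳ 1#

      D-∷ : ∀ k ks → 0 < k → All (0 <_) ks → D (k ∷ ks) ≈ wₙ k * M ks
      D-∷ k ks 0<k ps = trans (+-congʳ (E-suc k ks))
        (trans (solve 2 (λ x y → x :+ y :- x := y) refl _ _) (fillings-ψ k ks 0<k ps))

      M≈ : ∀ ks → All (0 <_) ks → M ks ≈ E n ks + t * D ks
      M≈ []       _          = sym (trans (+-congˡ (trans (*-congˡ D-[]) (zeroʳ t))) (+-identityʳ 1#))
      M≈ (k ∷ ks) (0<k ∷ ps) = +-congˡ (*-congˡ (sym (D-∷ k ks 0<k ps)))

-- The weights at one summation index.

module Weights {c ℓ} (K : CommutativeRing c ℓ) where
  open CommutativeRing K
  open Exp commutativeSemiring using (_^_; ^-assocʳ; ^-distrib-*; ^-homo-*)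
  open Solver K
  open SetoidReasoning setoid

  module _ (q : Carrier) (x : ℕ → Carrier) where
    w : ℕ → ℕ → Carrier
    w m k = q ^ ((k ∸ 1) ℕ.* m) * x m ^ k

    y : ℕ → Carrier
    y m = q ^ m * x m

    w-suc : ∀ m i → w m (suc i) ≈ x m * y m ^ i
    w-suc m i = begin
      q ^ (i ℕ.* m) * (x m * x m ^ i)
        ≈⟨ *-congʳ (trans (reflexive (≡.cong (q ^_) (ℕ.*-comm i m))) (sym (^-assocʳ q m i))) ⟩
      (q ^ m) ^ i * (x m * x m ^ i)       ≈⟨ solve 3 (λ a b c → a :* (b :* c) := b :* (a :* c)) refl _ (x m) _ ⟩
      x m * ((q ^ m) ^ i * x m ^ i)       ≈⟨ *-congˡ (^-distrib-* (q ^ m) (x m) i) ⟨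
      x m * y m ^ i                       ∎

    IsInverse : ℕ → Set ℓ
    IsInverse m = x m * (1# - q ^ m) ≈ 1#

    x≈1+y : ∀ m → IsInverse m → x m ≈ 1# + y m
    x≈1+y m inv = trans (solve 2 (λ x Q → x := x :* (:1 :- Q) :+ Q :* x) refl (x m) (q ^ m)) (+-congʳ inv)

    -- It rests on `x = 1 + y`: one of the two factors `x` splits into the part that raises the
    -- exponent of `y` and the part that keeps it.
    w-merge : ∀ m → IsInverse m → ∀ i j →
      w m (suc i) * w m (suc j) ≈ w m (suc i ℕ.+ suc j) + w m (i ℕ.+ suc j)
    w-merge m inv i j = begin
      w m (suc i) * w m (suc j)
        ≈⟨ *-cong (w-suc m i) (w-suc m j) ⟩
      (x m * y m ^ i) * (x m * y m ^ j)
        ≈⟨ solve 4 (λ x x′ a b → (x :* a) :* (x′ :* b) := x :* (x′ :* (a :* b))) refl (x m) (x m) _ _ ⟩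
      x m * (x m * (y m ^ i * y m ^ j))
        ≈⟨ *-congˡ (*-cong (x≈1+y m inv) (sym (^-homo-* (y m) i j))) ⟩
      x m * ((1# + y m) * y m ^ (i ℕ.+ j))
        ≈⟨ solve 3 (λ x y a → x :* ((:1 :+ y) :* a) := x :* (y :* a) :+ x :* a) refl (x m) (y m) _ ⟩
      x m * y m ^ suc (i ℕ.+ j) + x m * y m ^ (i ℕ.+ j)
        ≈⟨ +-cong (w-suc m (suc (i ℕ.+ j))) (w-suc m (i ℕ.+ j)) ⟨
      w m (suc (suc (i ℕ.+ j))) + w m (suc (i ℕ.+ j))
        ≡⟨ ≡.cong (λ l → w m (suc l) + w m l) (ℕ.+-suc i j) ⟨
      w m (suc i ℕ.+ suc j) + w m (i ℕ.+ suc j) ∎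

module TruncatedSums {c ℓ₁ ℓ₂} (F : HeytingField c ℓ₁ ℓ₂) where
  open FieldDefs F using (NoSmallOrder; 1/1-; z̄)
  open HeytingField F using (_#_; #⇒invertible; #-sym; heytingCommutativeRing)
  K : CommutativeRing c ℓ₁
  K = HeytingCommutativeRing.commutativeRing heytingCommutativeRing
  open CommutativeRing K
  open Exp commutativeSemiring using (_^_; ^-congˡ)
  open SumProperties semiring using (sum-cong-≋)
  open Solver K
  open SetoidReasoning setoid

  module _ (q : Carrier) (x : ℕ → Carrier) where
    open Weights K using (w; IsInverse)
    open NestedSums K (w q x)

    -- Inverses are unique. The inverse inside `z̄` is built from an apartness proof that changes
    -- with the upper bound; comparing it with the function `x` removes this dependence.
    1/1-≈x : ∀ m (q^m#1 : q ^ m # 1#) → IsInverse q x m → 1/1- (q ^ m) q^m#1 ≈ x m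
    1/1-≈x m q^m#1 inv with #⇒invertible (#-sym q^m#1)
    ... | z , z*[1-Q]≈1 , _ = begin
      z                           ≈⟨ *-identityʳ z ⟨
      z * 1#                      ≈⟨ *-congˡ inv ⟨
      z * (x m * (1# - q ^ m))    ≈⟨ solve 3 (λ z x d → z :* (x :* d) := (z :* d) :* x) refl z (x m) (1# - q ^ m) ⟩
      (z * (1# - q ^ m)) * x m    ≈⟨ *-congʳ z*[1-Q]≈1 ⟩
      1# * x m                    ≈⟨ *-identityˡ _ ⟩
      x m                         ∎

    z̄≈Z : ∀ ks n (q#1 : NoSmallOrder (suc n) q) → (∀ m → 0 < m → m < suc n → IsInverse q x m) →
           z̄ (suc n) q q#1 ks ≈ Z n ks
    z̄≈Z []       n q#1 inv = refl
    z̄≈Z (k ∷ ks) n q#1 inv = sum-cong-≋ {n} λ i →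
      let m = suc (toℕ i)
          m<n = s≤s (Fin.toℕ<n i)
      in *-cong (*-congˡ {q ^ ((k ∸ 1) ℕ.* m)} (^-congˡ k (1/1-≈x m (q#1 m (s≤s z≤n) m<n) (inv m (s≤s z≤n) m<n))))
                (z̄≈Z ks (toℕ i) _ λ j 0<j j<m → inv j 0<j (ℕ.<-trans j<m m<n))

-- Invertibility and the algebra of the quotient.

module Invertibility {c ℓ} (R : CommutativeRing c ℓ) where
  open CommutativeRing R
  open Solver R
  open Products R

  invertible-intro : ∀ {x} y → y * x ≈ 1# → Invertible _≈_ 1# _*_ x
  invertible-intro y yx≈1 = y , yx≈1 , trans (*-comm _ y) yx≈1

  invertible-cancel : ∀ {a} → Invertible _≈_ 1# _*_ a → ∀ {x y} → a * x ≈ a * y → x ≈ y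
  invertible-cancel {a} (b , ba≈1 , _) {x} {y} eq = trans (sym (undo x)) (trans (*-congˡ eq) (undo y))
    where
    undo : ∀ x → b * (a * x) ≈ x
    undo x = trans (sym (*-assoc b a x)) (trans (*-congʳ ba≈1) (*-identityˡ x))

  invertible-product : ∀ k f → (∀ i → i < k → Invertible _≈_ 1# _*_ (f i)) → Invertible _≈_ 1# _*_ (product k f)
  invertible-product zero    f inv = invertible-intro 1# (*-identityˡ 1#)
  invertible-product (suc k) f inv =
    let (p , pP≈1 , _) = invertible-product k f λ i i<k → inv i (ℕ.m≤n⇒m≤1+n i<k)
        (g , gf≈1 , _) = inv k ℕ.≤-refl
    in invertible-intro (p * g) (trans
      (solve 4 (λ p g P F → (p :* g) :* (P :* F) := (p :* P) :* (g :* F)) refl p g (product k f) (f k))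
      (trans (*-cong pP≈1 gf≈1) (*-identityˡ 1#)))

module GeneratingAlgebra {c ℓ} (R : CommutativeRing c ℓ) where
  open CommutativeRing R
  open Solver R
  open Products R
  open Invertibility R
  open SetoidReasoning setoid

  opaque
    quadratic : (u₁ u₂ u₃ τ Q : Carrier) → Carrier
    quadratic u₁ u₂ u₃ τ Q = α * (Q * Q) - (α + β + τ * (u₃ - u₁ * u₂)) * Q + β
      where
      α β : Carrier
      α = 1# + u₁
      β = 1# - τ * u₂

    quadratic≈ : ∀ u₁ u₂ u₃ τ Q → quadratic u₁ u₂ u₃ τ Q
      ≈ (1# + u₁) * (Q * Q) - ((1# + u₁) + (1# - τ * u₂) + τ * (u₃ - u₁ * u₂)) * Q + (1# - τ * u₂)
    quadratic≈ u₁ u₂ u₃ τ Q = refl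

  module _ (u₁ u₂ u₃ : Carrier) where
    linear : (x y τ : Carrier) → Carrier
    linear x y τ = (1# - u₁ * y) - τ * (x * (u₂ * (1# - u₁ * y) + u₃ * y))

    -- Multiplying by `(1 - Q)²` clears the denominators of `linear`, since `x (1 - Q) = 1` and
    -- `y (1 - Q) = Q`.
    quadratic-factor : ∀ {x y Q} τ → x * (1# - Q) ≈ 1# → y ≈ Q * x →
      quadratic u₁ u₂ u₃ τ Q ≈ (1# - Q) * (1# - Q) * linear x y τ
    quadratic-factor {x} {y} {Q} τ inv y≈Qx = sym (begin
      (1# - Q) * (1# - Q) * linear x y τ
        ≈⟨ solve 7 (λ u₁ u₂ u₃ x y Q τ →
             (:1 :- Q) :* (:1 :- Q) :* ((:1 :- u₁ :* y) :- τ :* (x :* (u₂ :* (:1 :- u₁ :* y) :+ u₃ :* y)))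
             := (:1 :- Q) :* ((:1 :- Q) :- u₁ :* (y :* (:1 :- Q)))
                :- τ :* ((x :* (:1 :- Q)) :* (u₂ :* ((:1 :- Q) :- u₁ :* (y :* (:1 :- Q))) :+ u₃ :* (y :* (:1 :- Q)))))
             refl u₁ u₂ u₃ x y Q τ ⟩
      (1# - Q) * ((1# - Q) - u₁ * (y * (1# - Q)))
        - τ * ((x * (1# - Q)) * (u₂ * ((1# - Q) - u₁ * (y * (1# - Q))) + u₃ * (y * (1# - Q))))
        ≈⟨ +-cong (*-congˡ v≈) (-‿cong (*-congˡ (*-cong inv (+-cong (*-congˡ v≈) (*-congˡ y[1-Q]≈Q))))) ⟩
      (1# - Q) * ((1# - Q) - u₁ * Q) - τ * (1# * (u₂ * ((1# - Q) - u₁ * Q) + u₃ * Q))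
        ≈⟨ solve 5 (λ u₁ u₂ u₃ Q τ →
             (:1 :- Q) :* ((:1 :- Q) :- u₁ :* Q) :- τ :* (:1 :* (u₂ :* ((:1 :- Q) :- u₁ :* Q) :+ u₃ :* Q))
             := (:1 :+ u₁) :* (Q :* Q) :- ((:1 :+ u₁) :+ (:1 :- τ :* u₂) :+ τ :* (u₃ :- u₁ :* u₂)) :* Q :+ (:1 :- τ :* u₂))
             refl u₁ u₂ u₃ Q τ ⟩
      (1# + u₁) * (Q * Q) - ((1# + u₁) + (1# - τ * u₂) + τ * (u₃ - u₁ * u₂)) * Q + (1# - τ * u₂)
        ≈⟨ quadratic≈ u₁ u₂ u₃ τ Q ⟨
      quadratic u₁ u₂ u₃ τ Q ∎)
      where
      y[1-Q]≈Q : y * (1# - Q) ≈ Q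
      y[1-Q]≈Q = trans (*-congʳ y≈Qx) (trans (*-assoc Q x _) (trans (*-congˡ inv) (*-identityʳ Q)))

      v≈ : (1# - Q) - u₁ * (y * (1# - Q)) ≈ (1# - Q) - u₁ * Q
      v≈ = +-congˡ (-‿cong (*-congˡ y[1-Q]≈Q))

    -- In `(e + d) (Y - τ B)` the term `Y d` equals `B (e + τ d)`. Its part `τ B d` cancels and its
    -- part `B e` changes `τ` into `τ - 1`.
    transfer : ∀ {x y Q τ τ′ e e′ d m} → x * (1# - Q) ≈ 1# → y ≈ Q * x → τ′ ≈ τ - 1# →
      e′ ≈ e + d → m ≈ e + τ * d →
      (1# - u₁ * y) * d ≈ x * (u₂ * (1# - u₁ * y) + u₃ * y) * m →
      e′ * quadratic u₁ u₂ u₃ τ Q ≈ e * quadratic u₁ u₂ u₃ τ′ Q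
    transfer {x} {y} {Q} {τ} {τ′} {e} {e′} {d} {m} inv y≈Qx τ′≈ e′≈ m≈ resolvent≈ = begin
      e′ * quadratic u₁ u₂ u₃ τ Q
        ≈⟨ *-cong e′≈ (quadratic-factor τ inv y≈Qx) ⟩
      (e + d) * ((1# - Q) * (1# - Q) * (Y - τ * B))
        ≈⟨ solve 6 (λ e d P Y τ B → (e :+ d) :* (P :* P :* (Y :- τ :* B))
             := P :* P :* (e :* (Y :- τ :* B) :+ Y :* d :- τ :* B :* d)) refl e d (1# - Q) Y τ B ⟩
      (1# - Q) * (1# - Q) * (e * (Y - τ * B) + Y * d - τ * B * d)
        ≈⟨ *-congˡ (+-congʳ (+-congˡ (trans resolvent≈ (*-congˡ m≈)))) ⟩
      (1# - Q) * (1# - Q) * (e * (Y - τ * B) + B * (e + τ * d) - τ * B * d)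
        ≈⟨ solve 6 (λ e d P Y τ B → P :* P :* (e :* (Y :- τ :* B) :+ B :* (e :+ τ :* d) :- τ :* B :* d)
             := e :* (P :* P :* (Y :- (τ :- :1) :* B))) refl e d (1# - Q) Y τ B ⟩
      e * ((1# - Q) * (1# - Q) * (Y - (τ - 1#) * B))
        ≈⟨ *-congˡ (*-congˡ (+-congˡ (-‿cong (*-congʳ (sym τ′≈))))) ⟩
      e * ((1# - Q) * (1# - Q) * linear x y τ′)
        ≈⟨ *-congˡ (quadratic-factor τ′ inv y≈Qx) ⟨
      e * quadratic u₁ u₂ u₃ τ′ Q ∎
      where
      Y B : Carrier
      Y = 1# - u₁ * y
      B = x * (u₂ * Y + u₃ * y)

  telescope : ∀ k (e f g : ℕ → Carrier) → e 0 ≈ 1# → (∀ i → i < k → e (suc i) * f i ≈ e i * g i) →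
              e k * product k f ≈ product k g
  telescope zero    e f g e₀≈1 step = trans (*-identityʳ _) e₀≈1
  telescope (suc k) e f g e₀≈1 step = begin
    e (suc k) * (product k f * f k)   ≈⟨ solve 3 (λ a b c → a :* (b :* c) := b :* (a :* c)) refl _ _ _ ⟩
    product k f * (e (suc k) * f k)   ≈⟨ *-congˡ (step k ℕ.≤-refl) ⟩
    product k f * (e k * g k)         ≈⟨ solve 3 (λ a b c → b :* (a :* c) := (a :* b) :* c) refl _ _ _ ⟩
    (e k * product k f) * g k         ≈⟨ *-congʳ (telescope k e f g e₀≈1 λ i i<k → step i (ℕ.m≤n⇒m≤1+n i<k)) ⟩
    product k g * g k                 ∎

  IsQuotient : (e U U′ : Carrier) → Set (c ⊔ ℓ)
  IsQuotient e U U′ = Σ (Invertible _≈_ 1# _*_ U) λ inv → e ≈ U′ * proj₁ inv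

  IsQuotient-congˡ : ∀ {e e′ U U′} → e′ ≈ e → IsQuotient e U U′ → IsQuotient e′ U U′
  IsQuotient-congˡ e′≈e (inv , e≈) = inv , trans e′≈e e≈

  -- Invertibility passes from `P` to `U`, with inverse `n p`, and cancelling the unit `n` turns
  -- `e P = P′` into `e U = U′`.
  quotient : ∀ {n e P P′ U U′} → Invertible _≈_ 1# _*_ n → Invertible _≈_ 1# _*_ P →
    n * U ≈ P → n * U′ ≈ P′ → e * P ≈ P′ →
    IsQuotient e U U′
  quotient {n} {e} {P} {P′} {U} {U′} n-inv (p , pP≈1 , _) nU≈P nU′≈P′ eP≈P′ =
    invertible-intro (n * p) npU≈1 , e≈
    where
    npU≈1 : (n * p) * U ≈ 1#
    npU≈1 = trans (solve 3 (λ n p u → (n :* p) :* u := p :* (n :* u)) refl n p U) (trans (*-congˡ nU≈P) pP≈1)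

    eU≈U′ : e * U ≈ U′
    eU≈U′ = invertible-cancel n-inv (begin
      n * (e * U)   ≈⟨ solve 3 (λ n e u → n :* (e :* u) := e :* (n :* u)) refl n e U ⟩
      e * (n * U)   ≈⟨ *-congˡ nU≈P ⟩
      e * P         ≈⟨ eP≈P′ ⟩
      P′            ≈⟨ nU′≈P′ ⟨
      n * U′        ∎)

    e≈ : e ≈ U′ * (n * p)
    e≈ = begin
      e                    ≈⟨ *-identityʳ e ⟨
      e * 1#               ≈⟨ *-congˡ npU≈1 ⟨
      e * ((n * p) * U)    ≈⟨ solve 3 (λ e x u → e :* (x :* u) := (e :* u) :* x) refl e (n * p) U ⟩
      (e * U) * (n * p)    ≈⟨ *-congʳ eU≈U′ ⟩
      U′ * (n * p)         ∎

module _ {a b ℓ₁ ℓ₂} (K : CommutativeRing a ℓ₁) (R : CommutativeRing b ℓ₂)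
         {ι : CommutativeRing.Carrier K → CommutativeRing.Carrier R}
         (ι-hom : IsRingHomomorphism (CommutativeRing.rawRing K) (CommutativeRing.rawRing R) ι) where
  private
    module K  = CommutativeRing K
    module MK = SemiringMult K.semiring
  open CommutativeRing R
  open IsRingHomomorphism ι-hom
  open SemiringMult semiring using () renaming (_×_ to _·_)

  homomorphism-inverse : ∀ {x y} → x K.* y K.≈ K.1# → ι x * ι y ≈ 1#
  homomorphism-inverse xy≈1 = trans (sym (*-homo _ _)) (trans (⟦⟧-cong xy≈1) 1#-homo)

  homomorphism-× : ∀ m → ι (m MK.× K.1#) ≈ m · 1#
  homomorphism-× zero    = 0#-homo
  homomorphism-× (suc m) = trans (+-homo K.1# (m MK.× K.1#)) (+-cong 1#-homo (homomorphism-× m))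

  homomorphism-1-minus : ∀ x → ι (K.1# K.- x) ≈ 1# - ι x
  homomorphism-1-minus x = trans (homomorphism-minus K R ι-hom K.1# x) (+-congʳ 1#-homo)

  homomorphism-minus-1 : ∀ x → ι (x K.- K.1#) ≈ ι x - 1#
  homomorphism-minus-1 x = trans (homomorphism-minus K R ι-hom x K.1#) (+-congˡ (-‿cong 1#-homo))

  homomorphism-geometric : ∀ x y i → ι (x K.* Exp._^_ K.commutativeSemiring y i) ≈ ι x * Exp._^_ commutativeSemiring (ι y) i
  homomorphism-geometric x y i = trans (*-homo x _) (*-congˡ (homomorphism-^ K R ι-hom y i))

  homomorphism-inverse-1- : ∀ {x Q} → x K.* (K.1# K.- Q) K.≈ K.1# → ι x * (1# - ι Q) ≈ 1#
  homomorphism-inverse-1- {x} {Q} eq = trans (*-congˡ (sym (homomorphism-1-minus Q))) (homomorphism-inverse eq)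

module _ {a b ℓ₁ ℓ₂} (R : CommutativeRing a ℓ₁) (S : CommutativeRing b ℓ₂)
         {φ : CommutativeRing.Carrier R → CommutativeRing.Carrier S}
         (φ-hom : IsRingHomomorphism (CommutativeRing.rawRing R) (CommutativeRing.rawRing S) φ) where
  private
    module R = CommutativeRing R
  open CommutativeRing S
  open IsRingHomomorphism φ-hom
  open Solver S
  open SetoidReasoning setoid

  -- With the variables sent to 0, both `α` and `β` become 1 and `s` becomes 2. Applied to the
  -- constant term, this shows that each factor is an invertible series.
  homomorphism-quadratic-0 : ∀ {u₁ u₂ u₃} τ Q → φ u₁ ≈ 0# → φ u₂ ≈ 0# → φ u₃ ≈ 0# →
    φ (GeneratingAlgebra.quadratic R u₁ u₂ u₃ τ Q) ≈ (1# - φ Q) * (1# - φ Q)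
  homomorphism-quadratic-0 {u₁} {u₂} {u₃} τ Q u₁≈0 u₂≈0 u₃≈0 = begin
    φ (GeneratingAlgebra.quadratic R u₁ u₂ u₃ τ Q)
      ≈⟨ ⟦⟧-cong (GeneratingAlgebra.quadratic≈ R u₁ u₂ u₃ τ Q) ⟩
    φ (α R.* (Q R.* Q) R.- (α R.+ β R.+ w) R.* Q R.+ β)
      ≈⟨ homomorphism-quadratic R S φ-hom α β (α R.+ β R.+ w) Q ⟩
    φ α * (φ Q * φ Q) - φ (α R.+ β R.+ w) * φ Q + φ β
      ≈⟨ +-cong (+-cong (*-congʳ α≈1) (-‿cong (*-congʳ
           (trans (+-homo _ w) (+-cong (trans (+-homo α β) (+-cong α≈1 β≈1)) w≈0))))) β≈1 ⟩
    1# * (φ Q * φ Q) - (1# + 1# + 0#) * φ Q + 1#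
      ≈⟨ solve 1 (λ Q → :1 :* (Q :* Q) :- (:1 :+ :1 :+ con (0 , 0)) :* Q :+ :1 := (:1 :- Q) :* (:1 :- Q)) refl (φ Q) ⟩
    (1# - φ Q) * (1# - φ Q) ∎
    where
    α β w : R.Carrier
    α = R.1# R.+ u₁
    β = R.1# R.- τ R.* u₂
    w = τ R.* (u₃ R.- u₁ R.* u₂)

    α≈1 : φ α ≈ 1#
    α≈1 = trans (+-homo R.1# u₁) (trans (+-cong 1#-homo u₁≈0) (+-identityʳ 1#))

    τu₂≈0 : ∀ τ → φ (τ R.* u₂) ≈ 0#
    τu₂≈0 τ = trans (*-homo τ u₂) (trans (*-congˡ u₂≈0) (zeroʳ _))

    β≈1 : φ β ≈ 1#
    β≈1 = trans (homomorphism-1-minus R S φ-hom (τ R.* u₂)) (trans (+-congˡ (-‿cong (τu₂≈0 τ)))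
      (solve 0 (:1 :- con (0 , 0) := :1) refl))

    w≈0 : φ w ≈ 0#
    w≈0 = trans (*-homo τ _) (trans (*-congˡ (trans (homomorphism-minus R S φ-hom u₃ (u₁ R.* u₂))
      (+-cong u₃≈0 (-‿cong (τu₂≈0 u₁))))) (solve 1 (λ x → x :* (con (0 , 0) :- con (0 , 0)) := con (0 , 0)) refl (φ τ)))

module QuotientFormula {a b ℓ₁ ℓ₂} (K : CommutativeRing a ℓ₁) (R : CommutativeRing b ℓ₂)
    {ι : CommutativeRing.Carrier K → CommutativeRing.Carrier R}
    (ι-hom : IsRingHomomorphism (CommutativeRing.rawRing K) (CommutativeRing.rawRing R) ι)
    (u₁ u₂ u₃ : CommutativeRing.Carrier R) (k : ℕ) (inv : ℕ → CommutativeRing.Carrier K) where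
  private
    module K  = CommutativeRing K
    module EK = Exp K.commutativeSemiring
    module MK = SemiringMult K.semiring
  open CommutativeRing R
  open SemiringMult semiring using () renaming (_×_ to _·_)
  open GeneratingAlgebra R
  open Invertibility R
  open Products R
  open Explicit rawRing using (explicit)
  open ExplicitForm R using (explicit≈F)

  U : Carrier → Carrier
  U τ = explicit (λ e → ι (inv e)) (1# + u₁) (1# - τ * u₂) τ (u₃ - u₁ * u₂) (suc k)

  module _ (ζ : K.Carrier) where
    factor : Carrier → ℕ → Carrier
    factor τ i = quadratic u₁ u₂ u₃ τ (ι (ζ EK.^ suc i))

    module _ (inv-inverse : ∀ e → inv e K.* suc e MK.× K.1# K.≈ K.1#)
             (ζⁿ≈1 : ζ EK.^ suc k K.≈ K.1#)
             (regular : ∀ i → 0 < i → i < suc k → ∀ x → ζ EK.^ i K.* x K.≈ x → x K.≈ K.0#)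
             (α-invertible : Invertible _≈_ 1# _*_ (1# + u₁)) where

      ι-inverse : ∀ e → ι (inv e) * suc e · 1# ≈ 1#
      ι-inverse e = trans (*-congˡ (sym (homomorphism-× K R ι-hom (suc e))))
        (homomorphism-inverse K R ι-hom (inv-inverse e))

      -- Both sides equal `F` at `k + 1`: the left through the integer coefficients of `n Uₙ`, the
      -- right through the split quadratics.
      product≈U : ∀ τ → suc k · 1# * U τ ≈ product k (factor τ)
      product≈U τ = trans (explicit≈F (λ e → ι (inv e)) ι-inverse (1# + u₁) (1# - τ * u₂) τ (u₃ - u₁ * u₂) k)
        (sym (trans (product-cong k λ i → quadratic≈ u₁ u₂ u₃ τ (ι (ζ EK.^ suc i)))
          (product-quadratic K R ι-hom ζ k ζⁿ≈1 regular _ _ _ (invertible-cancel α-invertible))))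

      quotient-formula : ∀ τ τ′ (e : ℕ → Carrier) → (∀ i → i < k → Invertible _≈_ 1# _*_ (factor τ i)) →
        e 0 ≈ 1# → (∀ i → i < k → e (suc i) * factor τ i ≈ e i * factor τ′ i) →
        IsQuotient (e k) (U τ) (U τ′)
      quotient-formula τ τ′ e invertible e₀≈1 step = quotient
        (invertible-intro (ι (inv k)) (ι-inverse k)) (invertible-product k (factor τ) invertible)
        (product≈U τ) (product≈U τ′) (telescope k e (factor τ) (factor τ′) e₀≈1 step)

-- The generating function of the interpolated sums.

module GeneratingFunction {a b ℓ₁ ℓ₂} (K : CommutativeRing a ℓ₁) (A : CommutativeRing b ℓ₂)
    {κ : CommutativeRing.Carrier K → CommutativeRing.Carrier A}
    (κ-hom : IsRingHomomorphism (CommutativeRing.rawRing K) (CommutativeRing.rawRing A) κ)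
    (t : CommutativeRing.Carrier A) where
  private
    module K = CommutativeRing K
    module A = CommutativeRing A
    module S = TripleSeries A
    module IA = IsRingHomomorphism κ-hom
    module EK = Exp K.commutativeSemiring
  open Weights K using (w; y; w-suc; w-merge; IsInverse)
  open MultiIndexSums A
  open MultiIndexSumsProperties A

  R : CommutativeRing b ℓ₂
  R = S.tripleSeries
  private
    module R = CommutativeRing R

  constant-hom : IsRingHomomorphism A.rawRing R.rawRing S.constant
  constant-hom = Composition.isRingHomomorphism R.trans
    (Composition.isRingHomomorphism (CommutativeRing.trans S.PS₂₃.commutativeRing)
      S.PS₃.constant-isRingHomomorphism S.PS₂₃.constant-isRingHomomorphism)
    S.PS₁₂₃.constant-isRingHomomorphism

  constantTerm : R.Carrier → A.Carrier
  constantTerm f = f 0 0 0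

  constantTerm-hom : IsRingHomomorphism R.rawRing A.rawRing constantTerm
  constantTerm-hom = Composition.isRingHomomorphism A.trans
    (Composition.isRingHomomorphism (CommutativeRing.trans S.PS₃.commutativeRing)
      S.PS₁₂₃.constantTerm-isRingHomomorphism S.PS₂₃.constantTerm-isRingHomomorphism)
    S.PS₃.constantTerm-isRingHomomorphism

  ι : K.Carrier → R.Carrier
  ι a = S.constant (κ a)

  ι-hom : IsRingHomomorphism K.rawRing R.rawRing ι
  ι-hom = Composition.isRingHomomorphism R.trans κ-hom constant-hom

  invertible-series : ∀ f → Invertible A._≈_ A.1# A._*_ (constantTerm f) → Invertible R._≈_ R.1# R._*_ f
  invertible-series f inv = S.PS₁₂₃.invertible f (S.PS₂₃.invertible (f 0) (S.PS₃.invertible (f 0 0) inv))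

  sumOver-zero : ∀ {x} {X : Set x} {φ : X → A.Carrier} → (∀ x → φ x A.≈ A.0#) → ∀ xs → sumOver φ xs A.≈ A.0#
  sumOver-zero eq []       = A.refl
  sumOver-zero eq (x ∷ xs) = A.trans (A.+-cong (eq x) (sumOver-zero eq xs)) (A.+-identityˡ _)

  sumOver-fillings-zero : ∀ {φ : List ℕ → A.Carrier} → (∀ k p → φ (k ∷ p) A.≈ A.0#) →
    ∀ k ks → sumOver φ (fillings k ks) A.≈ A.0#
  sumOver-fillings-zero {φ} eq k []        = A.trans (A.+-identityʳ _) (eq k [])
  sumOver-fillings-zero {φ} eq k (k′ ∷ ks) = A.trans
    (A.trans (sumOver-++ φ (map (k ∷_) (fillings k′ ks)) _)
      (A.+-cong (A.trans (sumOver-map φ (k ∷_) (fillings k′ ks)) (sumOver-zero (eq k) (fillings k′ ks)))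
        (A.trans (sumOver-++ φ (fillings (k ℕ.+ k′) ks) _)
          (A.+-cong (sumOver-fillings-zero eq (k ℕ.+ k′) ks) (sumOver-fillings-zero eq (k ∸ 1 ℕ.+ k′) ks)))))
    (A.trans (A.+-identityˡ _) (A.+-identityˡ _))

  T∑-zero : ∀ l a b c {φ} → (∀ ks → φ ks A.≈ A.0#) → T∑ l a b c φ A.≈ A.0#
  T∑-zero l a b c {φ} eq = A.trans
    (T∑-cong l a b c {φ} {λ ks → A.0# A.* φ ks} λ ks _ → A.trans (eq ks) (A.sym (A.zeroˡ _)))
    (A.trans (T∑-* A.0# l a b c φ) (A.zeroˡ _))

  T∑-suc-zero : ∀ l a b c {φ} → (∀ k ks → φ (k ∷ ks) A.≈ A.0#) → T∑ (suc l) a b c φ A.≈ A.0#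
  T∑-suc-zero l a b c {φ} eq = A.trans (A.+-cong (first b) (later c)) (A.+-identityˡ _)
    where
    first : ∀ b → previous b (λ b′ → T∑ l a b′ c (λ ks → φ (1 ∷ ks))) A.≈ A.0#
    first zero    = A.refl
    first (suc b) = T∑-zero l a b c (eq 1)

    later : ∀ c → previous c (λ c′ → SumProperties.sum A.semiring {suc a} λ i →
      T∑ l (a ∸ toℕ i) b c′ (λ ks → φ (suc (suc (toℕ i)) ∷ ks))) A.≈ A.0#
    later zero    = A.refl
    later (suc c) = sum-zero (suc a) λ i → T∑-zero l (a ∸ toℕ i) b c (eq (suc (suc (toℕ i))))

  -- The start of the telescoping: with no summation index available only the empty multi-index
  -- contributes, and all of its exponents are 0.
  generating-1 : ∀ φ → φ [] A.≈ A.1# → (∀ k ks → φ (k ∷ ks) A.≈ A.0#) → S.generating φ R.≈ R.1#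
  generating-1 φ φ[] φ∷ zero    zero    zero    = φ[]
  generating-1 φ φ[] φ∷ (suc a) zero    zero    = A.refl
  generating-1 φ φ[] φ∷ zero    zero    (suc c) = T∑-suc-zero c 0 0 (suc c) {φ} φ∷
  generating-1 φ φ[] φ∷ (suc a) zero    (suc c) = T∑-suc-zero c (suc a) 0 (suc c) {φ} φ∷
  generating-1 φ φ[] φ∷ zero    (suc b) c       = T∑-suc-zero (b ℕ.+ c) 0 (suc b) c {φ} φ∷
  generating-1 φ φ[] φ∷ (suc a) (suc b) c       = T∑-suc-zero (b ℕ.+ c) (suc a) (suc b) c {φ} φ∷

  module _ (ζ : K.Carrier) (x : ℕ → K.Carrier) where
    open Interpolated K A κ-hom t (w ζ x) using (E; M; D; D-[]; D-∷; M≈)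
    open GeneratingAlgebra R

    factor : A.Carrier → ℕ → R.Carrier
    factor τ i = quadratic S.u₁ S.u₂ S.u₃ (S.constant τ) (ι (ζ EK.^ suc i))

    generating-step : ∀ m → IsInverse ζ x (suc m) →
      S.generating (E (suc m)) R.* factor t m R.≈ S.generating (E m) R.* factor (t A.- A.1#) m
    generating-step m inv = transfer S.u₁ S.u₂ S.u₃
      {ι (x (suc m))} {ι (y ζ x (suc m))} {ι (ζ EK.^ suc m)} {S.constant t} {S.constant (t A.- A.1#)}
      {S.generating (E m)} {S.generating (E (suc m))} {S.generating Dₘ} {S.generating (M m)}
      (homomorphism-inverse-1- K R ι-hom {x (suc m)} {ζ EK.^ suc m} inv)
      (IsRingHomomorphism.*-homo ι-hom (ζ EK.^ suc m) (x (suc m)))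
      (homomorphism-minus-1 A R constant-hom t)
      (λ a b c → A.trans (T∑-cong (b ℕ.+ c) a b c {E (suc m)} {λ ks → E m ks A.+ Dₘ ks}
        (λ ks _ → E-suc≈ (E (suc m) ks) (E m ks)))
        (T∑-+ (b ℕ.+ c) a b c (E m) Dₘ))
      (λ a b c → A.trans (T∑-cong (b ℕ.+ c) a b c {M m} {λ ks → E m ks A.+ t A.* Dₘ ks} (M≈ m merge))
        (A.trans (T∑-+ (b ℕ.+ c) a b c (E m) (λ ks → t A.* Dₘ ks)) (A.+-congˡ
          (A.trans (T∑-* t (b ℕ.+ c) a b c Dₘ) (A.sym (S.constant-* t (S.generating Dₘ) a b c))))))
      (S.generating-resolvent (κ (x (suc m))) (κ (y ζ x (suc m))) Dₘ (M m) (D-[] m merge)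
        (λ i ks ps → A.trans (D-∷ m merge (suc i) ks (s≤s z≤n) ps) (A.*-congʳ (A.trans
          (IA.⟦⟧-cong (w-suc ζ x (suc m) i)) (homomorphism-geometric K A κ-hom (x (suc m)) (y ζ x (suc m)) i))))
        (IsRingHomomorphism.*-homo constant-hom (κ (x (suc m))) (κ (y ζ x (suc m)))))
      where
      merge = w-merge ζ x (suc m) inv
      Dₘ : List ℕ → A.Carrier
      Dₘ = D m merge

      E-suc≈ : ∀ e′ e → e′ A.≈ e A.+ (e′ A.- e)
      E-suc≈ = solve 2 (λ e′ e → e′ := e :+ (e′ :- e)) A.refl
        where open Solver A

    E-0 : ∀ k ks → E 0 (k ∷ ks) A.≈ A.0#
    E-0 k ks = sumOver-fillings-zero (λ k p → A.trans (A.*-congʳ IA.0#-homo) (A.zeroˡ _)) k ks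

    -- A series is invertible once its constant term is; here that term is `(1 - Q)²`, with inverse
    -- `x²`.
    factor-invertible : ∀ τ i → IsInverse ζ x (suc i) → Invertible R._≈_ R.1# R._*_ (factor τ i)
    factor-invertible τ i inv = invertible-series (factor τ i) (invertible-intro (κ (x (suc i)) A.* κ (x (suc i)))
      (A.trans (A.*-congˡ (homomorphism-quadratic-0 R A constantTerm-hom
        {S.u₁} {S.u₂} {S.u₃} (S.constant τ) (ι Q) A.refl A.refl A.refl))
        (A.trans (regroup (κ (x (suc i))) (A.1# A.- κ Q)) (A.trans (A.*-cong xQ≈1 xQ≈1) (A.*-identityˡ A.1#)))))
      where
      open Invertibility A
      Q : K.Carrier
      Q = ζ EK.^ suc i

      xQ≈1 : κ (x (suc i)) A.* (A.1# A.- κ Q) A.≈ A.1#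
      xQ≈1 = homomorphism-inverse-1- K A κ-hom inv

      regroup : ∀ x d → (x A.* x) A.* (d A.* d) A.≈ (x A.* d) A.* (x A.* d)
      regroup = solve 2 (λ x d → (x :* x) :* (d :* d) := (x :* d) :* (x :* d)) A.refl
        where open Solver A

    -- The form in which the product over the roots of unity uses that `1 - ζᵐ` is invertible: only
    -- 0 is fixed under multiplication by `ζᵐ`.
    regular : ∀ m → IsInverse ζ x m → ∀ z → ζ EK.^ m K.* z K.≈ z → z K.≈ K.0#
    regular m inv z Qz≈z = begin
      z                                      ≈⟨ K.*-identityˡ z ⟨
      K.1# K.* z                             ≈⟨ K.*-congʳ inv ⟨
      x m K.* (K.1# K.- ζ EK.^ m) K.* z
        ≈⟨ solve 3 (λ x Q z → x :* (:1 :- Q) :* z := x :* (z :- Q :* z)) K.refl (x m) (ζ EK.^ m) z ⟩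
      x m K.* (z K.- ζ EK.^ m K.* z)         ≈⟨ K.*-congˡ (K.+-congˡ (K.-‿cong Qz≈z)) ⟩
      x m K.* (z K.- z)                      ≈⟨ solve 2 (λ x z → x :* (z :- z) := con (0 , 0)) K.refl (x m) z ⟩
      K.0#                                   ∎
      where
      open SetoidReasoning K.setoid
      open Solver K

    module _ (k : ℕ) (inverse : ∀ m → 0 < m → m < suc k → IsInverse ζ x m) (ζⁿ≈1 : ζ EK.^ suc k K.≈ K.1#)
             (inv : ℕ → K.Carrier) (inv-inverse : ∀ e → inv e K.* SemiringMult._×_ K.semiring (suc e) K.1# K.≈ K.1#) where
      open Explicit R.rawRing using (explicit)

      α-invertible : Invertible R._≈_ R.1# R._*_ (R.1# R.+ S.u₁)
      α-invertible = invertible-series (R.1# R.+ S.u₁) (Invertibility.invertible-intro A A.1#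
        (A.trans (A.*-identityˡ _) (A.+-identityʳ A.1#)))

      U : A.Carrier → R.Carrier
      U τ = explicit (λ e → ι (inv e)) (R.1# R.+ S.u₁) (R.1# R.- S.constant τ R.* S.u₂)
        (S.constant τ) (S.u₃ R.- S.u₁ R.* S.u₂) (suc k)

      generating-quotient : IsQuotient (S.generating (E k)) (U t) (U (t A.- A.1#))
      generating-quotient = QuotientFormula.quotient-formula K R ι-hom S.u₁ S.u₂ S.u₃ k inv
        ζ inv-inverse ζⁿ≈1 (λ i 0<i i<n → regular i (inverse i 0<i i<n)) α-invertible
        (S.constant t) (S.constant (t A.- A.1#)) (λ m → S.generating (E m))
        (λ i i<k → factor-invertible t i (inverse (suc i) (s≤s z≤n) (s≤s i<k)))
        (generating-1 (E 0) A.refl E-0)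
        (λ m m<k → generating-step m (inverse (suc m) (s≤s z≤n) (s≤s m<k)))

-- Specialisation to the field and its polynomials in `t`.

module _ {c ℓ₁ ℓ₂} (F : HeytingField c ℓ₁ ℓ₂) where
  open FieldDefs F renaming (_×_ to _·_)
  open TruncatedSums F using (K; z̄≈Z)
  private
    module K = CommutativeRing K
    module P = PolynomialRing K
    A : CommutativeRing c ℓ₁
    A = P.commutativeRing
    module A = CommutativeRing A
    module S = TripleSeries A
    module R = RawRing K[t]⟦u₁,u₂,u₃⟧
  open HeytingField F using (Carrier; #⇒invertible; #-sym)
  open Weights K using (w; IsInverse)
  open MultiIndexSums A using (sumOver-cong)
  open MultiIndexSumsProperties A using (multiIndices-T∑)
  open Explicit K[t]⟦u₁,u₂,u₃⟧ using (explicit)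

  explicitU : CharacteristicZero → ℕ → RawRing.Carrier K[t] → R.Carrier
  explicitU char0 n τ = explicit (λ e → constant (K[t].constant (1/suc char0 e)))
    (R.1# R.+ u₁) (R.1# R.+ (R.- (constant τ R.* u₂))) (constant τ) (u₃ R.+ (R.- (u₁ R.* u₂))) n

  opaque
    unfolding explicit

    -- The passage between the opaque form and `U` is made at a variable `τ`, so neither `t` nor
    -- `t - 1` enters the unfolding.
    explicitU≡U : ∀ char0 n τ → explicitU char0 n τ ≡ U char0 n τ
    explicitU≡U char0 n τ = ≡.refl

  1/suc-inverse : ∀ char0 e → 1/suc char0 e K.* suc e · K.1# K.≈ K.1#
  1/suc-inverse char0 e with #⇒invertible (char0 e)
  ... | i , i*[s-0]≈1 , _ =
      K.trans (K.*-congˡ (K.sym (K.trans (K.+-congˡ (RingProperties.-0#≈0# K.ring)) (K.+-identityʳ _)))) i*[s-0]≈1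

  module _ (n : ℕ) (ζ : Carrier) (q#1 : NoSmallOrder n ζ) where
    -- 1/(1 - ζᵐ) for 0 < m < n, and 0 elsewhere.
    1/[1-ζ^_] : ℕ → Carrier
    1/[1-ζ^ zero  ] = K.0#
    1/[1-ζ^ suc m ] with suc m ℕ.<? n
    ... | yes m<n = 1/1- (ζ ^ suc m) (q#1 (suc m) (s≤s z≤n) m<n)
    ... | no  _   = K.0#

    1/[1-ζ^]-inverse : ∀ m → 0 < m → m < n → IsInverse ζ 1/[1-ζ^_] m
    1/[1-ζ^]-inverse (suc m) _ m<n with suc m ℕ.<? n
    ... | yes p   = proj₁ (proj₂ (#⇒invertible (#-sym (q#1 (suc m) (s≤s z≤n) p))))
    ... | no  m≮n = contradiction m<n m≮n

  module _ (k : ℕ) (ζ : Carrier) (q#1 : NoSmallOrder (suc k) ζ) where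
    private
      x : ℕ → Carrier
      x = 1/[1-ζ^_] (suc k) ζ q#1
    open Interpolated K A P.constant-isRingHomomorphism P.X (w ζ x) using (E)
    open NestedSums K (w ζ x) using (Z)

    -- The strict bound `m₁ < k + 1` in `z̄` is the inclusive bound `k` in `E`; the powers of `t`
    -- agree term by term over the same fillings.
    z̄ᵗ≈E : ∀ ks → z̄ᵗ (suc k) ζ q#1 ks A.≈ E k ks
    z̄ᵗ≈E []       = A.refl {A.1#}
    z̄ᵗ≈E (j ∷ ks) = sumOver-cong
      {φ = λ p → K[t].constant (z̄ (suc k) ζ q#1 p) A.* power p}
      {ψ = λ p → K[t].constant (Z k p) A.* power p}
      (fillings j ks) λ p → A.*-congʳ {power p}
        {K[t].constant (z̄ (suc k) ζ q#1 p)} {K[t].constant (Z k p)}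
        (IsRingHomomorphism.⟦⟧-cong P.constant-isRingHomomorphism
          (z̄≈Z ζ x p k q#1 (1/[1-ζ^]-inverse (suc k) ζ q#1)))
      where
      power : List ℕ → A.Carrier
      power p = Exp._^_ A.commutativeSemiring P.X (suc (length ks) ∸ length p)

    generatingFunction≈ : generatingFunction (suc k) ζ q#1 R.≈ S.generating (E k)
    generatingFunction≈ = multiIndices-T∑ {z̄ᵗ (suc k) ζ q#1} {E k} z̄ᵗ≈E

  open GeneratingAlgebra S.tripleSeries using (IsQuotient; IsQuotient-congˡ)

  explicit-formula : ∀ {τ τ′} → τ ≡ t → τ′ ≡ t-1 →
    (char0 : CharacteristicZero) (n : ℕ) → 0 < n → (ζ : Carrier) (prim : IsPrimitiveRoot n ζ) →
    IsQuotient (generatingFunction n ζ (IsPrimitiveRoot.noSmallOrder prim)) (explicitU char0 n τ) (explicitU char0 n τ′)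
  explicit-formula ≡.refl ≡.refl char0 (suc k) _ ζ prim = IsQuotient-congˡ
    {S.generating (Interpolated.E K A P.constant-isRingHomomorphism P.X (w ζ (1/[1-ζ^_] (suc k) ζ noSmallOrder)) k)}
    {generatingFunction (suc k) ζ noSmallOrder} {explicitU char0 (suc k) t} {explicitU char0 (suc k) t-1}
    (generatingFunction≈ k ζ noSmallOrder)
    (GeneratingFunction.generating-quotient K A P.constant-isRingHomomorphism P.X ζ
      (1/[1-ζ^_] (suc k) ζ noSmallOrder) k (1/[1-ζ^]-inverse (suc k) ζ noSmallOrder) ζⁿ≈1
      (1/suc char0) (1/suc-inverse char0))
    where open IsPrimitiveRoot prim

  formula : ∀ {τ τ′} ⦃ _ : τ ≡ t ⦄ ⦃ _ : τ′ ≡ t-1 ⦄ → (char0 : CharacteristicZero) (n : ℕ) → 0 < n →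
    (ζ : HeytingField.Carrier F) (prim : IsPrimitiveRoot n ζ) →
    Σ (Invertible R._≈_ R.1# R._*_ (U char0 n τ)) λ invertible →
      generatingFunction n ζ (IsPrimitiveRoot.noSmallOrder prim) R.≈ U char0 n τ′ R.* proj₁ invertible
  formula {τ} {τ′} ⦃ eq ⦄ ⦃ eq′ ⦄ char0 n 0<n ζ prim =
    ≡.subst₂ (IsQuotient (generatingFunction n ζ (IsPrimitiveRoot.noSmallOrder prim)))
    (explicitU≡U char0 n τ) (explicitU≡U char0 n τ′) (explicit-formula eq eq′ char0 n 0<n ζ prim)

-- Resolving τ ≡ t and τ′ ≡ t-1 by instance search, with τ and τ′ read off the
-- expected type, spares the comparison of two unfoldings of U at t.
instance
  reflexivity : ∀ {a} {A : Set a} {x : A} → x ≡.≡ x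
  reflexivity = ≡.refl

theorem1p3 :
    ∀ {c ℓ₁ ℓ₂} (K : HeytingField c ℓ₁ ℓ₂) →
    let open FieldDefs K
        open RawRing K[t]⟦u₁,u₂,u₃⟧
    in
    (char0 : CharacteristicZero) (n : ℕ) → 0 < n →
    (ζ : HeytingField.Carrier K) (prim : IsPrimitiveRoot n ζ) →
    Σ (Invertible _≈_ 1# _*_ (U char0 n t)) λ invertible →
      generatingFunction n ζ (IsPrimitiveRoot.noSmallOrder prim)
        ≈ U char0 n t-1 * proj₁ invertible
theorem1p3 K char0 n p ζ prim = formula K char0 n p ζ prim
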